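{- Every valid scene has a trajectory.
   Context: A list assignment $L$ gives each vertex $v$ a set $L(v)$ of colors; an $L$-coloring is a proper coloring with $\varphi(v)\in L(v)$. A sequence of recolorings $(v_1,c_1),\ldots,(v_m,c_m)$ successively changes the color of $v_i$ to $c_i$; it is proper if all intermediate colorings are proper colorings of the graph, once-only if each vertex is recolored at most once; for an induced subgraph $H$, it is $H$-late if all recolorings of vertices outside $V(H)$ precede all recolorings of vertices of $H$. An $(L_1,L_2)$-trajectory in a graph $G$ starting with $\varphi_0$ is a triple $(\varphi_0,\varphi_1,\varphi_2)$ where $\varphi_0$ is a proper coloring of $G$ and, for $i\in\{1,2\}$, $\varphi_i$ is an $L_i$-coloring obtained from $\varphi_{i-1}$ by a proper once-only sequence of recolorings. For an induced subgraph $H$ of $G$, an $(L_1,L_2)$-trajectory $\vec{\delta}$ in $H$ lifts to an $(L_1,L_2)$-trajectory $\vec{\varphi}$ in $G$ if $\delta_i=\varphi_i\restriction V(H)$ for $i=0,1,2$ and for $i\in\{1,2\}$ there is a proper once-only $H$-late sequence of recolorings of $G$ transforming $\varphi_{i-1}$ into $\varphi_i$. A scene $S=(G,H,L_1,L_2,\varphi_0,\vec{\delta})$ consists of a plane graph $G$, an induced subgraph $H$ of $G$ whose vertices are consecutive in the boundary of the outer face of $G$ (possibly $H$ empty), list assignments $L_1,L_2$ for $G$, a proper coloring $\varphi_0$ of $G$, and an $(L_1,L_2)$-trajectory $\vec{\delta}$ in $H$ starting with $\varphi_0\restriction V(H)$. The scene has a trajectory if $\vec{\delta}$ lifts to an $(L_1,L_2)$-trajectory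 in $G$ starting with $\varphi_0$. A vertex is internal if it is not incident with the outer face. The scene is valid if $|V(H)|\le 3$ and: (Ga) for each $v\in V(G)$, $|L_1(v)\setminus L_2(v)|\le 1$, $|L_1(v)|\ge 6$ and $|L_2(v)|\ge 7$; (Gb) for each internal $v$, $|L_1(v)|\ge 10$ and $|L_2(v)|\ge 9$; (Gc) if $|V(H)|=3$ and $v\in V(G)$ is adjacent to all vertices of $H$, then $L_1(v)\neq\bigcup_{u\in V(H)}\{\delta_0(u),\delta_1(u)\}$. -}

module Defs where

open import Data.Nat using (ℕ; zero; suc; _+_; _*_; _≤_; _≤ᵇ_)
open import Data.Fin using (Fin; toℕ) renaming (_≟_ to _≟ᶠ_)
open import Data.Bool using (Bool; true; false; _∧_; _∨_; not; if_then_else_; T)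
open import Data.List using (List; []; _∷_; _++_; map; length; allFin; upTo)
import Data.Bool.ListAction as BL
open import Data.Nat.ListAction using (sum)
import Data.List as L
open import Data.List.Membership.Propositional using (_∈_)
open import Data.List.Relation.Unary.All using (All)
open import Data.List.Relation.Unary.Unique.Propositional using (Unique)
open import Data.Product using (Σ; ∃; ∃-syntax; _×_; _,_; proj₁)
open import Data.Sum using (_⊎_)
open import Data.Unit using (⊤)
open import Relation.Nullary using (¬_; does)
open import Relation.Binary.PropositionalEquality using (_≡_; _≢_)
open import Function.Bundles using (_⇔_)

anyFin : ∀ {m} → (Fin m → Bool) → Bool
anyFin {m} f = BL.any f (allFin m)

allFinB : ∀ {m} → (Fin m → Bool) → Bool
allFinB {m} f = BL.all f (allFin m)

countFin : ∀ {m} → (Fin m → Bool) → ℕ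
countFin {m} f = sum (map (λ i → if f i then 1 else 0) (allFin m))

eqF : ∀ {m} → Fin m → Fin m → Bool
eqF a b = does (a ≟ᶠ b)

iter : ∀ {A : Set} → (A → A) → ℕ → A → A
iter f zero    x = x
iter f (suc k) x = f (iter f k x)

-- Combinatorial maps (rotation systems) of simple graphs on vertex set Fin n.
-- Darts = Fin d (each edge gives two opposite darts); rev = opposite dart;
-- next = cyclic successor of a dart in the rotation around its tail.

record Map (n : ℕ) : Set where
  field
    d          : ℕ
    tail       : Fin d → Fin n
    rev        : Fin d → Fin d
    next       : Fin d → Fin d
    prev       : Fin d → Fin d
    rev-invol  : ∀ x → rev (rev x) ≡ x
    next-prev  : ∀ x → next (prev x) ≡ x
    prev-next  : ∀ x → prev (next x) ≡ x
    next-tail  : ∀ x → tail (next x) ≡ tail x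
    rot-cycle  : ∀ x y → tail x ≡ tail y → ∃[ k ] iter next k x ≡ y
    no-loop    : ∀ x → tail (rev x) ≢ tail x
    no-multi   : ∀ x y → tail x ≡ tail y → tail (rev x) ≡ tail (rev y) → x ≡ y

  head : Fin d → Fin n
  head x = tail (rev x)

  -- face permutation; the boundary walk of the face of x visits
  -- tail x, tail (φ x), tail (φ (φ x)), ...
  φ : Fin d → Fin d
  φ x = next (rev x)

  Adj : Fin n → Fin n → Set
  Adj u v = ∃[ x ] (tail x ≡ u × head x ≡ v)

  sameFaceB : Fin d → Fin d → Bool
  sameFaceB x y = anyFin (λ (k : Fin d) → eqF (iter φ (toℕ k) x) y)

  faceRepB : Fin d → Bool
  faceRepB x = allFinB (λ (k : Fin d) → toℕ x ≤ᵇ toℕ (iter φ (toℕ k) x))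

  #faces : ℕ
  #faces = countFin faceRepB

  adjB : Fin n → Fin n → Bool
  adjB u v = anyFin (λ x → eqF (tail x) u ∧ eqF (head x) v)

  reachB : ℕ → Fin n → Fin n → Bool
  reachB zero    u v = eqF u v
  reachB (suc k) u v = reachB k u v ∨ anyFin (λ w → reachB k u w ∧ adjB w v)

  connB : Fin n → Fin n → Bool
  connB = reachB n

  compRepB : Fin n → Bool
  compRepB v = allFinB (λ w → not (connB v w) ∨ (toℕ v ≤ᵇ toℕ w))

  #components : ℕ
  #components = countFin compRepB

  isolatedB : Fin n → Bool
  isolatedB v = not (anyFin (λ x → eqF (tail x) v))

  #isolated : ℕ
  #isolated = countFin isolatedB

  -- Euler's formula summed over components (isolated vertices have no
  -- map-face): n - E + F + I = 2C with E = d/2.  Since every component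
  -- has genus >= 0, this holds iff every component has genus 0.
  Genus0 : Set
  Genus0 = 2 * n + 2 * #faces + 2 * #isolated ≡ d + 4 * #components

-- Plane graphs: a genus-0 rotation system together with the outer face.
-- The outer face is described by the darts lying on it (a union of
-- face orbits, at most one per component) and by the isolated vertices
-- lying in it.

record PlaneGraph (n : ℕ) : Set where
  field
    rot      : Map n
  open Map rot public
  field
    genus0   : Genus0
    outer    : Fin d → Bool
    outerIso : Fin n → Bool
    outer-closed : ∀ x → outer (φ x) ≡ outer x
    outer-one    : ∀ x y → T (outer x) → T (outer y) →
                   T (connB (tail x) (tail y)) → T (sameFaceB x y)

  OnOuter : Fin n → Set
  OnOuter v = (T (isolatedB v) × T (outerIso v)) ⊎ (∃[ x ] (tail x ≡ v × T (outer x)))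

  OuterLevel : Fin n → Set
  OuterLevel v = ∃[ w ] (T (connB v w) × OnOuter w)

  field
    -- realisability of the nesting of components
    outer-nonempty : (v : Fin n) → ∃[ w ] OnOuter w
    nested-ok      : (∃[ v ] ¬ OuterLevel v) →
                     ∃[ x ] (outer x ≡ false × OuterLevel (tail x))

  Internal : Fin n → Set
  Internal v = ¬ OnOuter v

  ConsecutiveOnOuter : List (Fin n) → Set
  ConsecutiveOnOuter hs =
    (hs ≡ []) ⊎ (∃[ v ] (hs ≡ v ∷ [] × OnOuter v)) ⊎
    (∃[ x ] (T (outer x) × hs ≡ L.map (λ i → tail (iter φ i x)) (upTo (length hs))))

module Coloring {n : ℕ} (Adj : Fin n → Fin n → Set) where

  Col : Set
  Col = Fin n → ℕ

  ListAssignment : Set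
  ListAssignment = Fin n → List ℕ

  ProperOn : (Fin n → Set) → Col → Set
  ProperOn S c = ∀ u v → S u → S v → Adj u v → c u ≢ c v

  LColOn : (Fin n → Set) → ListAssignment → Col → Set
  LColOn S L c = ProperOn S c × (∀ v → S v → c v ∈ L v)

  Recoloring : Set
  Recoloring = List (Fin n × ℕ)

  update : Col → Fin n → ℕ → Col
  update c v a w = if eqF w v then a else c w

  apply : Col → Recoloring → Col
  apply c []             = c
  apply c ((v , a) ∷ rs) = apply (update c v a) rs

  ProperSeqOn : (Fin n → Set) → Col → Recoloring → Set
  ProperSeqOn S c []             = ⊤
  ProperSeqOn S c ((v , a) ∷ rs) =
    S v × ProperOn S (update c v a) × ProperSeqOn S (update c v a) rs

  OnceOnly : Recoloring → Set
  OnceOnly rs = Unique (L.map proj₁ rs)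

  Transforms : (Fin n → Set) → Col → Col → Recoloring → Set
  Transforms S c c' rs =
    ProperSeqOn S c rs × OnceOnly rs × (∀ v → S v → apply c rs v ≡ c' v)

  Late : (Fin n → Set) → Recoloring → Set
  Late H rs = ∃[ xs ] ∃[ ys ] (rs ≡ xs ++ ys ×
              All (λ p → ¬ H (proj₁ p)) xs × All (λ p → H (proj₁ p)) ys)

  Everything : Fin n → Set
  Everything _ = ⊤

  TrajectoryOn : (Fin n → Set) → ListAssignment → ListAssignment →
                 Col → Col → Col → Set
  TrajectoryOn S L1 L2 c0 c1 c2 =
    ProperOn S c0 × LColOn S L1 c1 × LColOn S L2 c2 ×
    (∃[ rs ] Transforms S c0 c1 rs) × (∃[ rs ] Transforms S c1 c2 rs)

  Lifts : (Fin n → Set) → ListAssignment → ListAssignment →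
          Col → Col → Col → Col → Set
  Lifts H L1 L2 δ0 δ1 δ2 c0 =
    ∃[ c1 ] ∃[ c2 ]
      ( ProperOn Everything c0
      × LColOn Everything L1 c1 × LColOn Everything L2 c2
      × (∃[ rs ] (Transforms Everything c0 c1 rs × Late H rs))
      × (∃[ rs ] (Transforms Everything c1 c2 rs × Late H rs))
      × (∀ v → H v → δ0 v ≡ c0 v × δ1 v ≡ c1 v × δ2 v ≡ c2 v))

record Scene : Set where
  field
    n      : ℕ
    G      : PlaneGraph n
    hs     : List (Fin n)
    hs-unique : Unique hs
    hs-consecutive : PlaneGraph.ConsecutiveOnOuter G hs
    L1 L2  : Fin n → List ℕ        -- duplicate-free lists represent sets
    L1-unique : ∀ v → Unique (L1 v)
    L2-unique : ∀ v → Unique (L2 v)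
    φ0 δ0 δ1 δ2 : Fin n → ℕ

  open PlaneGraph G using (Adj; Internal)
  open Coloring Adj

  InH : Fin n → Set
  InH v = v ∈ hs

  field
    φ0-proper : ProperOn Everything φ0
    δ-trajectory : TrajectoryOn InH L1 L2 δ0 δ1 δ2
    δ0-start  : ∀ v → InH v → δ0 v ≡ φ0 v

  HasTrajectory : Set
  HasTrajectory = Lifts InH L1 L2 δ0 δ1 δ2 φ0

  Valid : Set
  Valid =
    length hs ≤ 3
    × (∀ v → (∀ a b → a ∈ L1 v → ¬ a ∈ L2 v → b ∈ L1 v → ¬ b ∈ L2 v → a ≡ b)
             × 6 ≤ length (L1 v) × 7 ≤ length (L2 v))
    × (∀ v → Internal v → 10 ≤ length (L1 v) × 9 ≤ length (L2 v))
    × (length hs ≡ 3 → ∀ v → (∀ u → u ∈ hs → Adj v u) →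
         ¬ (∀ a → (a ∈ L1 v) ⇔ (∃[ u ] (u ∈ hs × (a ≡ δ0 u ⊎ a ≡ δ1 u)))))

{-# OPTIONS --safe #-}

-- Planarity is used only through the absence of K₃,₃- and K₅-minors in G extended by a cycle of corner nodes inside each
-- face.  This follows from a Jordan curve theorem modulo 2, which is Euler's formula: adding the edges one by one, each edge
-- either joins two components of the earlier edges or separates two dual components of the later ones.
--
-- A scene is solved by induction, the outside being a connected blob of nodes and the weak vertices (those with short lists)
-- being attached to it.  If no vertex has too many weak or coloured neighbours, all weak vertices are deleted at once and join
-- the blob: such a vertex takes the same new colour in both rounds, moving last in the first round and first in the second,
-- which costs a neighbour two colours of L1 and one of L2.  Every remaining vertex has at most two deleted neighbours, whence
-- the bounds 10 - 4 = 6 and 9 - 2 = 7.  Otherwise a vertex with three neighbours on the boundary cuts the scene, by the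
-- excluded minors, into parts meeting in at most three vertices; these become the coloured vertices of the second part.

module Submission where

open import Defs
open import Algebra.Bundles using (CommutativeRing)
import Algebra.Properties.CommutativeMonoid.Sum as CMSum
open import Data.Bool using (Bool; true; false; T; not; if_then_else_; _∧_; _∨_; _xor_)
import Data.Bool.ListAction as BL
open import Data.Bool.Properties using (T?; ¬-not; xor-∧-commutativeRing) renaming (_≟_ to _≟ᵇ_)
open import Data.Empty using (⊥; ⊥-elim)
open import Data.Fin using (Fin; zero; suc; toℕ; fromℕ<) renaming (_≟_ to _≟ᶠ_)
open import Data.Fin.Permutation using (permutation)
open import Data.Fin.Properties using (toℕ-injective; toℕ-fromℕ<; toℕ<n; pigeonhole) renaming (any? to anyᶠ?)
open import Data.List using (List; []; _∷_; _++_; length; filter; allFin; map; foldr; _ʳ++_; upTo)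
open import Data.List.Membership.DecPropositional using () renaming (_∈?_ to member?)
open import Data.List.Membership.Propositional using (_∈_; _∉_; find; lose)
open import Data.List.Membership.Propositional.Properties using (∈-∃++; ∈-++⁻; ∈-++⁺ˡ; ∈-++⁺ʳ; ∈-filter⁺; ∈-filter⁻; ∈-allFin; ∈-map⁺; ∈-map⁻)
open import Data.List.Properties using (length-++; length-map; length-tabulate; ++-identityʳ; map-++)
open import Data.List.Relation.Binary.Permutation.Propositional using (↭⇒↭ₛ; ↭-sym)
open import Data.List.Relation.Binary.Permutation.Propositional.Properties using (∈-resp-↭)
import Data.List.Relation.Binary.Permutation.Setoid.Properties as ↭ₛ
open import Data.List.Relation.Unary.All as All using (All; []; _∷_)
open import Data.List.Relation.Unary.All.Properties using (¬All⇒Any¬)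
open import Data.List.Relation.Unary.AllPairs using ([]; _∷_; AllPairs)
open import Data.List.Relation.Unary.Any using (here; there; any?)
open import Data.List.Relation.Unary.Sorted.TotalOrder.Properties using (Sorted⇒AllPairs)
open import Data.List.Relation.Unary.Unique.Propositional using (Unique)
open import Data.List.Relation.Unary.Unique.Propositional.Properties as Unique using (allFin⁺)
import Data.List.Sort as Sort
import Data.Nat as ℕ
open import Data.Nat using (ℕ; zero; suc; _+_; _*_; _∸_; _≤_; _<_; z≤n; s≤s; s≤s⁻¹; _≤ᵇ_; _<?_; _≤?_; _⊔_)
open import Data.Nat.ListAction using (sum)
open import Data.Nat.Properties using (≤-refl; ≤-trans; ≤-reflexive; ≰⇒>; <⇒≱; +-suc; +-comm; +-monoʳ-≤; +-monoˡ-≤; +-cancelˡ-≤; m≤m+n; _≤?_; ≤-antisym; ≮⇒≥; <⇒≤; <-asym; ≤∧≢⇒<; +-mono-≤; ≤ᵇ⇒≤; ≤⇒≤ᵇ; m+[n∸m]≡n; m<n⇒0<n∸m; m∸n≤m; n≤1+n; module ≤-Reasoning; m≤m⊔n; m≤n⊔m; *-monoʳ-≤; *-comm; *-suc; *-mono-≤; ≤-decTotalOrder)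
open import Data.Nat.Solver using (module +-*-Solver)
open import Data.Product using (Σ; ∃; ∃-syntax; _×_; _,_; proj₁; proj₂)
open import Data.Sum using (_⊎_; inj₁; inj₂; [_,_]′)
open import Data.Unit using (⊤; tt)
open import Function using (_∘_; id)
open import Function.Bundles using (mk⇔)
open import Relation.Binary using (DecidableEquality)
open import Relation.Binary.Bundles using (module DecTotalOrder)
open import Relation.Binary.Construct.Closure.ReflexiveTransitive using (Star; ε; _◅_; _◅◅_; reverse)
import Relation.Binary.Construct.On as On
open import Relation.Binary.PropositionalEquality using (_≡_; _≢_; refl; sym; trans; cong; cong₂; subst; _≗_; module ≡-Reasoning; subst₂; ≢-sym; setoid)
open import Relation.Nullary using (¬_; Dec; yes; no; ¬?; does; contradiction; _×-dec_; decidable-stable; _⊎-dec_)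
open import Relation.Nullary.Decidable using (dec-true; dec-false)
open import Relation.Unary using (Decidable)
open import Relation.Unary.Properties using (∁?)

-- Counting

-- The obstacle is to cut plane graphs without rebuilding rotation systems, faces and outer
-- boundaries for every piece. The map therefore never changes: a piece is only a vertex set `W`
-- with its own lists, short lists take over the role of the outer face, and the blob may differ
-- from piece to piece; even a single coloured vertex can serve. What is left of the geometry enters
-- through contradictions with the excluded minors. Three coloured neighbours can block all six
-- colours of a vertex in the first round. Condition (Gc) excludes this for the given `H`, but every
-- new border must earn it again: the colour of a new border vertex is chosen not to be `Bad`, or
-- colours are reserved in advance. The induction measure is `4 * ∣ W ∣ + length hs`: a vertex less
-- in `W` pays for three coloured vertices, and without weak vertices a coloured vertex is absorbed
-- into the lists while `W` stays. There a neighbour loses three colours of `L1` and two of `L2`,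
-- which the bounds 10 and 9 also allow. The bound 6 is what a deleted vertex needs: at least five
-- of its colours are common to both lists, and at most four are lost to coloured vertices and weak
-- neighbours.

length-partition : {A : Set} {P : A → Set} (P? : Decidable P) (xs : List A) →
  length xs ≡ length (filter P? xs) + length (filter (∁? P?) xs)
length-partition P? [] = refl
length-partition P? (x ∷ xs) with P? x
... | yes _ = cong suc (length-partition P? xs)
... | no _ = trans (cong suc (length-partition P? xs)) (sym (+-suc _ _))

unique-⊆-length : {A : Set} {xs ys : List A} → Unique xs → (∀ {z} → z ∈ xs → z ∈ ys) → length xs ≤ length ys
unique-⊆-length [] _ = z≤n
unique-⊆-length {xs = x ∷ xs} (x∉ ∷ u) sub with ∈-∃++ (sub (here refl))
... | as , bs , refl = ≤-trans (s≤s (unique-⊆-length u sub'))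
        (≤-reflexive (trans (cong suc (length-++ as)) (trans (sym (+-suc (length as) (length bs))) (sym (length-++ as)))))
  where
  sub' : ∀ {z} → z ∈ xs → z ∈ as ++ bs
  sub' z∈ with ∈-++⁻ as (sub (there z∈))
  ... | inj₁ p = ∈-++⁺ˡ p
  ... | inj₂ (here e) = contradiction (sym e) (All.lookup x∉ z∈)
  ... | inj₂ (there p) = ∈-++⁺ʳ as p

module Difference {A : Set} (_≟_ : DecidableEquality A) where
  open import Data.List.Membership.DecPropositional _≟_ using (_∈?_)

  pick : {xs ys : List A} → Unique xs → length ys < length xs → ∃[ a ] (a ∈ xs × a ∉ ys)
  pick {xs} {ys} u lt with any? (λ a → ¬? (a ∈? ys)) xs
  ... | yes p = find p
  ... | no ¬p = contradiction (unique-⊆-length u sub) (<⇒≱ lt)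
    where
    sub : ∀ {z} → z ∈ xs → z ∈ ys
    sub {z} m with z ∈? ys
    ... | yes q = q
    ... | no q = contradiction (lose m q) ¬p

  infixl 6 _∖_
  _∖_ : List A → List A → List A
  xs ∖ ys = filter (λ a → ¬? (a ∈? ys)) xs

  ∖-unique : {xs : List A} (ys : List A) → Unique xs → Unique (xs ∖ ys)
  ∖-unique ys = Unique.filter⁺ (λ a → ¬? (a ∈? ys))

  ∈-∖⁻ : ∀ {xs a} ys → a ∈ xs ∖ ys → a ∈ xs × a ∉ ys
  ∈-∖⁻ {xs} ys = ∈-filter⁻ (λ a → ¬? (a ∈? ys)) {xs = xs}

  ∈-∖⁺ : ∀ {xs a} ys → a ∈ xs → a ∉ ys → a ∈ xs ∖ ys
  ∈-∖⁺ ys = ∈-filter⁺ (λ a → ¬? (a ∈? ys))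

  length-∖ : {xs : List A} (ys : List A) → Unique xs → length xs ≤ length ys + length (xs ∖ ys)
  length-∖ {xs} ys u = ≤-trans (≤-reflexive (length-partition (_∈? ys) xs))
    (+-monoˡ-≤ _ (unique-⊆-length (Unique.filter⁺ (_∈? ys) u) (λ m → proj₂ (∈-filter⁻ (_∈? ys) {xs = xs} m))))

length-≤1 : {A : Set} {xs : List A} → Unique xs → (∀ {a b} → a ∈ xs → b ∈ xs → a ≡ b) → length xs ≤ 1
length-≤1 [] _ = z≤n
length-≤1 (_ ∷ []) _ = s≤s z≤n
length-≤1 ((x≢y ∷ _) ∷ (_ ∷ _)) eq = contradiction (eq (here refl) (there (here refl))) x≢y

length-filter-but-one : {A : Set} {P : A → Set} (P? : Decidable P) {xs : List A} → Unique xs →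
  (∀ {a b} → a ∈ xs → b ∈ xs → ¬ P a → ¬ P b → a ≡ b) → length xs ≤ suc (length (filter P? xs))
length-filter-but-one P? {xs} u eq = ≤-trans (≤-reflexive (trans (length-partition P? xs) (+-comm (length (filter P? xs)) _)))
  (+-monoˡ-≤ _ (length-≤1 (Unique.filter⁺ (∁? P?) u) λ m m' →
    let a , na = ∈-filter⁻ (∁? P?) {xs = xs} m ; b , nb = ∈-filter⁻ (∁? P?) {xs = xs} m' in eq a b na nb))

three-members : {A : Set} {xs : List A} → Unique xs → 3 ≤ length xs →
  ∃[ a ] ∃[ b ] ∃[ c ] (a ∈ xs × b ∈ xs × c ∈ xs × a ≢ b × a ≢ c × b ≢ c)
three-members {xs = a ∷ b ∷ c ∷ _} ((ab ∷ ac ∷ _) ∷ (bc ∷ _) ∷ _) _ =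
  a , b , c , here refl , there (here refl) , there (there (here refl)) , ab , ac , bc
three-members (_ ∷ []) (s≤s ())
three-members (_ ∷ _ ∷ []) (s≤s (s≤s ()))

two-members : {A : Set} {xs : List A} → Unique xs → 2 ≤ length xs → ∃[ a ] ∃[ b ] (a ∈ xs × b ∈ xs × a ≢ b)
two-members {xs = a ∷ b ∷ _} ((ab ∷ _) ∷ _) _ = a , b , here refl , there (here refl) , ab
two-members (_ ∷ []) (s≤s ())

one-member : {A : Set} {xs : List A} → 1 ≤ length xs → ∃[ a ] a ∈ xs
one-member {xs = a ∷ _} _ = a , here refl

record FSet (n : ℕ) : Set₁ where
  constructor fset
  field
    Mem  : Fin n → Set
    mem? : Decidable Mem
open FSet public

elems : ∀ {n} → FSet n → List (Fin n)
elems {n} W = filter (mem? W) (allFin n)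

elems-unique : ∀ {n} (W : FSet n) → Unique (elems W)
elems-unique {n} W = Unique.filter⁺ (mem? W) (allFin⁺ n)

∈-elems⁺ : ∀ {n} (W : FSet n) {v} → Mem W v → v ∈ elems W
∈-elems⁺ W m = ∈-filter⁺ (mem? W) (∈-allFin _) m

∈-elems⁻ : ∀ {n} (W : FSet n) {v} → v ∈ elems W → Mem W v
∈-elems⁻ {n} W m = proj₂ (∈-filter⁻ (mem? W) {xs = allFin n} m)

∣_∣ : ∀ {n} → FSet n → ℕ
∣ W ∣ = length (elems W)

size-< : ∀ {n} (W W' : FSet n) → (∀ {v} → Mem W v → Mem W' v) → ∀ {u} → Mem W' u → ¬ Mem W u → ∣ W ∣ < ∣ W' ∣
size-< W W' sub {u} u∈ u∉ = unique-⊆-length {xs = u ∷ elems W}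
  (All.tabulate (λ m e → u∉ (subst (Mem W) (sym e) (∈-elems⁻ W m))) ∷ elems-unique W)
  λ { (here refl) → ∈-elems⁺ W' u∈ ; (there m) → ∈-elems⁺ W' (sub (∈-elems⁻ W m)) }

trueSet : ∀ {n} → (Fin n → Bool) → FSet n
trueSet f = fset (T ∘ f) (T? ∘ f)

countFin-size : ∀ {n} (f : Fin n → Bool) → countFin f ≡ ∣ trueSet f ∣
countFin-size {n} f = go (allFin n)
  where
  go : ∀ xs → sum (map (λ i → if f i then 1 else 0) xs) ≡ length (filter (T? ∘ f) xs)
  go [] = refl
  go (x ∷ xs) with f x
  ... | true = cong suc (go xs)
  ... | false = go xs

size-inj : ∀ {m n} (A : FSet m) (B : FSet n) (f : Fin m → Fin n) → (∀ {v} → Mem A v → Mem B (f v)) →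
  (∀ {v w} → Mem A v → Mem A w → f v ≡ f w → v ≡ w) → ∣ A ∣ ≤ ∣ B ∣
size-inj A B f maps inj = ≤-trans (≤-reflexive (sym (length-map f (elems A))))
  (unique-⊆-length (uniq (elems-unique A) (∈-elems⁻ A)) λ m →
    let v , v∈ , e = ∈-map⁻ f m in subst (_∈ elems B) (sym e) (∈-elems⁺ B (maps (∈-elems⁻ A v∈))))
  where
  uniq : ∀ {xs} → Unique xs → (∀ {v} → v ∈ xs → Mem A v) → Unique (map f xs)
  uniq [] _ = []
  uniq {x ∷ xs} (x∉ ∷ u) mem = All.tabulate (λ m e → let v , v∈ , e' = ∈-map⁻ f m in
      All.lookup x∉ v∈ (inj (mem (here refl)) (mem (there v∈)) (trans e e')))
    ∷ uniq u (mem ∘ there)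

size-split : ∀ {n} (A B C : FSet n) → (∀ {v} → Mem A v → Mem C v) → (∀ {v} → Mem B v → Mem C v) →
  (∀ {v} → Mem A v → ¬ Mem B v) → ∣ A ∣ + ∣ B ∣ ≤ ∣ C ∣
size-split A B C a b d = ≤-trans (≤-reflexive (sym (length-++ (elems A))))
  (unique-⊆-length (Unique.++⁺ (elems-unique A) (elems-unique B) λ (x , y) → d (∈-elems⁻ A x) (∈-elems⁻ B y))
   λ m → go (∈-++⁻ (elems A) m))
  where
  go : ∀ {z} → z ∈ elems A ⊎ z ∈ elems B → z ∈ elems C
  go (inj₁ m) = ∈-elems⁺ C (a (∈-elems⁻ A m))
  go (inj₂ m) = ∈-elems⁺ C (b (∈-elems⁻ B m))

size-cover : ∀ {n} (A B C : FSet n) → (∀ {v} → Mem C v → Mem A v ⊎ Mem B v) → ∣ C ∣ ≤ ∣ A ∣ + ∣ B ∣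
size-cover A B C c = ≤-trans (unique-⊆-length (elems-unique C) λ m → go (c (∈-elems⁻ C m))) (≤-reflexive (length-++ (elems A)))
  where
  go : ∀ {z} → Mem A z ⊎ Mem B z → z ∈ elems A ++ elems B
  go (inj₁ m) = ∈-++⁺ˡ (∈-elems⁺ A m)
  go (inj₂ m) = ∈-++⁺ʳ (elems A) (∈-elems⁺ B m)

size-≤n : ∀ {n} (A : FSet n) → ∣ A ∣ ≤ n
size-≤n {n} A = ≤-trans (unique-⊆-length (elems-unique A) (λ _ → ∈-allFin _)) (≤-reflexive (length-tabulate id))

size-full : ∀ {n} (A : FSet n) → (∀ v → Mem A v) → n ≤ ∣ A ∣
size-full {n} A all = ≤-trans (≤-reflexive (sym (length-tabulate id))) (unique-⊆-length (allFin⁺ n) λ {z} _ → ∈-elems⁺ A (all z))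

-- A discrete Jordan curve theorem

-- Boolean identities are checked by evaluating all cases.
BoolFun : ℕ → Set
BoolFun zero = Bool
BoolFun (suc k) = Bool → BoolFun k

Agree : ∀ k → BoolFun k → BoolFun k → Set
Agree zero a b = a ≡ b
Agree (suc k) f g = ∀ b → Agree k (f b) (g b)

agreeB : ∀ k → BoolFun k → BoolFun k → Bool
agreeB zero a b = not (a xor b)
agreeB (suc k) f g = agreeB k (f true) (g true) ∧ agreeB k (f false) (g false)

T-∧⁻ : ∀ {a b} → T (a ∧ b) → T a × T b
T-∧⁻ {true} {true} _ = _ , _

T-∧⁺ : ∀ {a b} → T a → T b → T (a ∧ b)
T-∧⁺ {true} {true} _ _ = _

T-∨⁻ : ∀ {a b} → T (a ∨ b) → T a ⊎ T b
T-∨⁻ {true} _ = inj₁ _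
T-∨⁻ {false} t = inj₂ t

T-∨⁺ˡ : ∀ {a b} → T a → T (a ∨ b)
T-∨⁺ˡ {true} _ = _

T-∨⁺ʳ : ∀ {a b} → T b → T (a ∨ b)
T-∨⁺ʳ {true} _ = _
T-∨⁺ʳ {false} t = t

taut : ∀ k (f g : BoolFun k) {_ : T (agreeB k f g)} → Agree k f g
taut zero true true = refl
taut zero false false = refl
taut (suc k) f g {p} true = taut k (f true) (g true) {proj₁ (T-∧⁻ p)}
taut (suc k) f g {p} false = taut k (f false) (g false) {proj₂ (T-∧⁻ {agreeB k (f true) (g true)} p)}

xor-≡ : ∀ {a b} → a xor b ≡ false → a ≡ b
xor-≡ {true} {true} _ = refl
xor-≡ {false} {false} _ = refl

eqF⁻ : ∀ {m} {a b : Fin m} → T (eqF a b) → a ≡ b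
eqF⁻ {a = a} {b} t with a ≟ᶠ b
... | yes e = e

eqF⁺ : ∀ {m} {a b : Fin m} → a ≡ b → T (eqF a b)
eqF⁺ {a = a} {b} e with a ≟ᶠ b
... | yes _ = _
... | no ¬e = ¬e e

T-true : ∀ {b} → T b → b ≡ true
T-true {true} _ = refl

T-false : ∀ {b} → ¬ T b → b ≡ false
T-false {true} h = contradiction _ h
T-false {false} _ = refl

T-not : ∀ {b} → ¬ T b → T (not b)
T-not {true} h = h _
T-not {false} _ = _

anyFin⁻ : ∀ {m} {f : Fin m → Bool} → T (anyFin f) → ∃[ i ] T (f i)
anyFin⁻ {m} {f} = go (allFin m)
  where
  go : ∀ xs → T (BL.any f xs) → ∃[ i ] T (f i)
  go (x ∷ xs) t = [ (λ p → x , p) , go xs ]′ (T-∨⁻ t)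

anyFin⁺ : ∀ {m} {f : Fin m → Bool} i → T (f i) → T (anyFin f)
anyFin⁺ {m} {f} i t = go (∈-allFin i)
  where
  go : ∀ {xs} → i ∈ xs → T (BL.any f xs)
  go (here refl) = T-∨⁺ˡ t
  go (there m) = T-∨⁺ʳ (go m)

allFinB⁻ : ∀ {m} {f : Fin m → Bool} → T (allFinB f) → ∀ i → T (f i)
allFinB⁻ {m} {f} t i = go t (∈-allFin i)
  where
  go : ∀ {xs} → T (BL.all f xs) → i ∈ xs → T (f i)
  go t (here refl) = proj₁ (T-∧⁻ t)
  go {x ∷ _} t (there m) = go (proj₂ (T-∧⁻ {f x} t)) m

allFinB⁺ : ∀ {m} {f : Fin m → Bool} → (∀ i → T (f i)) → T (allFinB f)
allFinB⁺ {m} {f} h = go (allFin m)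
  where
  go : ∀ xs → T (BL.all f xs)
  go [] = _
  go (x ∷ xs) = T-∧⁺ (h x) (go xs)

least : ∀ {n} (W : FSet n) {v} → Mem W v → ∃[ m ] (Mem W m × (∀ {w} → Mem W w → toℕ m ≤ toℕ w))
least {n} W {v} v∈ = go (suc (toℕ v)) v∈ ≤-refl
  where
  go : ∀ k {v} → Mem W v → toℕ v < k → ∃[ m ] (Mem W m × (∀ {w} → Mem W w → toℕ m ≤ toℕ w))
  go (suc k) {v} v∈ (s≤s lt) with anyᶠ? (λ w → mem? W w ×-dec (toℕ w <? toℕ v))
  ... | yes (w , w∈ , w<v) = go k w∈ (≤-trans w<v lt)
  ... | no ¬p = v , v∈ , λ w∈ → ≮⇒≥ (λ w<v → ¬p (_ , w∈ , w<v))

-- A partition of Fin m is represented by an idempotent labelling; its classes are counted by the fixed points.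
module Labels {m : ℕ} where
  merge : (Fin m → Fin m) → Fin m → Fin m → Fin m → Fin m
  merge ℓ a b v = if does (ℓ v ≟ᶠ ℓ a) then ℓ b else ℓ v

  Idem : (Fin m → Fin m) → Set
  Idem ℓ = ∀ v → ℓ (ℓ v) ≡ ℓ v

  fixed : (Fin m → Fin m) → FSet m
  fixed ℓ = fset (λ v → ℓ v ≡ v) (λ v → ℓ v ≟ᶠ v)

  module _ (ℓ : Fin m → Fin m) (a b : Fin m) where
    merge-in : ∀ {v} → ℓ v ≡ ℓ a → merge ℓ a b v ≡ ℓ b
    merge-in {v} e rewrite dec-true (ℓ v ≟ᶠ ℓ a) e = refl

    merge-out : ∀ {v} → ℓ v ≢ ℓ a → merge ℓ a b v ≡ ℓ v
    merge-out {v} e rewrite dec-false (ℓ v ≟ᶠ ℓ a) e = refl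

    merge-link : merge ℓ a b a ≡ merge ℓ a b b
    merge-link with ℓ b ≟ᶠ ℓ a
    ... | yes e = trans (merge-in refl) refl
    ... | no ¬e = merge-in refl

    merge-keep : ∀ {v w} → ℓ v ≡ ℓ w → merge ℓ a b v ≡ merge ℓ a b w
    merge-keep e rewrite e = refl

    merge-noop : ℓ a ≡ ℓ b → merge ℓ a b ≗ ℓ
    merge-noop e v with ℓ v ≟ᶠ ℓ a
    ... | yes p = trans (sym e) (sym p)
    ... | no _ = refl

    module _ (idem : Idem ℓ) where
      merge-idem : Idem (merge ℓ a b)
      merge-idem v with ℓ v ≟ᶠ ℓ a
      ... | no ¬p = trans (merge-out (λ e → ¬p (trans (sym (idem v)) e))) (idem v)
      ... | yes p with ℓ b ≟ᶠ ℓ a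
      ...   | yes q = merge-in (trans (idem b) q)
      ...   | no ¬q = trans (merge-out (λ e → ¬q (trans (sym (idem b)) e))) (idem b)

      -- Only the label `ℓ a` can cease to be a fixed point.
      merge-size : ∣ fixed ℓ ∣ ≤ suc ∣ fixed (merge ℓ a b) ∣
      merge-size = ≤-trans (size-cover single (fixed (merge ℓ a b)) (fixed ℓ) cover)
        (+-monoˡ-≤ _ (length-≤1 (elems-unique single) λ x y → trans (∈-elems⁻ single x) (sym (∈-elems⁻ single y))))
        where
        single : FSet m
        single = fset (_≡ ℓ a) (_≟ᶠ ℓ a)
        cover : ∀ {v} → ℓ v ≡ v → v ≡ ℓ a ⊎ merge ℓ a b v ≡ v
        cover {v} fix with v ≟ᶠ ℓ a
        ... | yes e = inj₁ e
        ... | no ¬e = inj₂ (trans (merge-out (λ e → ¬e (trans (sym fix) e))) fix)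

  fixed-size-cong : ∀ {ℓ ℓ'} → ℓ' ≗ ℓ → ∣ fixed ℓ ∣ ≤ ∣ fixed ℓ' ∣
  fixed-size-cong {ℓ} {ℓ'} eq = size-inj (fixed ℓ) (fixed ℓ') id (λ {v} e → trans (eq v) e) (λ _ _ e → e)

  closure : (Fin m → Fin m) → List (Fin m × Fin m) → Fin m → Fin m
  closure ℓ₀ = foldr (λ (a , b) ℓ → merge ℓ a b) ℓ₀

  closure-idem : ∀ {ℓ₀} → Idem ℓ₀ → ∀ ls → Idem (closure ℓ₀ ls)
  closure-idem i [] = i
  closure-idem i ((a , b) ∷ ls) = merge-idem _ a b (closure-idem i ls)

  closure-keep : ∀ {ℓ₀} ls {v w} → ℓ₀ v ≡ ℓ₀ w → closure ℓ₀ ls v ≡ closure ℓ₀ ls w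
  closure-keep [] e = e
  closure-keep {ℓ₀} ((a , b) ∷ ls) e = merge-keep (closure ℓ₀ ls) a b (closure-keep ls e)

  closure-link : ∀ {ℓ₀} {ls a b} → (a , b) ∈ ls → closure ℓ₀ ls a ≡ closure ℓ₀ ls b
  closure-link {ℓ₀} {(a , b) ∷ ls} (here refl) = merge-link (closure ℓ₀ ls) a b
  closure-link {ℓ₀} {(a , b) ∷ ls} (there m) = merge-keep (closure ℓ₀ ls) a b (closure-link m)

  -- This is the induction principle of a generated partition: labels never leave an equivalence
  -- relation that contains the links.
  closure-sound : ∀ {ℓ₀} (_~_ : Fin m → Fin m → Set) → (∀ {v} → v ~ v) → (∀ {v w} → v ~ w → w ~ v) →
    (∀ {u v w} → u ~ v → v ~ w → u ~ w) → (∀ v → v ~ ℓ₀ v) → ∀ ls → (∀ {a b} → (a , b) ∈ ls → a ~ b) →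
    ∀ v → v ~ closure ℓ₀ ls v
  closure-sound _~_ r s t base [] link v = base v
  closure-sound {ℓ₀} _~_ r s t base ((a , b) ∷ ls) link v with closure ℓ₀ ls v ≟ᶠ closure ℓ₀ ls a
  ... | no _ = closure-sound _~_ r s t base ls (link ∘ there) v
  ... | yes e = t (ih v) (t (subst (_~ a) (sym e) (s (ih a))) (t (link (here refl)) (ih b)))
    where ih = closure-sound _~_ r s t base ls (link ∘ there)

-- Doubling the first bound gives 2n + 2F + 2I + 2 ≤ 4C + 2m ≤ 4C + d, which misses Euler's formula
-- by two.
euler-bound : ∀ {n F I C m d} → n + F + I + 1 ≤ C + C + m → m + m ≤ d → 2 * n + 2 * F + 2 * I ≡ d + 4 * C → ⊥
euler-bound {n} {F} {I} {C} {m} {d} total half eq = <⇒≱ (begin-strict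
  2 * n + 2 * F + 2 * I
    <⟨ n≤1+n _ ⟩
  2 + (2 * n + 2 * F + 2 * I)
    ≡⟨ solve 3 (λ a b c → con 2 :+ (con 2 :* a :+ con 2 :* b :+ con 2 :* c) := (a :+ b :+ c :+ con 1) :+ (a :+ b :+ c :+ con 1)) refl n F I ⟩
  (n + F + I + 1) + (n + F + I + 1)
    ≤⟨ +-mono-≤ total total ⟩
  (C + C + m) + (C + C + m)
    ≡⟨ solve 2 (λ c m → (c :+ c :+ m) :+ (c :+ c :+ m) := m :+ m :+ con 4 :* c) refl C m ⟩
  m + m + 4 * C
    ≤⟨ +-monoˡ-≤ _ half ⟩
  d + 4 * C ∎) (≤-reflexive (sym eq))
  where
  open ≤-Reasoning
  open +-*-Solver using (solve; _:+_; _:*_; _:=_; con)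

-- One step of a telescoping sum. Here `p` counts the components of the earlier edges and `q` the
-- dual components of the later ones; `px` and `qx` are the counts with the current edge added.
later-arith : ∀ {p px q qx q₀ r l} → px + q₀ ≤ r + q + l → p + q ≤ suc (px + qx) → p + q₀ ≤ r + qx + suc l
later-arith {p} {px} {q} {qx} {q₀} {r} {l} h k = +-cancelˡ-≤ (px + q) _ _ (begin
  px + q + (p + q₀)
    ≡⟨ solve 4 (λ a b c e → a :+ b :+ (c :+ e) := (a :+ e) :+ (c :+ b)) refl px q p q₀ ⟩
  (px + q₀) + (p + q)
    ≤⟨ +-mono-≤ h k ⟩
  (r + q + l) + suc (px + qx)
    ≡⟨ solve 5 (λ a b c e f → (a :+ b :+ c) :+ (con 1 :+ (e :+ f)) := (e :+ b) :+ (a :+ f :+ (con 1 :+ c))) refl r q l px qx ⟩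
  px + q + (r + qx + suc l) ∎)
  where
  open ≤-Reasoning
  open +-*-Solver using (solve; _:+_; _:=_; con)

earlier-arith : ∀ {p₀ p px q qx r l} → p₀ + qx ≤ p + r + l → p + q ≤ suc (px + qx) → p₀ + q ≤ px + r + suc l
earlier-arith {p₀} {p} {px} {q} {qx} {r} {l} h k = +-cancelˡ-≤ (p + qx) _ _ (begin
  p + qx + (p₀ + q)
    ≡⟨ solve 4 (λ a b c e → a :+ b :+ (c :+ e) := (c :+ b) :+ (a :+ e)) refl p qx p₀ q ⟩
  (p₀ + qx) + (p + q)
    ≤⟨ +-mono-≤ h k ⟩
  (p + r + l) + suc (px + qx)
    ≡⟨ solve 5 (λ a b c e f → (a :+ b :+ c) :+ (con 1 :+ (e :+ f)) := (a :+ f) :+ (e :+ b :+ (con 1 :+ c))) refl p r l px qx ⟩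
  p + qx + (px + r + suc l) ∎)
  where
  open ≤-Reasoning
  open +-*-Solver using (solve; _:+_; _:=_; con)

lower-arith : ∀ {n F p px p₀ q qx q₀ r t a b} → n ≤ p₀ → F ≤ q₀ → p ≤ px → q ≤ qx →
  px + q₀ ≤ r + q + b → p₀ + qx ≤ p + t + a → n + F ≤ r + t + (a + b)
lower-arith {n} {F} {p} {px} {p₀} {q} {qx} {q₀} {r} {t} {a} {b} n≤ F≤ p≤ q≤ h k = +-cancelˡ-≤ (p + q) _ _ (begin
  p + q + (n + F)
    ≤⟨ +-mono-≤ (+-mono-≤ p≤ q≤) (+-mono-≤ n≤ F≤) ⟩
  px + qx + (p₀ + q₀)
    ≡⟨ solve 4 (λ a b c e → a :+ b :+ (c :+ e) := (a :+ e) :+ (c :+ b)) refl px qx p₀ q₀ ⟩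
  (px + q₀) + (p₀ + qx)
    ≤⟨ +-mono-≤ h k ⟩
  (r + q + b) + (p + t + a)
    ≡⟨ solve 6 (λ a b c e f g → (a :+ b :+ c) :+ (e :+ f :+ g) := e :+ b :+ (a :+ f :+ (g :+ c))) refl r q b p t a ⟩
  p + q + (r + t + (a + b)) ∎)
  where
  open ≤-Reasoning
  open +-*-Solver using (solve; _:+_; _:=_; con)

total-arith : ∀ {n F I r t a b C m} → n + F ≤ r + t + (a + b) → r ≤ C → t + I ≤ C → a + suc b ≡ m → n + F + I + 1 ≤ C + C + m
total-arith {n} {F} {I} {r} {t} {a} {b} {C} {m} h k l e = begin
  n + F + I + 1
    ≤⟨ +-monoˡ-≤ 1 (+-monoˡ-≤ I h) ⟩
  r + t + (a + b) + I + 1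
    ≡⟨ solve 5 (λ a b c e f → a :+ b :+ (c :+ e) :+ f :+ con 1 := a :+ (b :+ f) :+ (c :+ (con 1 :+ e))) refl r t a b I ⟩
  r + (t + I) + (a + suc b)
    ≤⟨ +-mono-≤ (+-mono-≤ k l) (≤-reflexive e) ⟩
  C + C + m ∎
  where
  open ≤-Reasoning
  open +-*-Solver using (solve; _:+_; _:=_; con)

module Jordan {n : ℕ} (M : Map n) (genus0 : Map.Genus0 M) where
  open Map M
  open Labels
  open CMSum (CommutativeRing.+-commutativeMonoid xor-∧-commutativeRing) public
    using (sum-cong-≗; ∑-distrib-+; sum-permute) renaming (sum to Σ⊕)

  φ⁻¹ : Fin d → Fin d
  φ⁻¹ x = rev (prev x)

  φ-φ⁻¹ : ∀ x → φ (φ⁻¹ x) ≡ x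
  φ-φ⁻¹ x = trans (cong next (rev-invol (prev x))) (next-prev x)

  φ⁻¹-φ : ∀ x → φ⁻¹ (φ x) ≡ x
  φ⁻¹-φ x = trans (cong rev (prev-next (rev x))) (rev-invol x)

  tail-φ : ∀ x → tail (φ x) ≡ head x
  tail-φ x = next-tail (rev x)

  Σ-rev : ∀ (f : Fin d → Bool) → Σ⊕ f ≡ Σ⊕ (f ∘ rev)
  Σ-rev f = sum-permute f (permutation rev rev rev-invol rev-invol)

  Σ-φ : ∀ (f : Fin d → Bool) → Σ⊕ f ≡ Σ⊕ (f ∘ φ)
  Σ-φ f = sum-permute f (permutation φ φ⁻¹ φ-φ⁻¹ φ⁻¹-φ)

  Σ-zero : ∀ {m} (f : Fin m → Bool) → (∀ x → f x ≡ false) → Σ⊕ f ≡ false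
  Σ-zero {zero} f h = refl
  Σ-zero {suc m} f h rewrite h zero = Σ-zero (f ∘ suc) (h ∘ suc)

  Σ-one : ∀ {m} (f : Fin m → Bool) x → f x ≡ true → (∀ y → y ≢ x → f y ≡ false) → Σ⊕ f ≡ true
  Σ-one f zero t h rewrite t = cong not (Σ-zero (f ∘ suc) (λ y → h (suc y) λ ()))
  Σ-one f (suc x) t h rewrite h zero (λ ()) =
    Σ-one (f ∘ suc) x t (λ y ne → h (suc y) (λ e → ne (sucinj e)))
    where
    sucinj : ∀ {m} {i j : Fin m} → suc i ≡ suc j → i ≡ j
    sucinj refl = refl

  abstract
    -- One dart of each edge is singled out, which turns a sum over darts into a sum over edges.
    lt : Fin d → Bool
    lt y = does (toℕ y <? toℕ (rev y))

    lt-rev : ∀ y → lt (rev y) ≡ not (lt y)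
    lt-rev y = go (toℕ y <? toℕ (rev y))
      where
      go : Dec (toℕ y < toℕ (rev y)) → lt (rev y) ≡ not (lt y)
      go (yes p) = trans (dec-false (toℕ (rev y) <? toℕ (rev (rev y))) (λ q → <-asym p (subst (λ z → toℕ (rev y) < toℕ z) (rev-invol y) q)))
        (cong not (sym (dec-true (toℕ y <? toℕ (rev y)) p)))
      go (no ¬p) = trans (dec-true (toℕ (rev y) <? toℕ (rev (rev y)))
           (subst (λ z → toℕ (rev y) < toℕ z) (sym (rev-invol y)) (≤∧≢⇒< (≮⇒≥ ¬p) λ e → no-loop y (cong tail (toℕ-injective e)))))
        (cong not (sym (dec-false (toℕ y <? toℕ (rev y)) ¬p)))

  -- The darts `y` and `rev y` are paired; `c` agrees on both, so their terms combine into one term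
  -- of the edge.
  half : ∀ (f c : Fin d → Bool) → (∀ y → c (rev y) ≡ c y) →
    Σ⊕ (λ y → f y ∧ c y) ≡ Σ⊕ (λ y → lt y ∧ ((f y xor f (rev y)) ∧ c y))
  half f c sc = begin
    Σ⊕ (λ y → f y ∧ c y)
      ≡⟨ sum-cong-≗ (λ y → taut 3 (λ l f c → f ∧ c) (λ l f c → (l ∧ f ∧ c) xor (not l ∧ f ∧ c)) (lt y) (f y) (c y)) ⟩
    Σ⊕ (λ y → (lt y ∧ f y ∧ c y) xor (not (lt y) ∧ f y ∧ c y))
      ≡⟨ ∑-distrib-+ (λ y → lt y ∧ f y ∧ c y) _ ⟩
    Σ⊕ (λ y → lt y ∧ f y ∧ c y) xor Σ⊕ (λ y → not (lt y) ∧ f y ∧ c y)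
      ≡⟨ cong (Σ⊕ (λ y → lt y ∧ f y ∧ c y) xor_) (trans (Σ-rev _) (sum-cong-≗ swap)) ⟩
    Σ⊕ (λ y → lt y ∧ f y ∧ c y) xor Σ⊕ (λ y → lt y ∧ f (rev y) ∧ c y)
      ≡⟨ ∑-distrib-+ (λ y → lt y ∧ f y ∧ c y) _ ⟨
    Σ⊕ (λ y → (lt y ∧ f y ∧ c y) xor (lt y ∧ f (rev y) ∧ c y))
      ≡⟨ sum-cong-≗ (λ y → taut 4 (λ l f g c → (l ∧ f ∧ c) xor (l ∧ g ∧ c)) (λ l f g c → l ∧ ((f xor g) ∧ c)) (lt y) (f y) (f (rev y)) (c y)) ⟩
    Σ⊕ (λ y → lt y ∧ ((f y xor f (rev y)) ∧ c y)) ∎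
    where
    open ≡-Reasoning
    swap : ∀ y → not (lt (rev y)) ∧ f (rev y) ∧ c (rev y) ≡ lt y ∧ f (rev y) ∧ c y
    swap y rewrite lt-rev y | sc y = taut 3 (λ l g c → not (not l) ∧ g ∧ c) (λ l g c → l ∧ g ∧ c) (lt y) (f (rev y)) (c y)

  cut : (Fin n → Bool) → Fin d → Bool
  cut χ y = χ (tail y) xor χ (head y)

  cut-rev : ∀ χ y → cut χ (rev y) ≡ cut χ y
  cut-rev χ y rewrite rev-invol y = taut 2 (λ a b → b xor a) (λ a b → a xor b) (χ (tail y)) (χ (head y))

  -- The head of `y` is the tail of `φ y` and `ψ` is constant on faces, so the sum over heads is the
  -- sum over tails reindexed by `φ`; modulo 2 they cancel.
  face-cut-even : ∀ (ψ : Fin d → Bool) → (∀ y → ψ (φ y) ≡ ψ y) → ∀ χ → Σ⊕ (λ y → ψ y ∧ cut χ y) ≡ false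
  face-cut-even ψ inv χ = begin
    Σ⊕ (λ y → ψ y ∧ cut χ y)
      ≡⟨ sum-cong-≗ (λ y → trans (taut 3 (λ p a b → p ∧ (a xor b)) (λ p a b → (p ∧ a) xor (p ∧ b)) (ψ y) (χ (tail y)) (χ (head y)))
           (cong₂ (λ p v → (ψ y ∧ χ (tail y)) xor (p ∧ χ v)) (sym (inv y)) (sym (tail-φ y)))) ⟩
    Σ⊕ (λ y → (ψ y ∧ χ (tail y)) xor (ψ (φ y) ∧ χ (tail (φ y))))
      ≡⟨ ∑-distrib-+ (λ y → ψ y ∧ χ (tail y)) _ ⟩
    Σ⊕ (λ y → ψ y ∧ χ (tail y)) xor Σ⊕ (λ y → ψ (φ y) ∧ χ (tail (φ y)))
      ≡⟨ cong (Σ⊕ (λ y → ψ y ∧ χ (tail y)) xor_) (sym (Σ-φ (λ y → ψ y ∧ χ (tail y)))) ⟩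
    Σ⊕ (λ y → ψ y ∧ χ (tail y)) xor Σ⊕ (λ y → ψ y ∧ χ (tail y))
      ≡⟨ taut 1 (λ a → a xor a) (λ _ → false) (Σ⊕ (λ y → ψ y ∧ χ (tail y))) ⟩
    false ∎
    where open ≡-Reasoning

  abstract
    ℓP : List (Fin d) → Fin n → Fin n
    ℓP xs = closure id (map (λ x → tail x , head x) xs)

    ℓF : Fin d → Fin d
    ℓF = closure id (map (λ x → x , φ x) (allFin d))

    -- Faces merged across the edges of `xs`, that is, the components of the dual graph with these
    -- edges.
    ℓQ : List (Fin d) → Fin d → Fin d
    ℓQ xs = closure ℓF (map (λ x → x , rev x) xs)

    P-idem : ∀ xs → Idem (ℓP xs)
    P-idem xs = closure-idem (λ _ → refl) (map _ xs)

    Q-idem : ∀ xs → Idem (ℓQ xs)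
    Q-idem xs = closure-idem (closure-idem (λ _ → refl) (map _ (allFin d))) (map _ xs)

    Q-φ : ∀ xs y → ℓQ xs (φ y) ≡ ℓQ xs y
    Q-φ xs y = sym (closure-keep (map _ xs) (closure-link (∈-map⁺ (λ x → x , φ x) (∈-allFin y))))

    P-link : ∀ {xs y} → y ∈ xs ⊎ rev y ∈ xs → ℓP xs (tail y) ≡ ℓP xs (head y)
    P-link (inj₁ m) = closure-link (∈-map⁺ (λ x → tail x , head x) m)
    P-link {xs} {y} (inj₂ m) = sym (subst (λ z → ℓP xs (head y) ≡ ℓP xs (tail z)) (rev-invol y) (closure-link (∈-map⁺ (λ x → tail x , head x) m)))

    Q-link : ∀ {xs y} → y ∈ xs ⊎ rev y ∈ xs → ℓQ xs y ≡ ℓQ xs (rev y)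
    Q-link (inj₁ m) = closure-link (∈-map⁺ (λ x → x , rev x) m)
    Q-link {xs} {y} (inj₂ m) = sym (subst (λ z → ℓQ xs (rev y) ≡ ℓQ xs z) (rev-invol y) (closure-link (∈-map⁺ (λ x → x , rev x) m)))

    P-noop : ∀ x xs → ℓP xs (tail x) ≡ ℓP xs (head x) → ∣ fixed (ℓP xs) ∣ ≤ ∣ fixed (ℓP (x ∷ xs)) ∣
    P-noop x xs e = fixed-size-cong (merge-noop (ℓP xs) (tail x) (head x) e)

    Q-noop : ∀ x xs → ℓQ xs x ≡ ℓQ xs (rev x) → ∣ fixed (ℓQ xs) ∣ ≤ ∣ fixed (ℓQ (x ∷ xs)) ∣
    Q-noop x xs e = fixed-size-cong (merge-noop (ℓQ xs) x (rev x) e)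

    P-step : ∀ x xs → ∣ fixed (ℓP xs) ∣ ≤ suc ∣ fixed (ℓP (x ∷ xs)) ∣
    P-step x xs = merge-size (ℓP xs) (tail x) (head x) (P-idem xs)

    Q-step : ∀ x xs → ∣ fixed (ℓQ xs) ∣ ≤ suc ∣ fixed (ℓQ (x ∷ xs)) ∣
    Q-step x xs = merge-size (ℓQ xs) x (rev x) (Q-idem xs)

    P-size : n ≤ ∣ fixed (ℓP []) ∣
    P-size = size-full (fixed id) (λ _ → refl)

    P-sound : ∀ (_~_ : Fin n → Fin n → Set) → (∀ {v} → v ~ v) → (∀ {v w} → v ~ w → w ~ v) →
      (∀ {u v w} → u ~ v → v ~ w → u ~ w) → (∀ x → tail x ~ head x) → ∀ L v → v ~ ℓP L v
    P-sound _~_ r s t h L = closure-sound _~_ r s t (λ _ → r) (map (λ x → tail x , head x) L)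
      λ m → link (∈-map⁻ (λ x → tail x , head x) m)
      where
      link : ∀ {a b} → ∃ (λ x → x ∈ L × (a , b) ≡ (tail x , head x)) → a ~ b
      link (x , _ , refl) = h x

    F-sound : ∀ (_~_ : Fin d → Fin d → Set) → (∀ {v} → v ~ v) → (∀ {v w} → v ~ w → w ~ v) →
      (∀ {u v w} → u ~ v → v ~ w → u ~ w) → (∀ x → x ~ φ x) → ∀ x → x ~ ℓQ [] x
    F-sound _~_ r s t h = closure-sound _~_ r s t (λ _ → r) (map (λ x → x , φ x) (allFin d))
      λ m → link (∈-map⁻ (λ x → x , φ x) m)
      where
      link : ∀ {a b} → ∃ (λ x → x ∈ allFin d × (a , b) ≡ (x , φ x)) → a ~ b
      link (x , _ , refl) = h x

  edges : List (Fin d)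
  edges = filter (T? ∘ lt) (allFin d)

  ∈edges : ∀ y → y ∈ edges ⊎ rev y ∈ edges
  ∈edges y with T? (lt y)
  ... | yes t = inj₁ (∈-filter⁺ (T? ∘ lt) (∈-allFin y) t)
  ... | no ¬t = inj₂ (∈-filter⁺ (T? ∘ lt) (∈-allFin (rev y)) (subst T (sym (lt-rev y)) (T-not ¬t)))

  ∈-ʳ++⁻ : ∀ {A : Set} (xs : List A) {ys y} → y ∈ xs ʳ++ ys → y ∈ xs ⊎ y ∈ ys
  ∈-ʳ++⁻ [] m = inj₂ m
  ∈-ʳ++⁻ (x ∷ xs) m with ∈-ʳ++⁻ xs m
  ... | inj₁ p = inj₁ (there p)
  ... | inj₂ (here e) = inj₁ (here e)
  ... | inj₂ (there p) = inj₂ p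

  ∈-ʳ++⁺ : ∀ {A : Set} (xs : List A) {ys y} → y ∈ xs ⊎ y ∈ ys → y ∈ xs ʳ++ ys
  ∈-ʳ++⁺ [] (inj₂ m) = m
  ∈-ʳ++⁺ (x ∷ xs) (inj₁ (here e)) = ∈-ʳ++⁺ xs (inj₂ (here e))
  ∈-ʳ++⁺ (x ∷ xs) (inj₁ (there m)) = ∈-ʳ++⁺ xs (inj₁ m)
  ∈-ʳ++⁺ (x ∷ xs) (inj₂ m) = ∈-ʳ++⁺ xs (inj₂ (there m))

  private
    -- A zipper through the list of edges: `pre` holds the earlier ones in reverse order.
    Split : List (Fin d) → List (Fin d) → Set
    Split pre post = pre ʳ++ post ≡ edges

    split-lt : ∀ pre {post x} → Split pre post → x ∈ pre ⊎ x ∈ post → T (lt x)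
    split-lt pre s m = proj₂ (∈-filter⁻ (T? ∘ lt) {xs = allFin d} (subst (_ ∈_) s (∈-ʳ++⁺ pre m)))

    split-cover : ∀ pre {x post} → Split pre (x ∷ post) → ∀ {y} → T (lt y) → y ≢ x →
      y ∈ pre ⊎ y ∈ post
    split-cover pre s {y} l ne with ∈-ʳ++⁻ pre (subst (y ∈_) (sym s) (∈-filter⁺ (T? ∘ lt) (∈-allFin y) l))
    ... | inj₁ m = inj₁ m
    ... | inj₂ (here e) = contradiction e ne
    ... | inj₂ (there m) = inj₂ m

  χ∋ : ∀ {m} → (Fin m → Fin m) → Fin m → Fin m → Bool
  χ∋ ℓ a v = does (ℓ v ≟ᶠ ℓ a)

  private
    -- The cut around a component of the earlier edges, seen in the dual, closes up through the later edges.
    cut-or-bond : ∀ pre {x post} → Split pre (x ∷ post) → ℓP pre (tail x) ≢ ℓP pre (head x) → ℓQ post x ≡ ℓQ post (rev x)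
    cut-or-bond pre {x} {post} s ¬p = decidable-stable (ℓQ post x ≟ᶠ ℓQ post (rev x)) λ ¬q → absurd ¬q
      where
      χ = χ∋ (ℓP pre) (tail x)
      ψ = χ∋ (ℓQ post) x
      module _ (¬q : ℓQ post x ≢ ℓQ post (rev x)) where
        f : Fin d → Bool
        f y = lt y ∧ ((ψ y xor ψ (rev y)) ∧ cut χ y)
        at-x : f x ≡ true
        at-x rewrite T-true (split-lt pre s (inj₂ (here refl))) | dec-true (ℓQ post x ≟ᶠ ℓQ post x) refl
          | dec-false (ℓQ post (rev x) ≟ᶠ ℓQ post x) (¬q ∘ sym)
          | dec-true (ℓP pre (tail x) ≟ᶠ ℓP pre (tail x)) refl
          | dec-false (ℓP pre (head x) ≟ᶠ ℓP pre (tail x)) (¬p ∘ sym) = refl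
        off-x : ∀ y → y ≢ x → f y ≡ false
        off-x y ne with T? (lt y)
        ... | no ¬l rewrite T-false ¬l = refl
        ... | yes l with split-cover pre s l ne
        ...   | inj₁ m rewrite P-link {pre} {y} (inj₁ m) =
                  taut 3 (λ l q a → l ∧ (q ∧ (a xor a))) (λ _ _ _ → false) (lt y) (ψ y xor ψ (rev y)) (χ (head y))
        ...   | inj₂ m rewrite Q-link {post} {y} (inj₁ m) =
                  taut 3 (λ l q c → l ∧ ((q xor q) ∧ c)) (λ _ _ _ → false) (lt y) (ψ (rev y)) (cut χ y)
        absurd : ⊥
        absurd with trans (sym (Σ-one f x at-x off-x)) (trans (sym (half ψ (cut χ) (cut-rev χ)))
                     (face-cut-even ψ (λ y → cong (λ z → does (z ≟ᶠ ℓQ post x)) (Q-φ post y)) χ))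
        ... | ()

    #P #Q : List (Fin d) → ℕ
    #P xs = ∣ fixed (ℓP xs) ∣
    #Q xs = ∣ fixed (ℓQ xs) ∣

    -- By `cut-or-bond` the edge `x` merges two classes on at most one of the two sides.
    step : ∀ pre {x post} → Split pre (x ∷ post) → #P pre + #Q post ≤ suc (#P (x ∷ pre) + #Q (x ∷ post))
    step pre {x} {post} s with ℓP pre (tail x) ≟ᶠ ℓP pre (head x)
    ... | yes e = ≤-trans (+-mono-≤ (P-noop x pre e) (Q-step x post)) (≤-reflexive (+-suc _ _))
    ... | no ¬e = +-mono-≤ (P-step x pre) (Q-noop x post (cut-or-bond pre s ¬e))

    later : ∀ pre post → Split pre post → #P pre + #Q [] ≤ #P (post ʳ++ pre) + #Q post + length post
    later pre [] s = m≤m+n _ 0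
    later pre (x ∷ post) s = later-arith {p = #P pre} {#P (x ∷ pre)} {#Q post} {#Q (x ∷ post)} {#Q []} {#P (post ʳ++ (x ∷ pre))}
      (later (x ∷ pre) post s) (step pre s)

    earlier : ∀ pre post → Split pre post → #P [] + #Q post ≤ #P pre + #Q (pre ʳ++ post) + length pre
    earlier [] post s = m≤m+n _ 0
    earlier (x ∷ pre) post s = earlier-arith {#P []} {#P pre} {#P (x ∷ pre)} {#Q post} {#Q (x ∷ post)} {#Q (pre ʳ++ (x ∷ post))}
      (earlier pre (x ∷ post) s) (step pre s)

  Orbit : Fin d → Fin d → Set
  Orbit x y = ∃[ k ] iter φ k x ≡ y

  iter-+ : ∀ {A : Set} (f : A → A) j k x → iter f (j + k) x ≡ iter f j (iter f k x)
  iter-+ f zero k x = refl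
  iter-+ f (suc j) k x = cong f (iter-+ f j k x)

  iter-φ⁻¹ : ∀ k x → iter φ⁻¹ k (iter φ k x) ≡ x
  iter-φ⁻¹ zero x = refl
  iter-φ⁻¹ (suc k) x = trans (pull k (iter φ (suc k) x)) (trans (cong (iter φ⁻¹ k) (φ⁻¹-φ (iter φ k x))) (iter-φ⁻¹ k x))
    where
    pull : ∀ k y → φ⁻¹ (iter φ⁻¹ k y) ≡ iter φ⁻¹ k (φ⁻¹ y)
    pull zero y = refl
    pull (suc k) y = cong φ⁻¹ (pull k y)

  -- Among `d + 1` iterates two coincide, and `φ` can be undone.
  period : ∀ x → ∃[ p ] (suc p ≤ d × iter φ (suc p) x ≡ x)
  period x with pigeonhole {d} {suc d} ≤-refl (λ k → iter φ (toℕ k) x)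
  ... | i , j , i<j , e with toℕ j ∸ toℕ i in eq | m<n⇒0<n∸m i<j
  ...   | suc p | _ = p , ≤-trans (≤-trans (≤-reflexive (sym eq)) (m∸n≤m (toℕ j) (toℕ i))) (s≤s⁻¹ (toℕ<n j))
        , trans (sym (iter-φ⁻¹ (toℕ i) (iter φ (suc p) x)))
          (trans (cong (iter φ⁻¹ (toℕ i)) (trans (sym (iter-+ φ (toℕ i) (suc p) x))
             (trans (cong (λ k → iter φ k x) (trans (cong (toℕ i +_) (sym eq)) (m+[n∸m]≡n (<⇒≤ i<j)))) (sym e))))
           (iter-φ⁻¹ (toℕ i) x))

  -- The tests `sameFaceB` and `faceRepB` try only fewer than `d` iterations; since the period is at
  -- most `d`, they see the whole orbit.
  iter-bounded : ∀ x k → ∃[ j ] iter φ (toℕ {d} j) x ≡ iter φ k x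
  iter-bounded x k with period x
  ... | p , p<d , per = let j , j≤p , e = go k in
        fromℕ< (≤-trans (s≤s j≤p) p<d) , trans (cong (λ i → iter φ i x) (toℕ-fromℕ< (≤-trans (s≤s j≤p) p<d))) e
    where
    go : ∀ k → ∃[ j ] (j ≤ p × iter φ j x ≡ iter φ k x)
    go zero = zero , z≤n , refl
    go (suc k) with go k
    ... | j , j≤p , e with j <? p
    ...   | yes j<p = suc j , j<p , cong φ e
    ...   | no j≮p = zero , z≤n , trans (sym per) (cong φ (trans (cong (λ i → iter φ i x) (≤-antisym (≮⇒≥ j≮p) j≤p)) e))

  orbit-sym : ∀ {x y} → Orbit x y → Orbit y x
  orbit-sym {x} (k , refl) with period x
  ... | p , _ , per = k * p , trans (sym (iter-+ φ (k * p) k x))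
        (trans (cong (λ i → iter φ i x) (solve 2 (λ a b → a :* b :+ a := a :* (con 1 :+ b)) refl k p)) (loop k))
    where
    open +-*-Solver using (solve; _:+_; _:*_; _:=_; con)
    loop : ∀ k → iter φ (k * suc p) x ≡ x
    loop zero = refl
    loop (suc k) = trans (iter-+ φ (suc p) (k * suc p) x) (trans (cong (iter φ (suc p)) (loop k)) per)

  orbit-trans : ∀ {x y z} → Orbit x y → Orbit y z → Orbit x z
  orbit-trans {x} (j , refl) (k , refl) = k + j , iter-+ φ k j x

  private
    ℓF-orbit : ∀ x → Orbit x (ℓQ [] x)
    ℓF-orbit = F-sound Orbit (0 , refl) orbit-sym orbit-trans (λ _ → 1 , refl)

    faceRep-min : ∀ {x y} → T (faceRepB x) → Orbit x y → toℕ x ≤ toℕ y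
    faceRep-min {x} t (k , refl) = let j , e = iter-bounded x k in
      subst (λ z → toℕ x ≤ toℕ z) e (≤ᵇ⇒≤ _ _ (allFinB⁻ t j))

    faces-≤ : #faces ≤ #Q []
    faces-≤ = ≤-trans (≤-reflexive (countFin-size faceRepB)) (size-inj (trueSet faceRepB) (fixed (ℓQ [])) (ℓQ []) (λ {x} _ → Q-idem [] x)
      λ {x} {y} tx ty e → let o = orbit-trans (ℓF-orbit x) (subst (λ z → Orbit z y) (sym e) (orbit-sym (ℓF-orbit y))) in
        toℕ-injective (≤-antisym (faceRep-min tx o) (faceRep-min ty (orbit-sym o))))

    reach-sound : ∀ (_~_ : Fin n → Fin n → Set) → (∀ {v} → v ~ v) → (∀ {u v} x → tail x ≡ v → u ~ v → u ~ head x) →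
      ∀ k {v w} → T (reachB k v w) → v ~ w
    reach-sound _~_ r s zero t = subst (_ ~_) (eqF⁻ t) r
    reach-sound _~_ r s (suc k) {v} {w} t with T-∨⁻ {reachB k v w} t
    ... | inj₁ p = reach-sound _~_ r s k p
    ... | inj₂ q with anyFin⁻ q
    ...   | u , a with T-∧⁻ {reachB k v u} a
    ...     | p , b with anyFin⁻ b
    ...       | x , c with T-∧⁻ {eqF (tail x) u} c
    ...         | tx , hx = subst (v ~_) (eqF⁻ hx) (s x (eqF⁻ tx) (reach-sound _~_ r s k p))

    module _ (L : List (Fin d)) (full : ∀ y → y ∈ L ⊎ rev y ∈ L) where
      conn-P : ∀ {v w} → T (connB v w) → ℓP L v ≡ ℓP L w
      conn-P = reach-sound (λ v w → ℓP L v ≡ ℓP L w) refl (λ { x refl e → trans e (P-link (full x)) }) n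

      -- The least vertex of a class passes the test `compRepB`, because vertices related by `connB`
      -- lie in one class.
      rep : ∀ v → ∃[ m ] (ℓP L m ≡ ℓP L v × T (compRepB m))
      rep v with least (fset (λ w → ℓP L w ≡ ℓP L v) (λ w → ℓP L w ≟ᶠ ℓP L v)) refl
      ... | m , e , min = m , e , allFinB⁺ λ w → intro w (λ t → min (trans (sym (conn-P t)) e))
        where
        intro : ∀ w → (T (connB m w) → toℕ m ≤ toℕ w) → T (not (connB m w) ∨ (toℕ m ≤ᵇ toℕ w))
        intro w h with connB m w
        ... | true = ≤⇒≤ᵇ (h _)
        ... | false = _

      P-≤ : #P L ≤ #components
      P-≤ = ≤-trans (size-inj (fixed (ℓP L)) (trueSet compRepB) (proj₁ ∘ rep) (λ {v} _ → proj₂ (proj₂ (rep v)))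
        λ {v} {w} fv fw e → trans (sym fv) (trans (trans (sym (proj₁ (proj₂ (rep v)))) (trans (cong (ℓP L) e) (proj₁ (proj₂ (rep w))))) fw))
        (≤-reflexive (sym (countFin-size compRepB)))

      iso⁻ : ∀ {v} → T (isolatedB v) → ∀ x → tail x ≢ v
      iso⁻ {v} t x e with anyFin (λ x → eqF (tail x) v) | anyFin⁺ {f = λ x → eqF (tail x) v} x (eqF⁺ e)
      ... | false | ()

      iso-conn : ∀ {v} → T (isolatedB v) → ∀ {w} → T (connB v w) → v ≡ w
      iso-conn {v} t c = reach-sound (λ a b → a ≡ v → a ≡ b) (λ _ → refl)
        (λ { x refl h refl → contradiction (sym (h refl)) (iso⁻ t x) }) n c refl

      iso-rep : ∀ {v} → T (isolatedB v) → T (compRepB v)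
      iso-rep {v} t = allFinB⁺ λ w → intro w
        where
        intro : ∀ w → T (not (connB v w) ∨ (toℕ v ≤ᵇ toℕ w))
        intro w with connB v w in eq
        ... | false = _
        ... | true = ≤⇒≤ᵇ (≤-reflexive (cong toℕ (iso-conn t (subst T (sym eq) _))))

      iso-P : ∀ {v} → T (isolatedB v) → ∀ w → ℓP L w ≡ ℓP L v → w ≡ v
      iso-P {v} t w e = proj₁ (sound w) (trans e (proj₂ (sound v) refl))
        where
        _~_ : Fin n → Fin n → Set
        a ~ b = (b ≡ v → a ≡ v) × (a ≡ v → b ≡ v)
        sound : ∀ w → w ~ ℓP L w
        sound = P-sound _~_ (id , id) (λ (f , g) → g , f) (λ (f , g) (f' , g') → f ∘ f' , g' ∘ g)
          (λ x → (λ e → contradiction e (iso⁻ t (rev x))) , λ e → contradiction e (iso⁻ t x)) L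

      dual-conn : ∀ {x y} → ℓP L (tail x) ≡ ℓP L (tail y) → ℓQ L x ≡ ℓQ L y
      dual-conn {x} {y} e = conn (tail x) (tail y) e x y refl refl
        where
        -- Darts with a common tail lie in one dual class, since consecutive ones share a face.
        rot : ∀ k z → ℓQ L (iter next k z) ≡ ℓQ L z
        rot zero z = refl
        rot (suc k) z = trans (trans (cong (λ u → ℓQ L (next u)) (sym (rev-invol w))) (Q-φ L (rev w)))
          (trans (sym (Q-link (full w))) (rot k z))
          where w = iter next k z
        same : ∀ {a b} → tail a ≡ tail b → ℓQ L a ≡ ℓQ L b
        same {a} {b} t = let k , e = rot-cycle a b t in trans (sym (rot k a)) (cong (ℓQ L) e)
        _~_ : Fin n → Fin n → Set
        v ~ w = ∀ a b → tail a ≡ v → tail b ≡ w → ℓQ L a ≡ ℓQ L b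
        -- Transitivity needs a dart at the middle vertex, hence the disjunction.
        _≈_ : Fin n → Fin n → Set
        v ≈ w = v ≡ w ⊎ (v ~ w × (∃[ a ] tail a ≡ v) × (∃[ b ] tail b ≡ w))
        ≈-sym : ∀ {v w} → v ≈ w → w ≈ v
        ≈-sym (inj₁ e) = inj₁ (sym e)
        ≈-sym (inj₂ (h , a , b)) = inj₂ ((λ p q r s → sym (h q p s r)) , b , a)
        ≈-trans : ∀ {u v w} → u ≈ v → v ≈ w → u ≈ w
        ≈-trans (inj₁ refl) q = q
        ≈-trans p (inj₁ refl) = p
        ≈-trans (inj₂ (h , a , b , tb)) (inj₂ (h' , _ , c)) = inj₂ ((λ p q r s → trans (h p b r tb) (h' b q tb s)) , a , c)
        sound : ∀ w → w ≈ ℓP L w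
        sound = P-sound _≈_ (inj₁ refl) ≈-sym ≈-trans
          (λ x → inj₂ ((λ p q r s → trans (same r) (trans (Q-link (full x)) (same (sym s)))) , (x , refl) , (rev x , refl))) L
        conn : ∀ v w → ℓP L v ≡ ℓP L w → v ~ w
        conn v w e with ≈-trans (sound v) (subst (_≈ w) (sym e) (≈-sym (sound w)))
        ... | inj₁ refl = λ p q r s → same (trans r (sym s))
        ... | inj₂ (h , _) = h

      -- By `dual-conn` a dual class is determined by the component of its darts, and such a
      -- component contains an edge; the isolated vertices are components of their own.
      Q-≤ : #Q L + #isolated ≤ #components
      Q-≤ = ≤-trans (+-mono-≤ (size-inj (fixed (ℓQ L)) proper (λ x → proj₁ (rep (tail x))) into inj) (≤-reflexive (countFin-size isolatedB)))
        (≤-trans (size-split proper (trueSet isolatedB) (trueSet compRepB) proj₁ iso-rep proj₂) (≤-reflexive (sym (countFin-size compRepB))))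
        where
        proper : FSet n
        proper = fset (λ v → T (compRepB v) × ¬ T (isolatedB v)) (λ v → T? (compRepB v) ×-dec ¬? (T? (isolatedB v)))
        into : ∀ {x} → ℓQ L x ≡ x → Mem proper (proj₁ (rep (tail x)))
        into {x} _ = let m , e , t = rep (tail x) in t , λ i → iso⁻ i x (iso-P i (tail x) (sym e))
        inj : ∀ {x y} → ℓQ L x ≡ x → ℓQ L y ≡ y → proj₁ (rep (tail x)) ≡ proj₁ (rep (tail y)) → x ≡ y
        inj {x} {y} fx fy e = trans (sym fx) (trans (dual-conn (trans (sym (proj₁ (proj₂ (rep (tail x)))))
          (trans (cong (ℓP L) e) (proj₁ (proj₂ (rep (tail y))))))) fy)

    edges-half : length edges + length edges ≤ d
    edges-half = ≤-trans (+-mono-≤ (≤-refl {length edges}) (size-inj (trueSet lt) (trueSet (not ∘ lt)) rev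
        (λ {v} t → subst (T ∘ not) (sym (lt-rev v)) (nn t)) (λ {v} {w} _ _ e → trans (sym (rev-invol v)) (trans (cong rev e) (rev-invol w)))))
      (≤-trans (size-split (trueSet lt) (trueSet (not ∘ lt)) (trueSet {d} (λ _ → true)) (λ _ → _) (λ _ → _) λ t f → ff t f)
        (size-≤n {d} (trueSet (λ _ → true))))
      where
      nn : ∀ {b} → T b → T (not (not b))
      nn {true} _ = _
      ff : ∀ {b} → T b → ¬ T (not b)
      ff {true} _ ()

    -- Euler's formula leaves no room for an edge that merges nothing on either side.
    tight : ∀ pre {x post} → Split pre (x ∷ post) → ℓP pre (tail x) ≡ ℓP pre (head x) → ℓQ post x ≡ ℓQ post (rev x) → ⊥
    tight pre {x} {post} s p q = euler-bound {n} {#faces} {#isolated} {#components} {length edges} {d} total edges-half genus0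
      where
      open ≤-Reasoning
      full : ∀ y → y ∈ post ʳ++ (x ∷ pre) ⊎ rev y ∈ post ʳ++ (x ∷ pre)
      full y = [ inj₁ ∘ move , inj₂ ∘ move ]′ (∈edges y)
        where
        move : ∀ {z} → z ∈ edges → z ∈ post ʳ++ (x ∷ pre)
        move m with ∈-ʳ++⁻ pre (subst (_ ∈_) (sym s) m)
        ... | inj₁ h = ∈-ʳ++⁺ post (inj₂ (there h))
        ... | inj₂ (here e) = ∈-ʳ++⁺ post (inj₂ (here e))
        ... | inj₂ (there h) = ∈-ʳ++⁺ post (inj₁ h)
      count : length pre + suc (length post) ≡ length edges
      count = trans (sym (len pre)) (cong length s)
        where
        len : ∀ xs {ys : List (Fin d)} → length (xs ʳ++ ys) ≡ length xs + length ys
        len [] = refl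
        len (x ∷ xs) = trans (len xs) (+-suc _ _)
      total : n + #faces + #isolated + 1 ≤ #components + #components + length edges
      total = total-arith {n} {#faces} {#isolated} {#P (post ʳ++ (x ∷ pre))} {#Q edges} {length pre} {length post}
        (lower-arith {n} {#faces} {#P pre} {#P (x ∷ pre)} {#P []} {#Q post} {#Q (x ∷ post)} {#Q []}
          {#P (post ʳ++ (x ∷ pre))} {#Q edges} {length pre} {length post}
          (P-size) (faces-≤) (P-noop x pre p) (Q-noop x post q) (later (x ∷ pre) post s)
          (≤-trans (earlier pre (x ∷ post) s) (≤-reflexive (cong (λ L → #P pre + #Q L + length pre) s))))
        (P-≤ (post ʳ++ (x ∷ pre)) full) (Q-≤ edges ∈edges) count

  -- For `χ` the indicator of one vertex this says that its degree in `p` is even. Quantifying over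
  -- all vertex sets makes the pairing with cuts immediate.
  Even : (Fin d → Bool) → Set
  Even p = ∀ (χ : Fin n → Bool) → Σ⊕ (λ y → p y ∧ χ (tail y)) ≡ false

  private
    module _ {p : Fin d → Bool} (sym-p : ∀ y → p (rev y) ≡ p y) (even : Even p) where
      even-cut : ∀ χ → Σ⊕ (λ y → lt y ∧ (p y ∧ cut χ y)) ≡ false
      even-cut χ = begin
        Σ⊕ (λ y → lt y ∧ (p y ∧ cut χ y))
          ≡⟨ sum-cong-≗ (λ y → cong (lt y ∧_) (taut 2 (λ p c → p ∧ c) (λ p c → c ∧ p) (p y) (cut χ y))) ⟩
        Σ⊕ (λ y → lt y ∧ (cut χ y ∧ p y))
          ≡⟨ half (λ y → χ (tail y)) p sym-p ⟨
        Σ⊕ (λ y → χ (tail y) ∧ p y)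
          ≡⟨ sum-cong-≗ (λ y → taut 2 (λ a b → a ∧ b) (λ a b → b ∧ a) (χ (tail y)) (p y)) ⟩
        Σ⊕ (λ y → p y ∧ χ (tail y))
          ≡⟨ even χ ⟩
        false ∎
        where open ≡-Reasoning

      -- Otherwise the cut around the component of `tail x` would meet the even set `p` in the
      -- single edge `x`.
      ends-joined : ∀ pre {x} → T (lt x) → p x ≡ true → (∀ {y} → p y ≡ true → T (lt y) → y ≢ x → y ∈ pre) →
        ℓP pre (tail x) ≡ ℓP pre (head x)
      ends-joined pre {x} lx px supp = decidable-stable (ℓP pre (tail x) ≟ᶠ ℓP pre (head x)) λ ne → absurd ne
        where
        χ = χ∋ (ℓP pre) (tail x)
        f : Fin d → Bool
        f y = lt y ∧ (p y ∧ cut χ y)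
        off : ∀ y → y ≢ x → f y ≡ false
        off y ne with lt y in l | p y in e
        ... | false | _ = refl
        ... | true | false = refl
        ... | true | true rewrite P-link {pre} {y} (inj₁ (supp e (subst T (sym l) _) ne)) =
              taut 1 (λ a → a xor a) (λ _ → false) (χ (head y))
        absurd : ℓP pre (tail x) ≢ ℓP pre (head x) → ⊥
        absurd ne with trans (sym (Σ-one f x at off)) (even-cut χ)
          where
          at : f x ≡ true
          at rewrite T-true lx | px | dec-true (ℓP pre (tail x) ≟ᶠ ℓP pre (tail x)) refl
            | dec-false (ℓP pre (head x) ≟ᶠ ℓP pre (tail x)) (ne ∘ sym) = refl
        ... | ()

  FaceColoring : (Fin d → Bool) → Set
  FaceColoring p = Σ (Fin d → Bool) λ g → (∀ (x : Fin d) → g (φ x) ≡ g x) × (∀ (x : Fin d) → g x xor g (rev x) ≡ p x)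

  private
    boundary-even : ∀ (h : Fin d → Bool) → (∀ y → h (φ y) ≡ h y) → Even (λ y → h y xor h (rev y))
    boundary-even h h-φ χ = begin
      Σ⊕ (λ y → (h y xor h (rev y)) ∧ χ (tail y))
        ≡⟨ sum-cong-≗ (λ y → taut 3 (λ a b c → (a xor b) ∧ c) (λ a b c → (a ∧ c) xor (b ∧ c)) (h y) (h (rev y)) (χ (tail y))) ⟩
      Σ⊕ (λ y → (h y ∧ χ (tail y)) xor (h (rev y) ∧ χ (tail y)))
        ≡⟨ ∑-distrib-+ (λ y → h y ∧ χ (tail y)) (λ y → h (rev y) ∧ χ (tail y)) ⟩
      Σ⊕ (λ y → h y ∧ χ (tail y)) xor Σ⊕ (λ y → h (rev y) ∧ χ (tail y))
        ≡⟨ cong (Σ⊕ (λ y → h y ∧ χ (tail y)) xor_) (trans (Σ-rev (λ y → h (rev y) ∧ χ (tail y))) (sum-cong-≗ (λ y → cong (λ z → h z ∧ χ (head y)) (rev-invol y)))) ⟩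
      Σ⊕ (λ y → h y ∧ χ (tail y)) xor Σ⊕ (λ y → h y ∧ χ (head y))
        ≡⟨ ∑-distrib-+ (λ y → h y ∧ χ (tail y)) (λ y → h y ∧ χ (head y)) ⟨
      Σ⊕ (λ y → (h y ∧ χ (tail y)) xor (h y ∧ χ (head y)))
        ≡⟨ sum-cong-≗ (λ y → taut 3 (λ a b c → (a ∧ b) xor (a ∧ c)) (λ a b c → a ∧ (b xor c)) (h y) (χ (tail y)) (χ (head y))) ⟩
      Σ⊕ (λ y → h y ∧ cut χ y)
        ≡⟨ face-cut-even h h-φ χ ⟩
      false ∎
      where open ≡-Reasoning

    -- Adding the boundary of the face set `h` removes `x` from `p`, keeps it even and brings in no
    -- later edge.
    module Eliminate (pre : List (Fin d)) (x : Fin d) (post : List (Fin d)) (s : Split (x ∷ pre) post)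
        (p : Fin d → Bool) (sym-p : ∀ y → p (rev y) ≡ p y) (even : Even p)
        (supp : ∀ {y} → p y ≡ true → T (lt y) → y ≢ x → y ∈ pre) (px : p x ≡ true)
        (h : Fin d → Bool) (h-φ : ∀ y → h (φ y) ≡ h y) (h-x : h x xor h (rev x) ≡ true)
        (h-post : ∀ {y} → y ∈ post → h y xor h (rev y) ≡ false) where
      ∂h p' : Fin d → Bool
      ∂h y = h y xor h (rev y)
      p' y = p y xor ∂h y

      p'-sym : ∀ y → p' (rev y) ≡ p' y
      p'-sym y = trans (cong₂ (λ a z → a xor (h (rev y) xor h z)) (sym-p y) (rev-invol y))
        (taut 3 (λ a b c → a xor (b xor c)) (λ a b c → a xor (c xor b)) (p y) (h (rev y)) (h y))

      p'-even : Even p'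
      p'-even χ = trans (sum-cong-≗ (λ y → taut 3 (λ a b c → (a xor b) ∧ c) (λ a b c → (a ∧ c) xor (b ∧ c)) (p y) (∂h y) (χ (tail y))))
        (trans (∑-distrib-+ (λ y → p y ∧ χ (tail y)) (λ y → ∂h y ∧ χ (tail y))) (cong₂ _xor_ (even χ) (boundary-even h h-φ χ)))

      p'-supp : ∀ {y} → p' y ≡ true → T (lt y) → y ∈ pre
      p'-supp {y} e l with y ≟ᶠ x
      ... | yes refl = contradiction (trans (sym e) (cong₂ _xor_ px h-x)) λ ()
      ... | no ne with split-cover pre s l ne
      ...   | inj₁ m = m
      ...   | inj₂ m = supp (trans (trans (taut 1 (λ a → a) (λ a → a xor false) (p y)) (cong (p y xor_) (sym (h-post m)))) e) l ne

      combine : FaceColoring p' → FaceColoring p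
      combine (g , g-φ , g-∂) = (λ y → g y xor h y) , (λ y → cong₂ _xor_ (g-φ y) (h-φ y)) , λ y →
        trans (taut 4 (λ a b c e → (a xor b) xor (c xor e)) (λ a b c e → (a xor c) xor (b xor e)) (g y) (h y) (g (rev y)) (h (rev y)))
        (trans (cong (_xor ∂h y) (g-∂ y)) (taut 2 (λ a b → (a xor b) xor b) (λ a b → a) (p y) (∂h y)))

    -- The even set is cleared from its last edge `x` backwards. The ends of `x` are joined by
    -- earlier edges, so by `tight` its two sides lie in different dual classes of the later edges;
    -- the class of `x` is the face set to add.
    bounds : ∀ pre post → Split pre post → ∀ p → (∀ y → p (rev y) ≡ p y) → Even p →
      (∀ {y} → p y ≡ true → T (lt y) → y ∈ pre) → FaceColoring p
    bounds [] post s p sym-p even supp = (λ _ → false) , (λ _ → refl) , λ x → sym (p-zero x)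
      where
      lt-zero : ∀ y → T (lt y) → p y ≡ false
      lt-zero y l = ¬-not (λ e → case (supp e l))
        where
        case : y ∈ [] → ⊥
        case ()
      p-zero : ∀ x → p x ≡ false
      p-zero x with T? (lt x)
      ... | yes l = lt-zero x l
      ... | no ¬l = trans (sym (sym-p x)) (lt-zero (rev x) (subst T (sym (lt-rev x)) (T-not ¬l)))
    bounds (x ∷ pre) post s p sym-p even supp = go (p x ≟ᵇ true)
      where
      go : Dec (p x ≡ true) → FaceColoring p
      go (no ne) = bounds pre (x ∷ post) s p sym-p even λ py l → drop py (supp py l)
        where
        drop : ∀ {y} → p y ≡ true → y ∈ x ∷ pre → y ∈ pre
        drop py (here refl) = contradiction py ne
        drop py (there m) = m
      go (yes px) = combine (bounds pre (x ∷ post) s p' p'-sym p'-even p'-supp)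
        where
        supp' : ∀ {y} → p y ≡ true → T (lt y) → y ≢ x → y ∈ pre
        supp' py l ne with supp py l
        ... | here e = contradiction e ne
        ... | there m = m
        joined : ℓP pre (tail x) ≡ ℓP pre (head x)
        joined = ends-joined sym-p even pre (split-lt (x ∷ pre) s (inj₁ (here refl))) px supp'
        h : Fin d → Bool
        h = χ∋ (ℓQ post) x
        h-x : h x xor h (rev x) ≡ true
        h-x = cong₂ _xor_ (dec-true (ℓQ post x ≟ᶠ ℓQ post x) refl)
          (dec-false (ℓQ post (rev x) ≟ᶠ ℓQ post x) (λ e → tight pre s joined (sym e)))
        h-post : ∀ {y} → y ∈ post → h y xor h (rev y) ≡ false
        h-post {y} m = trans (cong (λ z → does (z ≟ᶠ ℓQ post x) xor h (rev y)) (Q-link (inj₁ m)))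
          (taut 1 (λ a → a xor a) (λ _ → false) (h (rev y)))
        open Eliminate pre x post s p sym-p even supp' px h (λ y → cong (λ z → does (z ≟ᶠ ℓQ post x)) (Q-φ post y)) h-x h-post

  jordan : ∀ p → (∀ y → p (rev y) ≡ p y) → Even p → FaceColoring p
  jordan p sym-p even = bounds (edges ʳ++ []) [] split p sym-p even λ {y} _ l →
    ∈-ʳ++⁺ edges (inj₁ (∈-filter⁺ (T? ∘ lt) (∈-allFin y) l))
    where
    ʳ++-twice : ∀ {A : Set} (xs ys zs : List A) → (xs ʳ++ ys) ʳ++ zs ≡ ys ʳ++ (xs ++ zs)
    ʳ++-twice [] ys zs = refl
    ʳ++-twice (x ∷ xs) ys zs = ʳ++-twice xs (x ∷ ys) zs
    split : (edges ʳ++ []) ʳ++ [] ≡ edges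
    split = trans (ʳ++-twice edges [] []) (++-identityʳ edges)

-- Excluded minors

does-⇔ : ∀ {m k} {a b : Fin m} {c e : Fin k} → (a ≡ b → c ≡ e) → (c ≡ e → a ≡ b) → does (a ≟ᶠ b) ≡ does (c ≟ᶠ e)
does-⇔ {a = a} {b} {c} {e} f g with a ≟ᶠ b
... | yes p = sym (dec-true (c ≟ᶠ e) (f p))
... | no ¬p = sym (dec-false (c ≟ᶠ e) (¬p ∘ g))

module Rotation {D : Set} (next : D → D) (At : D → Set) (At-next : ∀ {y} → At y → At (next y))
    (cycle : ∀ {x y} → At x → At y → ∃[ k ] iter next k x ≡ y) where

  Crosses : (D → Bool) → (D → Bool) → Set
  Crosses q c = ∀ {y} → At y → q (next y) ≡ q y xor c y

  iter-next : ∀ k (x : D) → iter next k (next x) ≡ iter next (suc k) x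
  iter-next zero x = refl
  iter-next (suc k) x = cong next (iter-next k x)

  module _ (mark : D → D → Bool) (mark-refl : ∀ x → mark x x ≡ true) (mark-≢ : ∀ {x y} → x ≢ y → mark x y ≡ false)
      (_≟_ : ∀ (x y : D) → Dec (x ≡ y)) where

    both : D → D → D → Bool
    both a b y = mark y a xor mark y b

    private
      search : ∀ (P : D → Set) {target} → At target → (∀ {y} → At y → P y → y ≢ target → P (next y)) →
        ∀ k y → At y → P y → iter next k y ≡ target → P target
      search P _ h zero y _ p e = subst P e p
      search P {target} at h (suc k) y ay p e with y ≟ target
      ... | yes refl = p
      ... | no ne = search P at h k (next y) (At-next ay) (h ay p ne) (trans (iter-next k y) e)

    module _ (q₁₂ q₁₃ : D → Bool) {a b c : D} (At-a : At a) (At-b : At b) (At-c : At c)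
        (a≢b : a ≢ b) (a≢c : a ≢ c) (b≢c : b ≢ c)
        (x₁₂ : Crosses q₁₂ (both a b)) (x₁₃ : Crosses q₁₃ (both a c)) where
      private
        Early Late : D → Set
        Early y = (q₁₂ y ≡ not (q₁₂ a) × q₁₃ y ≡ not (q₁₃ a)) ⊎ (q₁₂ c ≡ not (q₁₂ a) × q₁₃ c ≡ not (q₁₃ a))
        Late y = (q₁₂ y ≡ q₁₂ a × q₁₃ y ≡ not (q₁₃ a))

        not≢ : ∀ {x} → x ≢ not x
        not≢ {true} ()
        not≢ {false} ()

        start : Early (next a)
        start = inj₁ (trans (x₁₂ At-a) (trans (cong₂ (λ u v → q₁₂ a xor (u xor v)) (mark-refl a) (mark-≢ a≢b)) (taut 1 (λ x → x xor true) not (q₁₂ a)))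
                   , trans (x₁₃ At-a) (trans (cong₂ (λ u v → q₁₃ a xor (u xor v)) (mark-refl a) (mark-≢ a≢c)) (taut 1 (λ x → x xor true) not (q₁₃ a))))

        stay : ∀ (q : D → Bool) {u v y r} → Crosses q (both u v) → At y → y ≢ u → y ≢ v → q y ≡ r → q (next y) ≡ r
        stay q {y = y} x ay ne ne' e = trans (x ay) (trans (cong₂ (λ s t → q y xor (s xor t)) (mark-≢ ne) (mark-≢ ne')) (trans (taut 1 (λ x → x xor false) id (q y)) e))

        early : ∀ {y} → At y → Early y → y ≢ b → Early (next y)
        early ay (inj₂ h) _ = inj₂ h
        early {y} ay (inj₁ (e , f)) y≢b with y ≟ a | y ≟ c
        ... | yes refl | _ = contradiction e not≢
        ... | no _ | yes refl = inj₂ (e , f)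
        ... | no y≢a | no y≢c = inj₁ (stay q₁₂ x₁₂ ay y≢a y≢b e , stay q₁₃ x₁₃ ay y≢a y≢c f)

        reach-b : Early b
        reach-b = let k , e = cycle (At-next At-a) At-b in search Early At-b early k (next a) (At-next At-a) start e

      ordered : (q₁₂ b ≡ not (q₁₂ a) × q₁₃ b ≡ not (q₁₃ a)) → (q₁₂ c xor q₁₃ b) xor (q₁₂ a xor q₁₃ a) ≡ true
      ordered (e , f) = result (let k , h = cycle (At-next At-b) At-c in search Late At-c late k (next b) (At-next At-b) begin-late h)
        where
        begin-late : Late (next b)
        begin-late = trans (x₁₂ At-b) (trans (cong₂ (λ u v → q₁₂ b xor (u xor v)) (mark-≢ (a≢b ∘ sym)) (mark-refl b))
                       (trans (cong (_xor true) e) (taut 1 (λ x → not x xor true) id (q₁₂ a))))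
                   , stay q₁₃ x₁₃ At-b (a≢b ∘ sym) b≢c f
        late : ∀ {y} → At y → Late y → y ≢ c → Late (next y)
        late {y} ay (l , m) y≢c with y ≟ a | y ≟ b
        ... | yes refl | _ = contradiction m not≢
        ... | no _ | yes refl = contradiction (trans (sym l) e) not≢
        ... | no y≢a | no y≢b = stay q₁₂ x₁₂ ay y≢a y≢b l , stay q₁₃ x₁₃ ay y≢a y≢c m
        result : Late c → (q₁₂ c xor q₁₃ b) xor (q₁₂ a xor q₁₃ a) ≡ true
        result (l , _) = trans (cong₂ (λ u v → (u xor v) xor (q₁₂ a xor q₁₃ a)) l f)
          (taut 2 (λ x y → (x xor not y) xor (x xor y)) (λ _ _ → true) (q₁₂ a) (q₁₃ a))

      first : (q₁₂ b ≡ not (q₁₂ a) × q₁₃ b ≡ not (q₁₃ a)) ⊎ (q₁₂ c ≡ not (q₁₂ a) × q₁₃ c ≡ not (q₁₃ a))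
      first = reach-b

    -- After `a` both functions are flipped until the first of `b` and `c` is met. In the order a,
    -- b, c only `q₁₃ b` differs from the value at `a`, in the order a, c, b only `q₁₂ c`; the sum
    -- is one either way.
    rotation : ∀ (q₁₂ q₁₃ : D → Bool) {a b c : D} → At a → At b → At c → a ≢ b → a ≢ c → b ≢ c →
      Crosses q₁₂ (both a b) → Crosses q₁₃ (both a c) → (q₁₂ c xor q₁₃ b) xor (q₁₂ a xor q₁₃ a) ≡ true
    rotation q₁₂ q₁₃ {a} {b} {c} A B C ab ac bc x y = [ ordered q₁₂ q₁₃ A B C ab ac bc x y , (λ (e , f) →
        trans (taut 4 (λ p q r s → (p xor q) xor (r xor s)) (λ p q r s → (q xor p) xor (s xor r)) (q₁₂ c) (q₁₃ b) (q₁₂ a) (q₁₃ a))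
          (ordered q₁₃ q₁₂ A C B ac ab (bc ∘ sym) y x (f , e))) ]′ (first q₁₂ q₁₃ A B C ab ac bc x y)

module Minors {n : ℕ} (M : Map n) (genus0 : Map.Genus0 M) where
  open Map M
  open Jordan M genus0

  Node : Set
  Node = Fin n ⊎ Fin d

  pattern V v = inj₁ v
  pattern K z = inj₂ z

  -- The graph G together with, inside each face, a cycle of corner nodes K z, each joined by a spoke to the vertex at its corner.
  data Step : Set where
    E S⁺ S⁻ R⁺ R⁻ : Fin d → Step

  src dst : Step → Node
  src (E x) = V (tail x)
  src (S⁺ x) = V (tail x)
  src (S⁻ x) = K x
  src (R⁺ x) = K x
  src (R⁻ x) = K (φ x)
  dst (E x) = V (head x)
  dst (S⁺ x) = K x
  dst (S⁻ x) = V (tail x)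
  dst (R⁺ x) = K (φ x)
  dst (R⁻ x) = K x

  opposite : Step → Step
  opposite (E x) = E (rev x)
  opposite (S⁺ x) = S⁻ x
  opposite (S⁻ x) = S⁺ x
  opposite (R⁺ x) = R⁻ x
  opposite (R⁻ x) = R⁺ x

  src-opposite : ∀ s → src (opposite s) ≡ dst s
  src-opposite (E x) = refl
  src-opposite (S⁺ x) = refl
  src-opposite (S⁻ x) = refl
  src-opposite (R⁺ x) = refl
  src-opposite (R⁻ x) = refl

  dst-opposite : ∀ s → dst (opposite s) ≡ src s
  dst-opposite (E x) = cong (V ∘ tail) (rev-invol x)
  dst-opposite (S⁺ x) = refl
  dst-opposite (S⁻ x) = refl
  dst-opposite (R⁺ x) = refl
  dst-opposite (R⁻ x) = refl

  data Walk (A : Node → Set) : Node → Node → Set where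
    stop : ∀ {a} → A a → Walk A a a
    move : ∀ s {b} → A (src s) → Walk A (dst s) b → Walk A (src s) b

  walk-start : ∀ {A a b} → Walk A a b → A a
  walk-start (stop m) = m
  walk-start (move s m _) = m

  _++ʷ_ : ∀ {A a b c} → Walk A a b → Walk A b c → Walk A a c
  stop _ ++ʷ w = w
  move s m v ++ʷ w = move s m (v ++ʷ w)

  widen : ∀ {A B a b} → (∀ {ν} → A ν → B ν) → Walk A a b → Walk B a b
  widen f (stop m) = stop (f m)
  widen f (move s m w) = move s (f m) (widen f w)

  move′ : ∀ {A a b c} s → src s ≡ a → dst s ≡ b → A a → Walk A b c → Walk A a c
  move′ s refl refl m w = move s m w

  reverseʷ : ∀ {A a b} → Walk A a b → Walk A b a
  reverseʷ (stop m) = stop m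
  reverseʷ {A} (move s m w) = reverseʷ w ++ʷ move′ (opposite s) (src-opposite s) (dst-opposite s) (walk-start w) (stop m)

  Conn : (Node → Set) → Set
  Conn A = ∀ a b → A a → A b → Walk A a b

  record _~_ (A B : Node → Set) : Set where
    constructor link
    field
      via : Step
      from : A (src via)
      to : B (dst via)
  open _~_

  Disjoint : (Node → Set) → (Node → Set) → Set
  Disjoint A B = ∀ ν → A ν → B ν → ⊥

  _∪_ : (Node → Set) → (Node → Set) → Node → Set
  (A ∪ B) ν = A ν ⊎ B ν

  ~-sym : ∀ {A B} → A ~ B → B ~ A
  ~-sym {A} {B} (link s m m') = link (opposite s) (subst B (sym (src-opposite s)) m') (subst A (sym (dst-opposite s)) m)

  conn-∪ : ∀ {A B} → Conn A → Conn B → A ~ B → Conn (A ∪ B)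
  conn-∪ cA cB _ μ ν (inj₁ a) (inj₁ b) = widen inj₁ (cA μ ν a b)
  conn-∪ cA cB _ μ ν (inj₂ a) (inj₂ b) = widen inj₂ (cB μ ν a b)
  conn-∪ cA cB (link s m m') μ ν (inj₁ a) (inj₂ b) = widen inj₁ (cA μ _ a m) ++ʷ move s (inj₁ m) (widen inj₂ (cB _ ν m' b))
  conn-∪ cA cB (link s m m') μ ν (inj₂ a) (inj₁ b) = reverseʷ (widen inj₁ (cA ν _ b m) ++ʷ move s (inj₁ m) (widen inj₂ (cB _ μ m' a)))

  -- A set of edges of the extended graph modulo 2. An edge of G is recorded on both of its darts, a
  -- spoke or rim on its single index.
  record Chain : Set where
    constructor chain
    field
      edge spoke rim : Fin d → Bool
  open Chain

  δ : Fin d → Fin d → Bool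
  δ x y = does (y ≟ᶠ x)

  zeroᶜ : Fin d → Bool
  zeroᶜ _ = false

  stepChain : Step → Chain
  stepChain (E x) = chain (λ y → δ x y xor δ (rev x) y) zeroᶜ zeroᶜ
  stepChain (S⁺ x) = chain zeroᶜ (δ x) zeroᶜ
  stepChain (S⁻ x) = chain zeroᶜ (δ x) zeroᶜ
  stepChain (R⁺ x) = chain zeroᶜ zeroᶜ (δ x)
  stepChain (R⁻ x) = chain zeroᶜ zeroᶜ (δ x)

  _⊕_ : Chain → Chain → Chain
  C ⊕ C' = chain (λ y → edge C y xor edge C' y) (λ y → spoke C y xor spoke C' y) (λ y → rim C y xor rim C' y)

  walkChain : ∀ {A a b} → Walk A a b → Chain
  walkChain (stop _) = chain zeroᶜ zeroᶜ zeroᶜ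
  walkChain (move s _ w) = stepChain s ⊕ walkChain w

  δ-rev : ∀ x y → δ x (rev y) ≡ δ (rev x) y
  δ-rev x y = does-⇔ (λ e → trans (sym (rev-invol y)) (cong rev e)) (λ e → trans (cong rev e) (rev-invol x))

  δ-φ⁻¹ : ∀ x z → δ x (φ⁻¹ z) ≡ δ (φ x) z
  δ-φ⁻¹ x z = does-⇔ (λ e → trans (sym (φ-φ⁻¹ z)) (cong φ e)) (λ e → trans (cong φ⁻¹ e) (φ⁻¹-φ x))

  Σ-δ : ∀ x (f : Fin d → Bool) → Σ⊕ (λ y → δ x y ∧ f y) ≡ f x
  Σ-δ x f = by (f x) refl
    where
    by : ∀ b → f x ≡ b → Σ⊕ (λ y → δ x y ∧ f y) ≡ f x
    by true e = trans (Σ-one _ x (cong₂ _∧_ (dec-true (x ≟ᶠ x) refl) e) (λ y ne → cong (_∧ f y) (dec-false (y ≟ᶠ x) ne))) (sym e)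
    by false e = trans (Σ-zero _ zero-at) (sym e)
      where
      zero-at : ∀ y → δ x y ∧ f y ≡ false
      zero-at y with y ≟ᶠ x
      ... | yes refl = e
      ... | no _ = refl

  -- Pushing rims out to the parallel edges projects a walk to G.
  shadow : Chain → Fin d → Bool
  shadow C y = edge C y xor (rim C y xor rim C (rev y))

  base : Node → Fin n
  base (V v) = v
  base (K z) = tail z

  corner : Node → Fin d → Bool
  corner (V _) _ = false
  corner (K x) z = δ x z

  private
    Σ-shadow-⊕ : ∀ C C' (χ : Fin n → Bool) → Σ⊕ (λ y → shadow (C ⊕ C') y ∧ χ (tail y)) ≡
      Σ⊕ (λ y → shadow C y ∧ χ (tail y)) xor Σ⊕ (λ y → shadow C' y ∧ χ (tail y))
    Σ-shadow-⊕ C C' χ = trans (sum-cong-≗ (λ y → taut 7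
        (λ a b c a' b' c' t → ((a xor a') xor ((b xor b') xor (c xor c'))) ∧ t)
        (λ a b c a' b' c' t → ((a xor (b xor c)) ∧ t) xor ((a' xor (b' xor c')) ∧ t))
        (edge C y) (rim C y) (rim C (rev y)) (edge C' y) (rim C' y) (rim C' (rev y)) (χ (tail y))))
      (∑-distrib-+ (λ y → shadow C y ∧ χ (tail y)) (λ y → shadow C' y ∧ χ (tail y)))

    Σ-pair : ∀ x (χ : Fin n → Bool) → Σ⊕ (λ y → (δ x y xor δ (rev x) y) ∧ χ (tail y)) ≡ χ (tail x) xor χ (head x)
    Σ-pair x χ = trans (sum-cong-≗ (λ y → taut 3 (λ a b t → (a xor b) ∧ t) (λ a b t → (a ∧ t) xor (b ∧ t)) (δ x y) (δ (rev x) y) (χ (tail y))))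
      (trans (∑-distrib-+ (λ y → δ x y ∧ χ (tail y)) (λ y → δ (rev x) y ∧ χ (tail y)))
        (cong₂ _xor_ (Σ-δ x (λ y → χ (tail y))) (Σ-δ (rev x) (λ y → χ (tail y)))))

    Σ-rim : ∀ x (χ : Fin n → Bool) → Σ⊕ (λ y → (δ x y xor δ x (rev y)) ∧ χ (tail y)) ≡ χ (tail x) xor χ (tail (φ x))
    Σ-rim x χ = trans (sum-cong-≗ (λ y → cong (λ b → (δ x y xor b) ∧ χ (tail y)) (δ-rev x y)))
      (trans (Σ-pair x χ) (cong (λ v → χ (tail x) xor χ v) (sym (tail-φ x))))

    step-shadow : ∀ s (χ : Fin n → Bool) → Σ⊕ (λ y → shadow (stepChain s) y ∧ χ (tail y)) ≡ χ (base (src s)) xor χ (base (dst s))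
    step-shadow (E x) χ = trans (sum-cong-≗ (λ y → cong (_∧ χ (tail y)) (taut 1 (λ a → a xor false) id (δ x y xor δ (rev x) y)))) (Σ-pair x χ)
    step-shadow (S⁺ x) χ = trans (Σ-zero {d} (λ y → false) (λ _ → refl)) (taut 1 (λ _ → false) (λ a → a xor a) (χ (tail x)))
    step-shadow (S⁻ x) χ = trans (Σ-zero {d} (λ y → false) (λ _ → refl)) (taut 1 (λ _ → false) (λ a → a xor a) (χ (tail x)))
    step-shadow (R⁺ x) χ = Σ-rim x χ
    step-shadow (R⁻ x) χ = trans (Σ-rim x χ) (taut 2 (λ a b → a xor b) (λ a b → b xor a) (χ (tail x)) (χ (tail (φ x))))

    walk-shadow : ∀ {A a b} (w : Walk A a b) (χ : Fin n → Bool) →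
      Σ⊕ (λ y → shadow (walkChain w) y ∧ χ (tail y)) ≡ χ (base a) xor χ (base b)
    walk-shadow {a = a} (stop _) χ = trans (Σ-zero {d} (λ y → false) (λ _ → refl)) (taut 1 (λ _ → false) (λ x → x xor x) (χ (base a)))
    walk-shadow {b = b} (move s _ w) χ = trans (Σ-shadow-⊕ (stepChain s) (walkChain w) χ)
      (trans (cong₂ _xor_ (step-shadow s χ) (walk-shadow w χ))
        (taut 3 (λ x y z → (x xor y) xor (y xor z)) (λ x y z → x xor z) (χ (base (src s))) (χ (base (dst s))) (χ (base b))))

    -- The degree of the chain at the corner `K z`, which lies on two rims and one spoke.
    cornerSum : Chain → Fin d → Bool
    cornerSum C z = (rim C (φ⁻¹ z) xor rim C z) xor spoke C z

    step-corner : ∀ s z → cornerSum (stepChain s) z ≡ corner (src s) z xor corner (dst s) z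
    step-corner (E x) z = refl
    step-corner (S⁺ x) z = refl
    step-corner (S⁻ x) z = taut 1 id (λ a → a xor false) (δ x z)
    step-corner (R⁺ x) z = trans (cong (λ a → (a xor δ x z) xor false) (δ-φ⁻¹ x z))
      (taut 2 (λ a b → (a xor b) xor false) (λ a b → b xor a) (δ (φ x) z) (δ x z))
    step-corner (R⁻ x) z = trans (cong (λ a → (a xor δ x z) xor false) (δ-φ⁻¹ x z))
      (taut 2 (λ a b → (a xor b) xor false) (λ a b → a xor b) (δ (φ x) z) (δ x z))

    walk-corner : ∀ {A a b} (w : Walk A a b) z → cornerSum (walkChain w) z ≡ corner a z xor corner b z
    walk-corner {a = a} (stop _) z = taut 1 (λ _ → false) (λ x → x xor x) (corner a z)
    walk-corner {b = b} (move s _ w) z =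
      trans (taut 6 (λ a b c a' b' c' → ((a xor a') xor (b xor b')) xor (c xor c')) (λ a b c a' b' c' → ((a xor b) xor c) xor ((a' xor b') xor c'))
          (rim (stepChain s) (φ⁻¹ z)) (rim (stepChain s) z) (spoke (stepChain s) z) (rim (walkChain w) (φ⁻¹ z)) (rim (walkChain w) z) (spoke (walkChain w) z))
      (trans (cong₂ _xor_ (step-corner s z) (walk-corner w z))
        (taut 3 (λ x y z → (x xor y) xor (y xor z)) (λ x y z → x xor z) (corner (src s) z) (corner (dst s) z) (corner b z)))

    edge-sym : ∀ {A a b} (w : Walk A a b) y → edge (walkChain w) (rev y) ≡ edge (walkChain w) y
    edge-sym (stop _) y = refl
    edge-sym (move s _ w) y = cong₂ _xor_ (sym-step s) (edge-sym w y)
      where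
      sym-step : ∀ s → edge (stepChain s) (rev y) ≡ edge (stepChain s) y
      sym-step (E x) = trans (cong₂ _xor_ (δ-rev x y) (trans (δ-rev (rev x) y) (cong (λ z → δ z y) (rev-invol x))))
        (taut 2 (λ a b → a xor b) (λ a b → b xor a) (δ (rev x) y) (δ x y))
      sym-step (S⁺ x) = refl
      sym-step (S⁻ x) = refl
      sym-step (R⁺ x) = refl
      sym-step (R⁻ x) = refl

  -- The two sides of a closed curve: side x is the value between the edge x and the rim x, centre x the value in the middle of the face.
  record Sides (C : Chain) : Set where
    field
      side centre : Fin d → Bool
      across-edge  : ∀ x → side x xor side (rev x) ≡ edge C x
      across-spoke : ∀ x → side (rev x) xor side (next x) ≡ spoke C (next x)
      across-rim   : ∀ x → side x xor centre x ≡ rim C x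
      centre-φ     : ∀ x → centre (φ x) ≡ centre x
  open Sides

  -- Two walks with common ends form a closed curve, whose shadow is an even set of edges of G. The
  -- face colouring given by `jordan` becomes the value at the centres, and crossing the rim gives
  -- the value next to the edge. The spokes come out right because the curve has even degree at
  -- every corner.
  sides : ∀ {A B a b} (v : Walk A a b) (w : Walk B a b) → Sides (walkChain v ⊕ walkChain w)
  sides {a = a} {b} v w = record
    { side = λ x → g x xor rim C x
    ; centre = g
    ; across-edge = λ x → trans (taut 4 (λ a r b s → (a xor r) xor (b xor s)) (λ a r b s → (a xor b) xor (r xor s)) (g x) (rim C x) (g (rev x)) (rim C (rev x)))
        (trans (cong (_xor (rim C x xor rim C (rev x))) (g-∂ x)) (taut 2 (λ e r → (e xor r) xor r) (λ e r → e) (edge C x) (rim C x xor rim C (rev x))))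
    ; across-spoke = λ x → trans (cong (λ z → (g (rev x) xor rim C (rev x)) xor (z xor rim C (next x)))
            (trans (cong (λ z → g (next z)) (sym (rev-invol x))) (g-φ (rev x))))
        (trans (taut 3 (λ a r s → (a xor r) xor (a xor s)) (λ a r s → r xor s) (g (rev x)) (rim C (rev x)) (rim C (next x)))
          (xor-≡ (trans (cong (λ z → (rim C (rev z) xor rim C (next x)) xor spoke C (next x)) (sym (prev-next x))) (C-corner (next x)))))
    ; across-rim = λ x → taut 2 (λ a r → (a xor r) xor a) (λ a r → r) (g x) (rim C x)
    ; centre-φ = g-φ }
    where
    C = walkChain v ⊕ walkChain w
    C-corner : ∀ z → cornerSum C z ≡ false
    C-corner z = trans (taut 6 (λ a b c a' b' c' → ((a xor a') xor (b xor b')) xor (c xor c')) (λ a b c a' b' c' → ((a xor b) xor c) xor ((a' xor b') xor c'))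
          (rim (walkChain v) (φ⁻¹ z)) (rim (walkChain v) z) (spoke (walkChain v) z) (rim (walkChain w) (φ⁻¹ z)) (rim (walkChain w) z) (spoke (walkChain w) z))
      (trans (cong₂ _xor_ (walk-corner v z) (walk-corner w z)) (taut 1 (λ x → x xor x) (λ _ → false) (corner a z xor corner b z)))
    shadow-sym : ∀ y → shadow C (rev y) ≡ shadow C y
    shadow-sym y = trans (cong₂ (λ e z → e xor (rim C (rev y) xor rim C z)) (cong₂ _xor_ (edge-sym v y) (edge-sym w y)) (rev-invol y))
      (taut 3 (λ e r s → e xor (s xor r)) (λ e r s → e xor (r xor s)) (edge C y) (rim C y) (rim C (rev y)))
    shadow-even : Even (shadow C)
    shadow-even χ = trans (Σ-shadow-⊕ (walkChain v) (walkChain w) χ)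
      (trans (cong₂ _xor_ (walk-shadow v χ) (walk-shadow w χ)) (taut 1 (λ x → x xor x) (λ _ → false) (χ (base a) xor χ (base b))))
    coloring : FaceColoring (shadow C)
    coloring = jordan (shadow C) shadow-sym shadow-even
    g = proj₁ coloring
    g-φ = proj₁ (proj₂ coloring)
    g-∂ = proj₂ (proj₂ coloring)

  record _≗ᶜ_ (C C' : Chain) : Set where
    field
      edge-≗ : ∀ y → edge C y ≡ edge C' y
      spoke-≗ : ∀ y → spoke C y ≡ spoke C' y
      rim-≗ : ∀ y → rim C y ≡ rim C' y
  open _≗ᶜ_

  sum-sides : ∀ {C C' D} → Sides C → Sides C' → (C ⊕ C') ≗ᶜ D → Sides D
  sum-sides {C} {C'} s t eq = record
    { side = λ x → side s x xor side t x
    ; centre = λ x → centre s x xor centre t x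
    ; across-edge = λ x → trans (taut 4 I J (side s x) (side t x) (side s (rev x)) (side t (rev x)))
        (trans (cong₂ _xor_ (across-edge s x) (across-edge t x)) (edge-≗ eq x))
    ; across-spoke = λ x → trans (taut 4 I J (side s (rev x)) (side t (rev x)) (side s (next x)) (side t (next x)))
        (trans (cong₂ _xor_ (across-spoke s x) (across-spoke t x)) (spoke-≗ eq (next x)))
    ; across-rim = λ x → trans (taut 4 I J (side s x) (side t x) (centre s x) (centre t x))
        (trans (cong₂ _xor_ (across-rim s x) (across-rim t x)) (rim-≗ eq x))
    ; centre-φ = λ x → cong₂ _xor_ (centre-φ s x) (centre-φ t x) }
    where
    I J : Bool → Bool → Bool → Bool → Bool
    I a b c e = (a xor b) xor (c xor e)
    J a b c e = (a xor c) xor (b xor e)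

  -- A corner takes the value of the centre of its face, so the only thing that matters there is the
  -- rim between the centre and the strip along the edge.
  Off : Chain → Node → Set
  Off C (V v) = ∀ y → tail y ≡ v → edge C y ≡ false × spoke C y ≡ false
  Off C (K z) = rim C z ≡ false

  Off-⊕ : ∀ {C C'} ν → Off C ν → Off C' ν → Off (C ⊕ C') ν
  Off-⊕ (V v) o o' y t = cong₂ _xor_ (proj₁ (o y t)) (proj₁ (o' y t)) , cong₂ _xor_ (proj₂ (o y t)) (proj₂ (o' y t))
  Off-⊕ (K z) o o' = cong₂ _xor_ o o'

  private
    step-off : ∀ s ν → src s ≢ ν → dst s ≢ ν → Off (stepChain s) ν
    step-off (E x) (V v) p q y t = cong₂ _xor_ (dec-false (y ≟ᶠ x) λ { refl → p (cong V t) })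
      (dec-false (y ≟ᶠ rev x) λ { refl → q (cong V t) }) , refl
    step-off (S⁺ x) (V v) p q y t = refl , dec-false (y ≟ᶠ x) λ { refl → p (cong V t) }
    step-off (S⁻ x) (V v) p q y t = refl , dec-false (y ≟ᶠ x) λ { refl → q (cong V t) }
    step-off (R⁺ x) (V v) p q y t = refl , refl
    step-off (R⁻ x) (V v) p q y t = refl , refl
    step-off (E x) (K z) p q = refl
    step-off (S⁺ x) (K z) p q = refl
    step-off (S⁻ x) (K z) p q = refl
    step-off (R⁺ x) (K z) p q = dec-false (z ≟ᶠ x) λ { refl → p refl }
    step-off (R⁻ x) (K z) p q = dec-false (z ≟ᶠ x) λ { refl → q refl }

    walk-off : ∀ {A a b} (w : Walk A a b) ν → ¬ A ν → Off (walkChain w) ν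
    walk-off (stop _) (V v) _ y t = refl , refl
    walk-off (stop _) (K z) _ = refl
    walk-off {A} (move s m w) ν ¬a = Off-⊕ {stepChain s} ν (step-off s ν (λ e → ¬a (subst A e m)) (λ e → ¬a (subst A e (walk-start w)))) (walk-off w ν ¬a)

  module _ {C : Chain} (S : Sides C) where
    Value : Node → Bool → Set
    Value (V v) b = ∀ y → tail y ≡ v → side S y ≡ b
    Value (K z) b = centre S z ≡ b

    -- A turn around the vertex crosses only its edges and spokes, none of which lie on the curve.
    value-here : ∀ {y} → Off C (V (tail y)) → Value (V (tail y)) (side S y)
    value-here {y} off z t = let k , e = rot-cycle y z (sym t) in trans (cong (side S) (sym e)) (rot k)
      where
      tail-iter : ∀ k → tail (iter next k y) ≡ tail y
      tail-iter zero = refl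
      tail-iter (suc k) = trans (next-tail _) (tail-iter k)
      rot : ∀ k → side S (iter next k y) ≡ side S y
      rot zero = refl
      rot (suc k) = trans (sym (trans (xor-≡ (trans (across-edge S w) (proj₁ (off w (tail-iter k)))))
          (xor-≡ (trans (across-spoke S w) (proj₂ (off (next w) (tail-iter (suc k)))))))) (rot k)
        where w = iter next k y

    transport : ∀ {A a c b} → (∀ {ν} → A ν → Off C ν) → Walk A a c → Value a b → Value c b
    transport off (stop _) val = val
    transport {A} {b = b} off (move s m w) val = transport off w (one s (off m) (off (walk-start w)) val)
      where
      one : ∀ s → Off C (src s) → Off C (dst s) → Value (src s) b → Value (dst s) b
      one (E x) o o' val y t = trans (value-here o' y t) (trans (sym (xor-≡ (trans (across-edge S x) (proj₁ (o x refl))))) (val x refl))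
      one (S⁺ x) o o' val = trans (sym (xor-≡ (trans (across-rim S x) o'))) (val x refl)
      one (S⁻ x) o o' val y t = trans (value-here o' y t) (trans (xor-≡ (trans (across-rim S x) o)) val)
      one (R⁺ x) o o' val = trans (centre-φ S x) val
      one (R⁻ x) o o' val = trans (sym (centre-φ S x)) val

  record Leg (x : Fin n) (C B : Node → Set) (end : Node) : Set where
    field
      dart : Fin d
      dart-tail : tail dart ≡ x
      dart-head : C (V (head dart))
      inner : Walk (C ∪ B) (V (head dart)) end
    Range : Node → Set
    Range ν = ν ≡ V x ⊎ (C ∪ B) ν
    rest : Walk Range (V (head dart)) end
    rest = widen inj₂ inner
    whole : Walk Range (V x) end
    whole = move′ (E dart) (cong V dart-tail) refl (inj₁ refl) rest
  open Leg hiding (Range)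

  Touches : Fin n → (Node → Set) → Set
  Touches x C = ∃[ e ] (tail e ≡ x × C (V (head e)))

  leg : ∀ {x C B end} → Touches x C → Conn C → Conn B → C ~ B → B end → Leg x C B end
  leg (e , t , h) cC cB (link s m m') end = record
    { dart = e ; dart-tail = t ; dart-head = h
    ; inner = widen inj₁ (cC _ _ h m) ++ʷ move s (inj₁ m) (widen inj₂ (cB _ _ m' end)) }

  module _ {x : Fin n} {C B : Node → Set} {end : Node} (l : Leg x C B end) where
    leg-off : ∀ ν → ν ≢ V x → ¬ C ν → ¬ B ν → Off (walkChain (whole l)) ν
    leg-off ν p q r = walk-off (whole l) ν λ { (inj₁ e) → p e ; (inj₂ (inj₁ c)) → q c ; (inj₂ (inj₂ b)) → r b }

    private
      chain-move′ : ∀ {A : Node → Set} {a b c} s (p : src s ≡ a) (q : dst s ≡ b) (m : A a) (w : Walk A b c) → walkChain (move′ s p q m w) ≡ stepChain s ⊕ walkChain w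
      chain-move′ s refl refl m w = refl

      chain-widen : ∀ {A A' : Node → Set} {a b} (f : ∀ {ν} → A ν → A' ν) (w : Walk A a b) → walkChain (widen {B = A'} f w) ≡ walkChain w
      chain-widen f (stop _) = refl
      chain-widen f (move s m w) = cong (stepChain s ⊕_) (chain-widen f w)

      whole-chain : walkChain (whole l) ≡ stepChain (E (dart l)) ⊕ walkChain (inner l)
      whole-chain = trans (chain-move′ (E (dart l)) (cong V (dart-tail l)) refl (inj₁ refl) (rest l))
        (cong (stepChain (E (dart l)) ⊕_) (chain-widen {A' = Leg.Range l} inj₂ (inner l)))

    -- The rest of the leg stays in `C ∪ B` and never returns to `x`.
    leg-start : ¬ C (V x) → ¬ B (V x) → ∀ y → tail y ≡ x → edge (walkChain (whole l)) y ≡ δ (dart l) y × spoke (walkChain (whole l)) y ≡ false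
    leg-start ¬c ¬b y t = subst (λ c → edge c y ≡ δ (dart l) y × spoke c y ≡ false) (sym whole-chain)
      ( trans (cong₂ (λ a b → (δ (dart l) y xor a) xor b)
                (dec-false (y ≟ᶠ rev (dart l)) (λ e → no-loop (dart l) (trans (trans (cong tail (sym e)) t) (sym (dart-tail l)))))
                (proj₁ off))
              (taut 1 (λ a → (a xor false) xor false) id (δ (dart l) y))
      , proj₂ off)
      where
      off : edge (walkChain (inner l)) y ≡ false × spoke (walkChain (inner l)) y ≡ false
      off = walk-off (inner l) (V x) (λ { (inj₁ c) → ¬c c ; (inj₂ b) → ¬b b }) y t

  -- The legs form a theta curve from `x` to `end`. At `x` a closed curve of two legs changes sides
  -- exactly at its own two darts, so `rotation` applies.
  module Tripod {x C₁ C₂ C₃ B end} (l₁ : Leg x C₁ B end) (l₂ : Leg x C₂ B end) (l₃ : Leg x C₃ B end)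
      (x∉₁ : ¬ C₁ (V x)) (x∉₂ : ¬ C₂ (V x)) (x∉₃ : ¬ C₃ (V x)) (x∉B : ¬ B (V x))
      (d₁₂ : Disjoint C₁ C₂) (d₁₃ : Disjoint C₁ C₃) (d₂₃ : Disjoint C₂ C₃)
      (s₁₂ : Sides (walkChain (whole l₁) ⊕ walkChain (whole l₂)))
      (s₁₃ : Sides (walkChain (whole l₁) ⊕ walkChain (whole l₃))) where
    private
      At : Fin d → Set
      At y = tail y ≡ x

      At-next : ∀ {y} → At y → At (next y)
      At-next {y} t = trans (next-tail y) t

      At-cycle : ∀ {y z} → At y → At z → ∃[ k ] iter next k y ≡ z
      At-cycle {y} {z} t t' = rot-cycle y z (trans t (sym t'))

      open Rotation next At At-next At-cycle

      crossing : ∀ {C C' : Node → Set} (l : Leg x C B end) (l' : Leg x C' B end) → ¬ C (V x) → ¬ C' (V x) →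
        (s : Sides (walkChain (whole l) ⊕ walkChain (whole l'))) → Crosses (side s) (λ y → δ (dart l) y xor δ (dart l') y)
      crossing l l' ¬c ¬c' s {y} t = trans (sym (xor-≡ {side s (rev y)} {side s (next y)} (trans (across-spoke s y)
            (cong₂ _xor_ (proj₂ (leg-start l ¬c x∉B (next y) t')) (proj₂ (leg-start l' ¬c' x∉B (next y) t'))))))
          (solve {side s y} {side s (rev y)} (trans (across-edge s y) (cong₂ _xor_ (proj₁ (leg-start l ¬c x∉B y t)) (proj₁ (leg-start l' ¬c' x∉B y t)))))
        where
        t' = trans (next-tail y) t
        solve : ∀ {a b c} → a xor b ≡ c → b ≡ a xor c
        solve {a} {b} refl = taut 2 (λ a b → b) (λ a b → a xor (a xor b)) a b

    apart : ∀ {C C' : Node → Set} (l : Leg x C B end) (l' : Leg x C' B end) → Disjoint C C' → dart l ≢ dart l'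
    apart {C' = C'} l l' dis e = dis (V (head (dart l))) (dart-head l) (subst (λ z → C' (V (head z))) (sym e) (dart-head l'))

    tripod : (side s₁₂ (dart l₃) xor side s₁₃ (dart l₂)) xor (side s₁₂ (dart l₁) xor side s₁₃ (dart l₁)) ≡ true
    tripod = rotation (λ y a → δ a y) (λ a → dec-true (a ≟ᶠ a) refl) (λ {a} {b} ne → dec-false (a ≟ᶠ b) ne) _≟ᶠ_ (side s₁₂) (side s₁₃)
      (dart-tail l₁) (dart-tail l₂) (dart-tail l₃) (apart l₁ l₂ d₁₂) (apart l₁ l₃ d₁₃) (apart l₂ l₃ d₂₃)
      (crossing l₁ l₂ x∉₁ x∉₂ s₁₂) (crossing l₁ l₃ x∉₁ x∉₃ s₁₃)

    uncrossed : ∀ {C C' C'' : Node → Set} (l : Leg x C B end) (l' : Leg x C' B end) (l'' : Leg x C'' B end) → ¬ C (V x) → ¬ C' (V x) →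
      Disjoint C C'' → Disjoint C' C'' → ∀ (s : Sides (walkChain (whole l) ⊕ walkChain (whole l'))) → side s (dart l'') ≡ side s (rev (dart l''))
    uncrossed l l' l'' ¬c ¬c' dis dis' s = xor-≡ (trans (across-edge s (dart l''))
      (cong₂ _xor_ (trans (proj₁ (leg-start l ¬c x∉B _ (dart-tail l''))) (dec-false (dart l'' ≟ᶠ dart l) (apart l l'' dis ∘ sym)))
                   (trans (proj₁ (leg-start l' ¬c' x∉B _ (dart-tail l''))) (dec-false (dart l'' ≟ᶠ dart l') (apart l' l'' dis' ∘ sym)))))

  private
    -- `Value` is vacuous at a vertex without darts, so the node where sides are compared must own
    -- one.
    Witness : Node → Set
    Witness (V v) = ∃[ y ] tail y ≡ v
    Witness (K _) = ⊤

    dst-witness : ∀ s → Witness (dst s)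
    dst-witness (E x) = rev x , refl
    dst-witness (S⁺ x) = tt
    dst-witness (S⁻ x) = x , refl
    dst-witness (R⁺ x) = tt
    dst-witness (R⁻ x) = tt

  record K₃₃ (x : Fin n) (C₁ C₂ C₃ B D : Node → Set) : Set where
    field
      c₁ : Conn C₁
      c₂ : Conn C₂
      c₃ : Conn C₃
      cB : Conn B
      cD : Conn D
      x~₁ : Touches x C₁
      x~₂ : Touches x C₂
      x~₃ : Touches x C₃
      b~₁ : C₁ ~ B
      b~₂ : C₂ ~ B
      b~₃ : C₃ ~ B
      d~₁ : C₁ ~ D
      d~₂ : C₂ ~ D
      d~₃ : C₃ ~ D
      x∉₁ : ¬ C₁ (V x)
      x∉₂ : ¬ C₂ (V x)
      x∉₃ : ¬ C₃ (V x)
      x∉B : ¬ B (V x)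
      x∉D : ¬ D (V x)
      d₁₂ : Disjoint C₁ C₂
      d₁₃ : Disjoint C₁ C₃
      d₂₃ : Disjoint C₂ C₃
      d₁B : Disjoint C₁ B
      d₂B : Disjoint C₂ B
      d₃B : Disjoint C₃ B
      d₁D : Disjoint C₁ D
      d₂D : Disjoint C₂ D
      d₃D : Disjoint C₃ D
      dBD : Disjoint B D

  flip-disjoint : ∀ {A B} → Disjoint A B → Disjoint B A
  flip-disjoint d ν b a = d ν a b

  -- No region of a theta curve touches all three legs. Each branch set, together with `D`, avoids
  -- the closed curve of the other two legs, so the three sides in question can be read off at one
  -- node of `D`. There they sum to zero, since the third curve is the sum of the other two, while
  -- `tripod` gives one.
  no-K₃₃ : ∀ {x C₁ C₂ C₃ B D} → ¬ K₃₃ x C₁ C₂ C₃ B D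
  no-K₃₃ {x} {C₁} {C₂} {C₃} {B} {D} k = contradiction (trans (sym tripod) total) λ ()
    where
    open K₃₃ k
    end = dst (via b~₁)
    l₁ : Leg x C₁ B end
    l₁ = leg x~₁ c₁ cB b~₁ (to b~₁)
    l₂ : Leg x C₂ B end
    l₂ = leg x~₂ c₂ cB b~₂ (to b~₁)
    l₃ : Leg x C₃ B end
    l₃ = leg x~₃ c₃ cB b~₃ (to b~₁)
    q₁ = walkChain (whole l₁)
    q₂ = walkChain (whole l₂)
    q₃ = walkChain (whole l₃)
    s₁₂ : Sides (q₁ ⊕ q₂)
    s₁₂ = sides (whole l₁) (whole l₂)
    s₁₃ : Sides (q₁ ⊕ q₃)
    s₁₃ = sides (whole l₁) (whole l₃)
    s₂₃ : Sides (q₂ ⊕ q₃)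
    s₂₃ = sum-sides s₁₂ s₁₃ record
      { edge-≗ = λ y → taut 3 I J (edge q₁ y) (edge q₂ y) (edge q₃ y)
      ; spoke-≗ = λ y → taut 3 I J (spoke q₁ y) (spoke q₂ y) (spoke q₃ y)
      ; rim-≗ = λ y → taut 3 I J (rim q₁ y) (rim q₂ y) (rim q₃ y) }
      where
      I J : Bool → Bool → Bool → Bool
      I a b c = (a xor b) xor (a xor c)
      J a b c = b xor c
    open Tripod l₁ l₂ l₃ x∉₁ x∉₂ x∉₃ x∉B d₁₂ d₁₃ d₂₃ s₁₂ s₁₃
    hub = dst (via d~₁)
    hub∈ : D hub
    hub∈ = to d~₁
    off : ∀ {C C' C''} (l : Leg x C B end) (l' : Leg x C' B end) → ¬ C'' (V x) → Disjoint C C'' → Disjoint C' C'' → Disjoint C'' B →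
      Disjoint C D → Disjoint C' D → ∀ {ν} → (C'' ∪ D) ν → Off (walkChain (whole l) ⊕ walkChain (whole l')) ν
    off l l' ¬c dis dis' disB dD dD' {ν} (inj₁ m) = Off-⊕ {walkChain (whole l)} ν
      (leg-off l ν (λ { refl → ¬c m }) (λ c → dis ν c m) (λ b → disB ν m b)) (leg-off l' ν (λ { refl → ¬c m }) (λ c → dis' ν c m) (λ b → disB ν m b))
    off l l' ¬c dis dis' disB dD dD' {ν} (inj₂ m) = Off-⊕ {walkChain (whole l)} ν
      (leg-off l ν (λ { refl → x∉D m }) (λ c → dD ν c m) (λ b → dBD ν b m)) (leg-off l' ν (λ { refl → x∉D m }) (λ c → dD' ν c m) (λ b → dBD ν b m))
    to-hub : ∀ {C C' C''} (l : Leg x C B end) (l' : Leg x C' B end) (l'' : Leg x C'' B end) → Conn C'' → C'' ~ D → ¬ C'' (V x) →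
      Disjoint C C'' → Disjoint C' C'' → Disjoint C'' B → Disjoint C D → Disjoint C' D →
      (s : Sides (walkChain (whole l) ⊕ walkChain (whole l'))) → Value s hub (side s (rev (dart l'')))
    to-hub l l' l'' c (link t m m') ¬c dis dis' disB dD dD' s = transport s o
      (widen inj₁ (c _ _ (dart-head l'') m) ++ʷ move t (inj₁ m) (widen inj₂ (cD _ _ m' hub∈)))
      (value-here s (o (inj₁ (dart-head l''))))
      where o = off l l' ¬c dis dis' disB dD dD'
    v₁₂ = to-hub l₁ l₂ l₃ c₃ d~₃ x∉₃ d₁₃ d₂₃ d₃B d₁D d₂D s₁₂
    v₁₃ = to-hub l₁ l₃ l₂ c₂ d~₂ x∉₂ d₁₂ (flip-disjoint d₂₃) d₂B d₁D d₃D s₁₃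
    v₂₃ = to-hub l₂ l₃ l₁ c₁ d~₁ x∉₁ (flip-disjoint d₁₂) (flip-disjoint d₁₃) d₁B d₂D d₃D s₂₃
    agree : ∀ ν → Witness ν → ∀ {a b c} → Value s₁₂ ν a → Value s₁₃ ν b → Value s₂₃ ν c → c ≡ a xor b
    agree (V v) (y , t) p q r = trans (sym (r y t)) (cong₂ _xor_ (p y t) (q y t))
    agree (K z) _ p q r = trans (sym r) (cong₂ _xor_ p q)
    total : (side s₁₂ (dart l₃) xor side s₁₃ (dart l₂)) xor (side s₁₂ (dart l₁) xor side s₁₃ (dart l₁)) ≡ false
    total = trans (cong₂ _xor_ (cong₂ _xor_ (uncrossed l₁ l₂ l₃ x∉₁ x∉₂ d₁₃ d₂₃ s₁₂) (uncrossed l₁ l₃ l₂ x∉₁ x∉₃ d₁₂ (flip-disjoint d₂₃) s₁₃))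
        (trans (uncrossed l₂ l₃ l₁ x∉₂ x∉₃ (flip-disjoint d₁₂) (flip-disjoint d₁₃) s₂₃) (agree hub (dst-witness (via d~₁)) v₁₂ v₁₃ v₂₃)))
      (taut 1 (λ a → a xor a) (λ _ → false) (side s₁₂ (rev (dart l₃)) xor side s₁₃ (rev (dart l₂))))

  record K₅ (x : Fin n) (C₁ C₂ C₃ B : Node → Set) : Set where
    field
      c₁ : Conn C₁
      c₂ : Conn C₂
      c₃ : Conn C₃
      cB : Conn B
      x~₁ : Touches x C₁
      x~₂ : Touches x C₂
      x~₃ : Touches x C₃
      x~B : (_≡ V x) ~ B
      b~₁ : C₁ ~ B
      b~₂ : C₂ ~ B
      b~₃ : C₃ ~ B
      a₁₂ : C₁ ~ C₂
      a₁₃ : C₁ ~ C₃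
      a₂₃ : C₂ ~ C₃
      x∉₁ : ¬ C₁ (V x)
      x∉₂ : ¬ C₂ (V x)
      x∉₃ : ¬ C₃ (V x)
      x∉B : ¬ B (V x)
      d₁₂ : Disjoint C₁ C₂
      d₁₃ : Disjoint C₁ C₃
      d₂₃ : Disjoint C₂ C₃
      d₁B : Disjoint C₁ B
      d₂B : Disjoint C₂ B
      d₃B : Disjoint C₃ B

  -- The direct step from `x` to `B` closes each leg to a curve. With respect to this curve the
  -- other two branch sets are adjacent and lie on the same side, so three unknown values remain,
  -- and each occurs twice in the sum of `tripod`.
  no-K₅ : ∀ {x C₁ C₂ C₃ B} → ¬ K₅ x C₁ C₂ C₃ B
  no-K₅ {x} {C₁} {C₂} {C₃} {B} k = contradiction (trans (sym tripod) total) λ ()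
    where
    open K₅ k
    sx = via x~B
    end = dst sx
    end∈ = to x~B
    l₁ : Leg x C₁ B end
    l₁ = leg x~₁ c₁ cB b~₁ end∈
    l₂ : Leg x C₂ B end
    l₂ = leg x~₂ c₂ cB b~₂ end∈
    l₃ : Leg x C₃ B end
    l₃ = leg x~₃ c₃ cB b~₃ end∈
    direct : Walk (λ ν → ν ≡ V x ⊎ B ν) (V x) end
    direct = move′ sx (from x~B) refl (inj₁ refl) (stop (inj₂ end∈))
    q₀ = walkChain direct
    sideOf : ∀ {C} (l : Leg x C B end) → Sides (walkChain (whole l) ⊕ q₀)
    sideOf l = sides (whole l) direct
    s₁ = sideOf l₁
    s₂ = sideOf l₂
    s₃ = sideOf l₃
    pair : ∀ {C C'} (l : Leg x C B end) (l' : Leg x C' B end) → Sides (walkChain (whole l) ⊕ walkChain (whole l'))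
    pair l l' = sum-sides (sideOf l) (sideOf l') record
      { edge-≗ = λ y → taut 3 I J (edge (walkChain (whole l)) y) (edge (walkChain (whole l')) y) (edge q₀ y)
      ; spoke-≗ = λ y → taut 3 I J (spoke (walkChain (whole l)) y) (spoke (walkChain (whole l')) y) (spoke q₀ y)
      ; rim-≗ = λ y → taut 3 I J (rim (walkChain (whole l)) y) (rim (walkChain (whole l')) y) (rim q₀ y) }
      where
      I J : Bool → Bool → Bool → Bool
      I a b c = (a xor c) xor (b xor c)
      J a b c = a xor b
    open Tripod l₁ l₂ l₃ x∉₁ x∉₂ x∉₃ x∉B d₁₂ d₁₃ d₂₃ (pair l₁ l₂) (pair l₁ l₃)
    off : ∀ {C C'} (l : Leg x C B end) → ¬ C' (V x) → Disjoint C C' → Disjoint C' B → ∀ {ν} → C' ν → Off (walkChain (whole l) ⊕ q₀) ν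
    off l ¬c dis disB {ν} m = Off-⊕ {walkChain (whole l)} ν (leg-off l ν (λ { refl → ¬c m }) (λ c → dis ν c m) (disB ν m))
      (walk-off direct ν λ { (inj₁ refl) → ¬c m ; (inj₂ b) → disB ν m b })
    same : ∀ {C C' C''} (l : Leg x C B end) (l' : Leg x C' B end) (l'' : Leg x C'' B end) → Conn C' → Conn C'' → C' ~ C'' →
      ¬ C' (V x) → ¬ C'' (V x) → Disjoint C C' → Disjoint C C'' → Disjoint C' B → Disjoint C'' B →
      side (sideOf l) (rev (dart l'')) ≡ side (sideOf l) (rev (dart l'))
    same l l' l'' c' c'' adj ¬c' ¬c'' dis dis' disB disB' = transport (sideOf l)
      (λ { (inj₁ m) → off l ¬c' dis disB m ; (inj₂ m) → off l ¬c'' dis' disB' m })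
      (conn-∪ c' c'' adj _ _ (inj₁ (dart-head l')) (inj₂ (dart-head l''))) (value-here (sideOf l) (off l ¬c' dis disB (dart-head l'))) (rev (dart l'')) refl
    e₁ = same l₁ l₂ l₃ c₂ c₃ a₂₃ x∉₂ x∉₃ d₁₂ d₁₃ d₂B d₃B
    e₂ = same l₂ l₁ l₃ c₁ c₃ a₁₃ x∉₁ x∉₃ (flip-disjoint d₁₂) d₂₃ d₁B d₃B
    e₃ = same l₃ l₁ l₂ c₁ c₂ a₁₂ x∉₁ x∉₂ (flip-disjoint d₁₃) (flip-disjoint d₂₃) d₁B d₂B
    cancel : ∀ p q r → ((p xor q) xor (p xor r)) xor (q xor r) ≡ false
    cancel = taut 3 (λ p q r → ((p xor q) xor (p xor r)) xor (q xor r)) (λ _ _ _ → false)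
    p₁ = side s₁ (rev (dart l₂))
    p₂ = side s₂ (rev (dart l₁))
    p₃ = side s₃ (rev (dart l₁))
    total : (side (pair l₁ l₂) (dart l₃) xor side (pair l₁ l₃) (dart l₂)) xor (side (pair l₁ l₂) (dart l₁) xor side (pair l₁ l₃) (dart l₁)) ≡ false
    total = trans (cong₂ _xor_ (cong₂ _xor_
          (trans (uncrossed l₁ l₂ l₃ x∉₁ x∉₂ d₁₃ d₂₃ (pair l₁ l₂)) (cong₂ _xor_ e₁ e₂))
          (trans (uncrossed l₁ l₃ l₂ x∉₁ x∉₃ d₁₂ (flip-disjoint d₂₃) (pair l₁ l₃)) (cong (p₁ xor_) e₃)))
        (trans (taut 3 (λ p q r → (p xor q) xor (p xor r)) (λ p q r → q xor r) (side s₁ (dart l₁)) (side s₂ (dart l₁)) (side s₃ (dart l₁)))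
          (uncrossed l₂ l₃ l₁ x∉₂ x∉₃ (flip-disjoint d₁₂) (flip-disjoint d₁₃) (pair l₂ l₃))))
      (cancel p₁ p₂ p₃)

-- Recoloring in two rounds

upper-bound : ∀ {n} (r : Fin n → ℕ) → ∃[ k ] (∀ v → r v < k)
upper-bound {zero} r = 0 , λ ()
upper-bound {suc n} r = let k , h = upper-bound (r ∘ suc) in suc (r zero) ⊔ k , λ
  { zero → m≤m⊔n (suc (r zero)) k ; (suc v) → ≤-trans (h v) (m≤n⊔m (suc (r zero)) k) }

without : ∀ {n} → FSet n → Fin n → FSet n
without W u = fset (λ v → Mem W v × v ≢ u) (λ v → mem? W v ×-dec ¬? (v ≟ᶠ u))

_─_ : ∀ {n} → FSet n → FSet n → FSet n
W ─ A = fset (λ v → Mem W v × ¬ Mem A v) (λ v → mem? W v ×-dec ¬? (mem? A v))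

upd : ∀ {n} → (Fin n → ℕ) → Fin n → ℕ → Fin n → ℕ
upd f u a v with v ≟ᶠ u
... | yes _ = a
... | no _ = f v

upd-same : ∀ {n} (f : Fin n → ℕ) u a → upd f u a u ≡ a
upd-same f u a with u ≟ᶠ u
... | yes _ = refl
... | no ne = contradiction refl ne

upd-other : ∀ {n} (f : Fin n → ℕ) {u v} a → v ≢ u → upd f u a v ≡ f v
upd-other f {u} {v} a ne with v ≟ᶠ u
... | yes e = contradiction e ne
... | no _ = refl

onto : ∀ {n} {X : Set} (A : FSet n) → (Fin n → X) → (Fin n → X) → Fin n → X
onto A f g v with mem? A v
... | yes _ = f v
... | no _ = g v

module _ {n : ℕ} {X : Set} (A : FSet n) {f g : Fin n → X} where
  onto-in : ∀ {v} → Mem A v → onto A f g v ≡ f v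
  onto-in {v} m with mem? A v
  ... | yes _ = refl
  ... | no ¬m = contradiction m ¬m

  onto-out : ∀ {v} → ¬ Mem A v → onto A f g v ≡ g v
  onto-out {v} ¬m with mem? A v
  ... | yes m = contradiction m ¬m
  ... | no _ = refl

module Recolor {n : ℕ} (M : Map n) (genus0 : Map.Genus0 M) (φ₀ : Fin n → ℕ) where
  open Map M hiding (φ)
  open Minors M genus0
  open Difference ℕ._≟_ public

  Adj? : ∀ u v → Dec (Adj u v)
  Adj? u v = anyᶠ? (λ x → (tail x ≟ᶠ u) ×-dec (head x ≟ᶠ v))

  Adj-sym : ∀ {u v} → Adj u v → Adj v u
  Adj-sym (x , t , h) = rev x , h , trans (cong tail (rev-invol x)) t

  Adj-≢ : ∀ {u v} → Adj u v → u ≢ v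
  Adj-≢ (x , t , h) e = no-loop x (trans h (sym (trans t e)))

  -- The recoloring of v in round i comes at time rᵢ v; of two neighbours with equal times, either may go first.
  record Sol (W : Fin n → Set) (N₁ N₂ : Fin n → ℕ → Set) : Set where
    field
      φ₁ φ₂ r₁ r₂ : Fin n → ℕ
      in₁ : ∀ {v} → W v → N₁ v (φ₁ v)
      in₂ : ∀ {v} → W v → N₂ v (φ₂ v)
      proper₁ : ∀ {u v} → W u → W v → Adj u v → φ₁ u ≢ φ₁ v
      proper₂ : ∀ {u v} → W u → W v → Adj u v → φ₂ u ≢ φ₂ v
      order₁ : ∀ {u v} → W u → W v → Adj u v → r₁ u ≤ r₁ v → φ₁ u ≢ φ₀ v
      order₂ : ∀ {u v} → W u → W v → Adj u v → r₂ u ≤ r₂ v → φ₂ u ≢ φ₁ v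
  open Sol

  weaken : ∀ {W W' : Fin n → Set} {N₁ N₂ N₁' N₂' : Fin n → ℕ → Set} → (∀ {v} → W' v → W v) →
    (∀ {v a} → W' v → N₁ v a → N₁' v a) → (∀ {v a} → W' v → N₂ v a → N₂' v a) → Sol W N₁ N₂ → Sol W' N₁' N₂'
  weaken sub f g s = record
    { φ₁ = φ₁ s ; φ₂ = φ₂ s ; r₁ = r₁ s ; r₂ = r₂ s
    ; in₁ = λ m → f m (in₁ s (sub m)) ; in₂ = λ m → g m (in₂ s (sub m))
    ; proper₁ = λ m m' → proper₁ s (sub m) (sub m') ; proper₂ = λ m m' → proper₂ s (sub m) (sub m')
    ; order₁ = λ m m' → order₁ s (sub m) (sub m') ; order₂ = λ m m' → order₂ s (sub m) (sub m') }

  module _ (A : FSet n) (rA rC : Fin n → ℕ) where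
    private
      k = proj₁ (upper-bound rC)

    -- The times on `A` are shifted beyond every value of `rC`, so that `A` moves last.
    after : Fin n → ℕ
    after = onto A (λ v → k + rA v) rC

    after-AA : ∀ {u v} → Mem A u → Mem A v → after u ≤ after v → rA u ≤ rA v
    after-AA m m' le rewrite onto-in A {λ v → k + rA v} {rC} m | onto-in A {λ v → k + rA v} {rC} m' = +-cancelˡ-≤ k _ _ le

    after-CC : ∀ {u v} → ¬ Mem A u → ¬ Mem A v → after u ≤ after v → rC u ≤ rC v
    after-CC m m' le rewrite onto-out A {λ v → k + rA v} {rC} m | onto-out A {λ v → k + rA v} {rC} m' = le

    after-AC : ∀ {u v} → Mem A u → ¬ Mem A v → ¬ after u ≤ after v
    after-AC {u} {v} m m' le rewrite onto-in A {λ v → k + rA v} {rC} m | onto-out A {λ v → k + rA v} {rC} m' =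
      <⇒≱ (proj₂ (upper-bound rC) v) (≤-trans (m≤m+n k (rA u)) le)

  -- In the first round the vertices of C go before those of A.
  module Join (W A C : FSet n) {N₁ N₂ N₁' N₂' : Fin n → ℕ → Set} (cover : ∀ {v} → Mem W v → ¬ Mem A v → Mem C v)
      (s : Sol (Mem A) N₁ N₂) (t : Sol (Mem C) N₁' N₂')
      (i₁ : ∀ {v a} → Mem C v → N₁' v a → N₁ v a) (i₂ : ∀ {v a} → Mem C v → N₂' v a → N₂ v a)
      (x₁ : ∀ {u v a} → Mem C v → N₁' v a → Mem A u → Adj v u → a ≢ φ₀ u × a ≢ φ₁ s u)
      (x₂ : ∀ {u v a} → Mem C v → N₂' v a → Mem A u → Adj v u → a ≢ φ₂ s u) where
    private
      ψ₁ ψ₂ : Fin n → ℕ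
      ψ₁ = onto A (φ₁ s) (φ₁ t)
      ψ₂ = onto A (φ₂ s) (φ₂ t)

      by-cases : ∀ {f g : Fin n → ℕ} (P : Fin n → ℕ → Set) → (∀ {v} → Mem A v → P v (f v)) → (∀ {v} → Mem C v → P v (g v)) →
        ∀ {v} → Mem W v → P v (onto A f g v)
      by-cases P p q {v} m with mem? A v
      ... | yes a = p a
      ... | no ¬a = q (cover m ¬a)

      pairs : ∀ {f g f' g' : Fin n → ℕ} → (∀ {u v} → Mem A u → Mem A v → Adj u v → f u ≢ f' v) → (∀ {u v} → Mem C u → Mem C v → Adj u v → g u ≢ g' v) →
        (∀ {u v} → Mem A u → Mem C v → Adj u v → f u ≢ g' v) → (∀ {u v} → Mem C u → Mem A v → Adj u v → g u ≢ f' v) →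
        ∀ {u v} → Mem W u → Mem W v → Adj u v → onto A f g u ≢ onto A f' g' v
      pairs p q r r' {u} {v} mu mv adj with mem? A u | mem? A v
      ... | yes a | yes b = p a b adj
      ... | yes a | no ¬b = r a (cover mv ¬b) adj
      ... | no ¬a | yes b = r' (cover mu ¬a) b adj
      ... | no ¬a | no ¬b = q (cover mu ¬a) (cover mv ¬b) adj

    module _ (ρ₂ : Fin n → ℕ) (o₂ : ∀ {u v} → Mem W u → Mem W v → Adj u v → ρ₂ u ≤ ρ₂ v → ψ₂ u ≢ ψ₁ v) where
      joined : Sol (Mem W) N₁ N₂
      joined = record
        { φ₁ = ψ₁ ; φ₂ = ψ₂ ; r₁ = after A (r₁ s) (r₁ t) ; r₂ = ρ₂
        ; in₁ = by-cases N₁ (in₁ s) (λ c → i₁ c (in₁ t c))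
        ; in₂ = by-cases N₂ (in₂ s) (λ c → i₂ c (in₂ t c))
        ; proper₁ = pairs (proper₁ s) (proper₁ t) (λ a c adj e → proj₂ (x₁ c (in₁ t c) a (Adj-sym adj)) (sym e)) (λ c a adj → proj₂ (x₁ c (in₁ t c) a adj))
        ; proper₂ = pairs (proper₂ s) (proper₂ t) (λ a c adj e → x₂ c (in₂ t c) a (Adj-sym adj) (sym e)) (λ c a adj → x₂ c (in₂ t c) a adj)
        ; order₁ = ord₁
        ; order₂ = o₂ }
        where
        ord₁ : ∀ {u v} → Mem W u → Mem W v → Adj u v → after A (r₁ s) (r₁ t) u ≤ after A (r₁ s) (r₁ t) v → ψ₁ u ≢ φ₀ v
        ord₁ {u} {v} mu mv adj le = subst (_≢ φ₀ v) refl (go (mem? A u) (mem? A v))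
          where
          go : Dec (Mem A u) → Dec (Mem A v) → ψ₁ u ≢ φ₀ v
          go (yes a) (yes b) e = order₁ s a b adj (after-AA A (r₁ s) (r₁ t) a b le) (trans (sym (onto-in A a)) e)
          go (yes a) (no ¬b) e = after-AC A (r₁ s) (r₁ t) a ¬b le
          go (no ¬a) (yes b) e = proj₁ (x₁ (cover mu ¬a) (in₁ t (cover mu ¬a)) b adj) (trans (sym (onto-out A ¬a)) e)
          go (no ¬a) (no ¬b) e = order₁ t (cover mu ¬a) (cover mv ¬b) adj (after-CC A (r₁ s) (r₁ t) ¬a ¬b le) (trans (sym (onto-out A ¬a)) e)

    same-order : (∀ {u v a} → Mem C v → N₂' v a → Mem A u → Adj v u → a ≢ φ₁ s u) → Sol (Mem W) N₁ N₂
    same-order x₂' = joined (after A (r₂ s) (r₂ t)) λ {u} {v} mu mv adj le → go mu mv adj le (mem? A u) (mem? A v)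
      where
      go : ∀ {u v} → Mem W u → Mem W v → Adj u v → after A (r₂ s) (r₂ t) u ≤ after A (r₂ s) (r₂ t) v → Dec (Mem A u) → Dec (Mem A v) → ψ₂ u ≢ ψ₁ v
      go mu mv adj le (yes a) (yes b) e = order₂ s a b adj (after-AA A (r₂ s) (r₂ t) a b le) (trans (sym (onto-in A a)) (trans e (onto-in A b)))
      go mu mv adj le (yes a) (no ¬b) e = after-AC A (r₂ s) (r₂ t) a ¬b le
      go mu mv adj le (no ¬a) (yes b) e = x₂' (cover mu ¬a) (in₂ t (cover mu ¬a)) b adj (trans (sym (onto-out A ¬a)) (trans e (onto-in A b)))
      go mu mv adj le (no ¬a) (no ¬b) e = order₂ t (cover mu ¬a) (cover mv ¬b) adj (after-CC A (r₂ s) (r₂ t) ¬a ¬b le)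
        (trans (sym (onto-out A ¬a)) (trans e (onto-out A ¬b)))

    -- If `A` moves first in the second round, its final colours meet the first colours of `C`, and
    -- the extra condition falls on the first round. When `A` keeps its colours in the second round,
    -- that condition is already part of `x₁`.
    opposite-order : (∀ {v} → Mem C v → ¬ Mem A v) → (∀ {u v a} → Mem C v → N₁' v a → Mem A u → Adj v u → a ≢ φ₂ s u) → Sol (Mem W) N₁ N₂
    opposite-order disj x₁' = joined (after C (r₂ t) (r₂ s)) λ {u} {v} mu mv adj le → go mu mv adj le (mem? A u) (mem? A v)
      where
      go : ∀ {u v} → Mem W u → Mem W v → Adj u v → after C (r₂ t) (r₂ s) u ≤ after C (r₂ t) (r₂ s) v → Dec (Mem A u) → Dec (Mem A v) → ψ₂ u ≢ ψ₁ v
      go mu mv adj le (yes a) (yes b) e = order₂ s a b adj (after-CC C (r₂ t) (r₂ s) (λ c → disj c a) (λ c → disj c b) le) (trans (sym (onto-in A a)) (trans e (onto-in A b)))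
      go mu mv adj le (yes a) (no ¬b) e = x₁' (cover mv ¬b) (in₁ t (cover mv ¬b)) a (Adj-sym adj) (sym (trans (sym (onto-in A a)) (trans e (onto-out A ¬b))))
      go mu mv adj le (no ¬a) (yes b) e = after-AC C (r₂ t) (r₂ s) (cover mu ¬a) (λ c → disj c b) le
      go mu mv adj le (no ¬a) (no ¬b) e = order₂ t (cover mu ¬a) (cover mv ¬b) adj (after-AA C (r₂ t) (r₂ s) (cover mu ¬a) (cover mv ¬b) le)
        (trans (sym (onto-out A ¬a)) (trans e (onto-out A ¬b)))

  empty-sol : ∀ {W : Fin n → Set} {N₁ N₂} → (∀ v → ¬ W v) → Sol W N₁ N₂
  empty-sol none = record
    { φ₁ = φ₀ ; φ₂ = φ₀ ; r₁ = φ₀ ; r₂ = φ₀ ; in₁ = λ m → contradiction m (none _) ; in₂ = λ m → contradiction m (none _)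
    ; proper₁ = λ m → contradiction m (none _) ; proper₂ = λ m → contradiction m (none _)
    ; order₁ = λ m → contradiction m (none _) ; order₂ = λ m → contradiction m (none _) }

  singleton : Fin n → FSet n
  singleton u = fset (_≡ u) (_≟ᶠ u)

  single-sol : ∀ {N₁ N₂ : Fin n → ℕ → Set} u {a b} → N₁ u a → N₂ u b → Sol (_≡ u) N₁ N₂
  single-sol u {a} {b} m m' = record
    { φ₁ = λ _ → a ; φ₂ = λ _ → b ; r₁ = λ _ → 0 ; r₂ = λ _ → 0 ; in₁ = λ { refl → m } ; in₂ = λ { refl → m' }
    ; proper₁ = λ { refl refl adj → contradiction refl (Adj-≢ adj) } ; proper₂ = λ { refl refl adj → contradiction refl (Adj-≢ adj) }
    ; order₁ = λ { refl refl adj → contradiction refl (Adj-≢ adj) } ; order₂ = λ { refl refl adj → contradiction refl (Adj-≢ adj) } }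

  lift : (Fin n → Set) → Node → Set
  lift D (V v) = D v
  lift D (K _) = ⊥

  ⟦_⟧ : Fin n → Node → Set
  ⟦ v ⟧ ν = ν ≡ V v

  record Component (C D : FSet n) : Set where
    field
      inside : ∀ {v} → Mem D v → Mem C v
      closed : ∀ {v w} → Mem D v → Mem C w → Adj v w → Mem D w
      conn   : Conn (lift (Mem D))
  open Component

  Att : FSet n → Fin n → Set
  Att D v = ∃[ w ] (Mem D w × Adj w v)

  Att? : ∀ D v → Dec (Att D v)
  Att? D v = anyᶠ? (λ w → mem? D w ×-dec Adj? w v)

  component : ∀ (C : FSet n) {v} → Mem C v → ∃[ D ] (Component C D × Mem D v)
  component C {v} v∈ = grow ∣ C ∣ (singleton v) (λ { refl → v∈ }) refl (λ { refl → stop refl }) (m≤m+n _ _)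
    where
    grow : ∀ k (D : FSet n) → (∀ {w} → Mem D w → Mem C w) → Mem D v → (∀ {w} → Mem D w → Walk (lift (Mem D)) (V v) (V w)) →
      ∣ C ∣ ≤ k + ∣ D ∣ → ∃[ D ] (Component C D × Mem D v)
    grow k D sub vD walks le with anyᶠ? (λ w → mem? C w ×-dec (¬? (mem? D w) ×-dec Att? D w))
    ... | no ¬p = D , record
          { inside = sub
          ; closed = λ {u} {w} m m' adj → decidable-stable (mem? D w) (λ ¬m → ¬p (w , m' , ¬m , u , m , adj))
          ; conn = λ { (V a) (V b) m m' → reverseʷ (walks m) ++ʷ walks m' } } , vD
    grow zero D sub vD walks le | yes (w , wC , w∉ , _) = contradiction le (<⇒≱ (size-< D C sub wC w∉))
    grow (suc k) D sub vD walks le | yes (w , wC , w∉ , u , uD , (x , t , h)) =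
      grow k D' (λ { (inj₁ m) → sub m ; (inj₂ refl) → wC }) (inj₁ vD)
        (λ { (inj₁ m) → up (walks m)
           ; (inj₂ refl) → up (walks uD) ++ʷ move′ (E x) (cong V t) (cong V h) (inj₁ uD) (stop (inj₂ refl)) })
        (≤-trans le (≤-trans (≤-reflexive (sym (+-suc k _))) (+-monoʳ-≤ k (size-< D D' inj₁ {w} (inj₂ refl) w∉))))
      where
      D' : FSet n
      D' = fset (λ v → Mem D v ⊎ v ≡ w) (λ v → mem? D v ⊎-dec (v ≟ᶠ w))
      up : ∀ {a b} → Walk (lift (Mem D)) a b → Walk (lift (Mem D')) a b
      up = widen (λ { {V _} → inj₁ ; {K _} → id })

  by-components : ∀ {N₁ N₂} (C : FSet n) → (∀ D → Component C D → Sol (Mem D) N₁ N₂) → Sol (Mem C) N₁ N₂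
  by-components {N₁} {N₂} C solve = go (suc ∣ C ∣) C ≤-refl id (λ _ m _ → m)
    where
    go : ∀ k (R : FSet n) → ∣ R ∣ < k → (∀ {v} → Mem R v → Mem C v) → (∀ {v w} → Mem R v → Mem C w → Adj v w → Mem R w) → Sol (Mem R) N₁ N₂
    go (suc k) R (s≤s le) sub closedR with anyᶠ? (mem? R)
    ... | no ¬p = empty-sol (λ v m → ¬p (v , m))
    ... | yes (v , v∈) = same-order (λ c _ a adj → contradiction adj (apart c a))
      where
      comp = component R v∈
      D = proj₁ comp
      DR = proj₁ (proj₂ comp)
      apart : ∀ {u v} → Mem (R ─ D) v → Mem D u → ¬ Adj v u
      apart (m , ¬d) d adj = ¬d (closed DR d m (Adj-sym adj))
      DC : Component C D
      DC = record { inside = λ m → sub (inside DR m) ; closed = λ m m' adj → closed DR m (closedR (inside DR m) m' adj) adj ; conn = conn DR }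
      open Join R D (R ─ D) (λ m ¬d → m , ¬d) (solve D DC)
        (go k (R ─ D) (≤-trans (size-< (R ─ D) R proj₁ v∈ (λ (_ , ¬d) → ¬d (proj₂ (proj₂ comp)))) le) (sub ∘ proj₁)
          (λ (m , ¬d) m' adj → closedR m m' adj , λ d → apart (m , ¬d) d adj))
        (λ _ m → m) (λ _ m → m) (λ c _ a adj → contradiction adj (apart c a)) (λ c _ a adj → contradiction adj (apart c a))

  -- A vertex coloured c in both rounds blocks one colour for each neighbour in the same set.
  greedy : ∀ (A : Fin n → List ℕ) us → Unique us → (∀ {u} → u ∈ us → Unique (A u)) →
    (∀ {u} → u ∈ us → length (filter (Adj? u) us) < length (A u)) →
    Σ (Fin n → ℕ) λ c → Σ (Fin n → ℕ) λ r → (∀ {u} → u ∈ us → c u ∈ A u) × (∀ {u v} → u ∈ us → v ∈ us → Adj u v → c u ≢ c v) ×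
      (∀ {u v} → u ∈ us → v ∈ us → Adj u v → (r u ≤ r v) → c u ≢ φ₀ v)
  greedy A [] _ _ _ = φ₀ , φ₀ , (λ ()) , (λ ()) , λ ()
  greedy A (u ∷ us) (u∉ ∷ uniq) uA enough = c , r , in-A , proper , order
    where
    nbrs = filter (Adj? u) us
    drop-self : filter (Adj? u) (u ∷ us) ≡ nbrs
    drop-self with Adj? u u
    ... | yes adj = contradiction refl (Adj-≢ adj)
    ... | no _ = refl
    choice = pick (uA (here refl)) (subst₂ _<_ (trans (cong length drop-self) (sym (length-map φ₀ nbrs))) refl (enough (here refl)))
    c₀ = proj₁ choice
    A' : Fin n → List ℕ
    A' v with Adj? v u
    ... | yes _ = A v ∖ (c₀ ∷ [])
    ... | no _ = A v
    A'-unique : ∀ {v} → v ∈ us → Unique (A' v)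
    A'-unique {v} m with Adj? v u
    ... | yes _ = ∖-unique (c₀ ∷ []) (uA (there m))
    ... | no _ = uA (there m)
    A'-enough : ∀ {v} → v ∈ us → length (filter (Adj? v) us) < length (A' v)
    A'-enough {v} m with Adj? v u | enough (there m)
    ... | yes _ | h = s≤s⁻¹ (≤-trans h (length-∖ (c₀ ∷ []) (uA (there m))))
    ... | no _ | h = h
    A'-sub : ∀ {v a} → a ∈ A' v → a ∈ A v
    A'-sub {v} m with Adj? v u
    ... | yes _ = proj₁ (∈-∖⁻ (c₀ ∷ []) m)
    ... | no _ = m
    A'-avoid : ∀ {v a} → a ∈ A' v → Adj v u → a ≢ c₀
    A'-avoid {v} m adj with Adj? v u
    ... | yes _ = λ { refl → proj₂ (∈-∖⁻ {A v} (c₀ ∷ []) m) (here refl) }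
    ... | no ¬adj = contradiction adj ¬adj
    rec = greedy A' us uniq A'-unique A'-enough
    c' = proj₁ rec
    r' = proj₁ (proj₂ rec)
    in' = proj₁ (proj₂ (proj₂ rec))
    proper' = proj₁ (proj₂ (proj₂ (proj₂ rec)))
    order' = proj₂ (proj₂ (proj₂ (proj₂ rec)))
    c = upd c' u c₀
    -- `u` moves before the others and so avoids the old colours of its neighbours. They move later
    -- and avoid only its new colour, which was taken from their lists.
    r = upd (suc ∘ r') u 0
    fresh : ∀ {v} → v ∈ us → v ≢ u
    fresh m e = All.lookup u∉ m (sym e)
    in-A : ∀ {v} → v ∈ u ∷ us → c v ∈ A v
    in-A (here refl) = subst (_∈ A u) (sym (upd-same c' u c₀)) (proj₁ (proj₂ choice))
    in-A {v} (there m) = subst (_∈ A v) (sym (upd-other c' c₀ (fresh m))) (A'-sub (in' m))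
    off-u : ∀ {v} → v ∈ us → Adj v u → c v ≢ c u
    off-u m adj e = A'-avoid (in' m) adj (trans (sym (upd-other c' c₀ (fresh m))) (trans e (upd-same c' u c₀)))
    proper : ∀ {v w} → v ∈ u ∷ us → w ∈ u ∷ us → Adj v w → c v ≢ c w
    proper (here refl) (here refl) adj = contradiction refl (Adj-≢ adj)
    proper (here refl) (there m) adj e = off-u m (Adj-sym adj) (sym e)
    proper (there m) (here refl) adj = off-u m adj
    proper (there m) (there m') adj e = proper' m m' adj (trans (sym (upd-other c' c₀ (fresh m))) (trans e (upd-other c' c₀ (fresh m'))))
    order : ∀ {v w} → v ∈ u ∷ us → w ∈ u ∷ us → Adj v w → r v ≤ r w → c v ≢ φ₀ w
    order (here refl) (here refl) adj = contradiction refl (Adj-≢ adj)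
    order {w = w} (here refl) (there m) adj _ e = proj₂ (proj₂ choice)
      (subst (_∈ map φ₀ nbrs) (trans (sym e) (upd-same c' u c₀)) (∈-map⁺ φ₀ (∈-filter⁺ (Adj? u) m adj)))
    order (there m) (here refl) adj le = contradiction
      (subst₂ _≤_ (upd-other (suc ∘ r') 0 (fresh m)) (upd-same (suc ∘ r') u 0) le) λ ()
    order (there m) (there m') adj le e = order' m m' adj
      (s≤s⁻¹ (subst₂ _≤_ (upd-other (suc ∘ r') 0 (fresh m)) (upd-other (suc ∘ r') 0 (fresh m')) le)) (trans (sym (upd-other c' c₀ (fresh m))) e)

-- Scenes

module Scenes {n : ℕ} (M : Map n) (genus0 : Map.Genus0 M) (φ₀ : Fin n → ℕ) where
  open Map M hiding (φ)
  open Minors M genus0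
  open Recolor M genus0 φ₀ public

  conn-⟦⟧ : ∀ {v} → Conn ⟦ v ⟧
  conn-⟦⟧ _ _ refl refl = stop refl

  adj-~ : ∀ {u v} → Adj u v → ⟦ u ⟧ ~ ⟦ v ⟧
  adj-~ (x , t , h) = link (E x) (cong V t) (cong V h)

  touch : ∀ {u v} → Adj u v → Touches u ⟦ v ⟧
  touch (x , t , h) = x , t , cong V h

  touch-lift : ∀ {D : Fin n → Set} {u w} → Adj u w → D w → Touches u (lift D)
  touch-lift {D} (x , t , h) m = x , t , subst D (sym h) m

  touch-⊆ : ∀ {A B u} → (∀ {ν} → A ν → B ν) → Touches u A → Touches u B
  touch-⊆ f (x , t , m) = x , t , f m

  ~-⊆ : ∀ {A A' B B'} → (∀ {ν} → A ν → A' ν) → (∀ {ν} → B ν → B' ν) → A ~ B → A' ~ B'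
  ~-⊆ f g (link s m m') = link s (f m) (g m')

  att-~ : ∀ {D v} → Att D v → lift (Mem D) ~ ⟦ v ⟧
  att-~ {D} (w , m , (x , t , h)) = link (E x) (subst (Mem D) (sym t) m) (cong V h)

  att-~ʳ : ∀ {D v} → Att D v → ⟦ v ⟧ ~ lift (Mem D)
  att-~ʳ {D} a = ~-sym (att-~ {D} a)

  lift-~B : ∀ {D : Fin n → Set} {B v} → D v → ⟦ v ⟧ ~ B → lift D ~ B
  lift-~B {D} m (link s e b) = link s (subst (lift D) (sym e) m) b

  ⟦⟧-disjoint : ∀ {v} {B : Node → Set} → ¬ B (V v) → Disjoint ⟦ v ⟧ B
  ⟦⟧-disjoint ¬b _ refl b = ¬b b

  lift-disjoint : ∀ {D : Fin n → Set} {B : Node → Set} → (∀ {v} → D v → ¬ B (V v)) → Disjoint (lift D) B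
  lift-disjoint h (V v) m b = h m b

  ⟦⟧-∌ : ∀ {u v} → u ≢ v → ¬ ⟦ v ⟧ (V u)
  ⟦⟧-∌ ne refl = ne refl

  kuratowski₃₃ : ∀ {x X c₂ c₃ B D} → Conn X → Conn B → Conn D → Touches x X → Adj x c₂ → Adj x c₃ →
    X ~ B → ⟦ c₂ ⟧ ~ B → ⟦ c₃ ⟧ ~ B → X ~ D → ⟦ c₂ ⟧ ~ D → ⟦ c₃ ⟧ ~ D →
    ¬ X (V x) → ¬ B (V x) → ¬ D (V x) → c₂ ≢ c₃ → ¬ X (V c₂) → ¬ X (V c₃) →
    Disjoint X B → ¬ B (V c₂) → ¬ B (V c₃) → Disjoint X D → ¬ D (V c₂) → ¬ D (V c₃) → Disjoint B D → ⊥
  kuratowski₃₃ cX cB cD xX x₂ x₃ XB b₂ b₃ XD d₂ d₃ x∉X x∉B x∉D ne ∉X₂ ∉X₃ XdB ∉B₂ ∉B₃ XdD ∉D₂ ∉D₃ BdD = no-K₃₃ record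
    { c₁ = cX ; c₂ = conn-⟦⟧ ; c₃ = conn-⟦⟧ ; cB = cB ; cD = cD ; x~₁ = xX ; x~₂ = touch x₂ ; x~₃ = touch x₃
    ; b~₁ = XB ; b~₂ = b₂ ; b~₃ = b₃ ; d~₁ = XD ; d~₂ = d₂ ; d~₃ = d₃
    ; x∉₁ = x∉X ; x∉₂ = ⟦⟧-∌ (Adj-≢ x₂) ; x∉₃ = ⟦⟧-∌ (Adj-≢ x₃) ; x∉B = x∉B ; x∉D = x∉D
    ; d₁₂ = flip-disjoint (⟦⟧-disjoint ∉X₂) ; d₁₃ = flip-disjoint (⟦⟧-disjoint ∉X₃) ; d₂₃ = ⟦⟧-disjoint (⟦⟧-∌ ne)
    ; d₁B = XdB ; d₂B = ⟦⟧-disjoint ∉B₂ ; d₃B = ⟦⟧-disjoint ∉B₃ ; d₁D = XdD ; d₂D = ⟦⟧-disjoint ∉D₂ ; d₃D = ⟦⟧-disjoint ∉D₃ ; dBD = BdD }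

  kuratowski-set : ∀ {x X c₂ c₃ B d'} → Conn X → Conn B → Touches x X → Adj x c₂ → Adj x c₃ →
    X ~ B → ⟦ c₂ ⟧ ~ B → ⟦ c₃ ⟧ ~ B → X ~ ⟦ d' ⟧ → Adj c₂ d' → Adj c₃ d' → x ≢ d' → c₂ ≢ c₃ →
    ¬ X (V x) → ¬ X (V d') → ¬ X (V c₂) → ¬ X (V c₃) → Disjoint X B → ¬ B (V x) → ¬ B (V d') → ¬ B (V c₂) → ¬ B (V c₃) → ⊥
  kuratowski-set cX cB xX x₂ x₃ XB b₂ b₃ Xd d₂ d₃ x≢d ne x∉X d∉X ∉₂ ∉₃ XdB ∉Bx ∉Bd ∉B₂ ∉B₃ =
    kuratowski₃₃ cX cB conn-⟦⟧ xX x₂ x₃ XB b₂ b₃ Xd (adj-~ d₂) (adj-~ d₃) x∉X ∉Bx (⟦⟧-∌ x≢d) ne ∉₂ ∉₃ XdB ∉B₂ ∉B₃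
      (flip-disjoint (⟦⟧-disjoint d∉X)) (⟦⟧-∌ (Adj-≢ d₂)) (⟦⟧-∌ (Adj-≢ d₃)) (flip-disjoint (⟦⟧-disjoint ∉Bd))

  kuratowski-vertices : ∀ {x c₁ c₂ c₃ B d'} → Conn B → Adj x c₁ → Adj x c₂ → Adj x c₃ →
    ⟦ c₁ ⟧ ~ B → ⟦ c₂ ⟧ ~ B → ⟦ c₃ ⟧ ~ B → Adj c₁ d' → Adj c₂ d' → Adj c₃ d' → x ≢ d' → c₁ ≢ c₂ → c₁ ≢ c₃ → c₂ ≢ c₃ →
    ¬ B (V x) → ¬ B (V d') → ¬ B (V c₁) → ¬ B (V c₂) → ¬ B (V c₃) → ⊥
  kuratowski-vertices cB x₁ x₂ x₃ b₁ b₂ b₃ d₁ d₂ d₃ x≢d n₁₂ n₁₃ n₂₃ ∉x ∉d ∉₁ ∉₂ ∉₃ =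
    kuratowski-set conn-⟦⟧ cB (touch x₁) x₂ x₃ b₁ b₂ b₃ (adj-~ d₁) d₂ d₃ x≢d n₂₃ (⟦⟧-∌ (Adj-≢ x₁)) (⟦⟧-∌ (≢-sym (Adj-≢ d₁)))
      (⟦⟧-∌ (≢-sym n₁₂)) (⟦⟧-∌ (≢-sym n₁₃)) (⟦⟧-disjoint ∉₁) ∉x ∉d ∉₂ ∉₃

  kuratowski-component : ∀ {x c₁ c₂ c₃ B} (D : FSet n) → Conn B → Conn (lift (Mem D)) → Adj x c₁ → Adj x c₂ → Adj x c₃ →
    ⟦ c₁ ⟧ ~ B → ⟦ c₂ ⟧ ~ B → ⟦ c₃ ⟧ ~ B → Att D c₁ → Att D c₂ → Att D c₃ → c₁ ≢ c₂ → c₁ ≢ c₃ → c₂ ≢ c₃ →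
    ¬ B (V x) → ¬ B (V c₁) → ¬ B (V c₂) → ¬ B (V c₃) → ¬ Mem D x → ¬ Mem D c₁ → ¬ Mem D c₂ → ¬ Mem D c₃ → (∀ {v} → Mem D v → ¬ B (V v)) → ⊥
  kuratowski-component D cB cD x₁ x₂ x₃ b₁ b₂ b₃ d₁ d₂ d₃ n₁₂ n₁₃ n₂₃ ∉x ∉₁ ∉₂ ∉₃ ∉Dx ∉D₁ ∉D₂ ∉D₃ DdB =
    kuratowski₃₃ conn-⟦⟧ cB cD (touch x₁) x₂ x₃ b₁ b₂ b₃ (att-~ʳ {D} d₁) (att-~ʳ {D} d₂) (att-~ʳ {D} d₃) (⟦⟧-∌ (Adj-≢ x₁)) ∉x ∉Dx n₂₃ (⟦⟧-∌ (≢-sym n₁₂)) (⟦⟧-∌ (≢-sym n₁₃))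
      (⟦⟧-disjoint ∉₁) ∉₂ ∉₃ (⟦⟧-disjoint ∉D₁) ∉D₂ ∉D₃ (flip-disjoint (lift-disjoint DdB))

  kuratowski₅ : ∀ {x X c₂ c₃ B} → Conn X → Conn B → Touches x X → Adj x c₂ → Adj x c₃ → ⟦ x ⟧ ~ B → X ~ B → ⟦ c₂ ⟧ ~ B → ⟦ c₃ ⟧ ~ B →
    X ~ ⟦ c₂ ⟧ → X ~ ⟦ c₃ ⟧ → Adj c₂ c₃ → ¬ X (V x) → ¬ X (V c₂) → ¬ X (V c₃) → Disjoint X B → ¬ B (V x) → ¬ B (V c₂) → ¬ B (V c₃) → ⊥
  kuratowski₅ cX cB xX x₂ x₃ xB XB b₂ b₃ X₂ X₃ a₂₃ x∉X ∉X₂ ∉X₃ XdB ∉x ∉₂ ∉₃ = no-K₅ record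
    { c₁ = cX ; c₂ = conn-⟦⟧ ; c₃ = conn-⟦⟧ ; cB = cB ; x~₁ = xX ; x~₂ = touch x₂ ; x~₃ = touch x₃ ; x~B = xB
    ; b~₁ = XB ; b~₂ = b₂ ; b~₃ = b₃ ; a₁₂ = X₂ ; a₁₃ = X₃ ; a₂₃ = adj-~ a₂₃
    ; x∉₁ = x∉X ; x∉₂ = ⟦⟧-∌ (Adj-≢ x₂) ; x∉₃ = ⟦⟧-∌ (Adj-≢ x₃) ; x∉B = ∉x
    ; d₁₂ = flip-disjoint (⟦⟧-disjoint ∉X₂) ; d₁₃ = flip-disjoint (⟦⟧-disjoint ∉X₃) ; d₂₃ = ⟦⟧-disjoint (⟦⟧-∌ (Adj-≢ a₂₃))
    ; d₁B = XdB ; d₂B = ⟦⟧-disjoint ∉₂ ; d₃B = ⟦⟧-disjoint ∉₃ }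

  record OK (l₁ l₂ : List ℕ) : Set where
    field
      unique₁ : Unique l₁
      unique₂ : Unique l₂
      nearly⊆ : ∀ {a b} → a ∈ l₁ → a ∉ l₂ → b ∈ l₁ → b ∉ l₂ → a ≡ b
      six     : 6 ≤ length l₁
      seven   : 7 ≤ length l₂
  open OK public

  Lists : Set
  Lists = Fin n → List ℕ

  Strong : Lists → Lists → Fin n → Set
  Strong L₁ L₂ v = 10 ≤ length (L₁ v) × 9 ≤ length (L₂ v)

  Strong? : ∀ L₁ L₂ v → Dec (Strong L₁ L₂ v)
  Strong? L₁ L₂ v = (10 ≤? length (L₁ v)) ×-dec (9 ≤? length (L₂ v))

  -- Weak vertices play the role of the vertices on the outer face; the blob B stands for the outside.
  Weak : Lists → Lists → Fin n → Set
  Weak L₁ L₂ v = ¬ Strong L₁ L₂ v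

  HasWeak : FSet n → Lists → Lists → Set
  HasWeak W L₁ L₂ = ∃[ v ] (Mem W v × Weak L₁ L₂ v)

  record Base (W : FSet n) (L₁ L₂ : Lists) (B : Node → Set) : Set where
    field
      ok : ∀ {v} → Mem W v → OK (L₁ v) (L₂ v)
      weak-B : ∀ {v} → Mem W v → Weak L₁ L₂ v → ⟦ v ⟧ ~ B
      conn-B : Conn B
      W∉B : ∀ {v} → Mem W v → ¬ B (V v)
  open Base public

  base-⊆ : ∀ {W W' L₁ L₂ B} → (∀ {v} → Mem W' v → Mem W v) → Base W L₁ L₂ B → Base W' L₁ L₂ B
  base-⊆ sub b = record { ok = ok b ∘ sub ; weak-B = weak-B b ∘ sub ; conn-B = conn-B b ; W∉B = W∉B b ∘ sub }

  Out : FSet n → (Node → Set) → Fin n → Set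
  Out W B p = ¬ Mem W p × ¬ B (V p)

  Avoids : (Fin n → ℕ) → (Fin n → ℕ) → List (Fin n) → ℕ → Set
  Avoids f g hs a = ∀ {p} → p ∈ hs → a ≢ f p × a ≢ g p

  -- Only three coloured neighbours can exhaust a list of six, each blocking its old and its new
  -- colour.
  Gc : FSet n → Lists → (Fin n → ℕ) → List (Fin n) → Set
  Gc W L₁ δ₁ hs = ∀ {v} → Mem W v → (∀ {p} → p ∈ hs → Adj v p) → ∃[ a ] (a ∈ L₁ v × Avoids φ₀ δ₁ hs a)

  -- A coloured path whose ends reach the blob, except that in `two` one end suffices. This is asked
  -- only in the presence of weak vertices: without them `Absorb` puts a coloured vertex in place of
  -- the blob.
  data Head (W : FSet n) (L₁ L₂ : Lists) (B : Node → Set) (δ₁ : Fin n → ℕ) : List (Fin n) → Set where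
    none  : Head W L₁ L₂ B δ₁ []
    one   : ∀ {p} → Out W B p → Head W L₁ L₂ B δ₁ (p ∷ [])
    two   : ∀ {p q} → Out W B p → Out W B q → Adj p q → (HasWeak W L₁ L₂ → ⟦ p ⟧ ~ B) → Head W L₁ L₂ B δ₁ (p ∷ q ∷ [])
    three : ∀ {p q r} → Out W B p → Out W B q → Out W B r → Adj p q → Adj q r → p ≢ r →
            (HasWeak W L₁ L₂ → ⟦ p ⟧ ~ B) → (HasWeak W L₁ L₂ → ⟦ r ⟧ ~ B) → Gc W L₁ δ₁ (p ∷ q ∷ r ∷ []) → Head W L₁ L₂ B δ₁ (p ∷ q ∷ r ∷ [])

  head-length : ∀ {W L₁ L₂ B δ₁ hs} → Head W L₁ L₂ B δ₁ hs → length hs ≤ 3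
  head-length none = z≤n
  head-length (one _) = s≤s z≤n
  head-length (two _ _ _ _) = s≤s (s≤s z≤n)
  head-length (three _ _ _ _ _ _ _ _ _) = s≤s (s≤s (s≤s z≤n))

  head-out : ∀ {W L₁ L₂ B δ₁ hs} → Head W L₁ L₂ B δ₁ hs → ∀ {p} → p ∈ hs → Out W B p
  head-out (one o) (here refl) = o
  head-out (two o _ _ _) (here refl) = o
  head-out (two _ o _ _) (there (here refl)) = o
  head-out (three o _ _ _ _ _ _ _ _) (here refl) = o
  head-out (three _ o _ _ _ _ _ _ _) (there (here refl)) = o
  head-out (three _ _ o _ _ _ _ _ _) (there (there (here refl))) = o

  head-map : ∀ {W L₁ L₂ B δ₁ hs W' L₁' L₂' B' δ₁'} → (∀ {p} → p ∈ hs → Out W' B' p) → (HasWeak W' L₁' L₂' → HasWeak W L₁ L₂) → (∀ {p} → ⟦ p ⟧ ~ B → ⟦ p ⟧ ~ B') →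
    (Gc W L₁ δ₁ hs → Gc W' L₁' δ₁' hs) → Head W L₁ L₂ B δ₁ hs → Head W' L₁' L₂' B' δ₁' hs
  head-map o w b g none = none
  head-map o w b g (one _) = one (o (here refl))
  head-map o w b g (two _ _ pq pB) = two (o (here refl)) (o (there (here refl))) pq (b ∘ pB ∘ w)
  head-map o w b g (three _ _ _ pq qr ne pB rB gc) = three (o (here refl)) (o (there (here refl))) (o (there (there (here refl)))) pq qr ne (b ∘ pB ∘ w) (b ∘ rB ∘ w) (g gc)

  -- The coloured vertices move last in each round, so a neighbour has to avoid both their colour
  -- before the round and their colour after it.
  M₁ : Lists → List (Fin n) → (Fin n → ℕ) → Fin n → ℕ → Set
  M₁ L₁ hs δ₁ v a = a ∈ L₁ v × (∀ {p} → p ∈ hs → Adj v p → a ≢ φ₀ p × a ≢ δ₁ p)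

  M₂ : Lists → List (Fin n) → (Fin n → ℕ) → (Fin n → ℕ) → Fin n → ℕ → Set
  M₂ L₂ hs δ₁ δ₂ v a = a ∈ L₂ v × (∀ {p} → p ∈ hs → Adj v p → a ≢ δ₁ p × a ≢ δ₂ p)

  Solvable : FSet n → Lists → Lists → List (Fin n) → (Fin n → ℕ) → (Fin n → ℕ) → Set
  Solvable W L₁ L₂ hs δ₁ δ₂ = Sol (Mem W) (M₁ L₁ hs δ₁) (M₂ L₂ hs δ₁ δ₂)

  flatten : (Fin n → List ℕ) → List (Fin n) → List ℕ
  flatten f [] = []
  flatten f (p ∷ hs) = f p ++ flatten f hs

  flatten-∈ : ∀ f {hs p a} → p ∈ hs → a ∈ f p → a ∈ flatten f hs
  flatten-∈ f (here refl) m = ∈-++⁺ˡ m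
  flatten-∈ f {p ∷ _} (there m) m' = ∈-++⁺ʳ (f p) (flatten-∈ f m m')

  flatten-∈⁻ : ∀ f hs {a} → a ∈ flatten f hs → ∃[ p ] (p ∈ hs × a ∈ f p)
  flatten-∈⁻ f (p ∷ hs) m with ∈-++⁻ (f p) m
  ... | inj₁ m' = p , here refl , m'
  ... | inj₂ m' = let q , q∈ , h = flatten-∈⁻ f hs m' in q , there q∈ , h

  flatten-length : ∀ f k hs → (∀ p → length (f p) ≤ k) → length (flatten f hs) ≤ length hs * k
  flatten-length f k [] h = z≤n
  flatten-length f k (p ∷ hs) h = ≤-trans (≤-reflexive (length-++ (f p))) (+-mono-≤ (h p) (flatten-length f k hs h))

  pair : (Fin n → ℕ) → (Fin n → ℕ) → Fin n → List ℕ
  pair f g p = f p ∷ g p ∷ []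

  only-adj : Fin n → (Fin n → List ℕ) → Fin n → List ℕ
  only-adj u f p with Adj? u p
  ... | yes _ = f p
  ... | no _ = []

  only-adj-≤ : ∀ u f k → (∀ p → length (f p) ≤ k) → ∀ p → length (only-adj u f p) ≤ k
  only-adj-≤ u f k h p with Adj? u p
  ... | yes _ = h p
  ... | no _ = z≤n

  only-adj-∈ : ∀ {u f p a} → Adj u p → a ∈ f p → a ∈ only-adj u f p
  only-adj-∈ {u} {p = p} adj m with Adj? u p
  ... | yes _ = m
  ... | no ¬adj = contradiction adj ¬adj

  only-adj-no : ∀ {u f p} → ¬ Adj u p → length (only-adj u f p) ≤ 0
  only-adj-no {u} {p = p} ¬adj with Adj? u p
  ... | yes adj = contradiction adj ¬adj
  ... | no _ = z≤n

  blocked : (Fin n → ℕ) → (Fin n → ℕ) → List (Fin n) → Fin n → List ℕ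
  blocked f g hs u = flatten (only-adj u (pair f g)) hs

  blocked-length : ∀ f g hs u → length (blocked f g hs u) ≤ length hs * 2
  blocked-length f g hs u = flatten-length _ 2 hs (only-adj-≤ u (pair f g) 2 (λ _ → ≤-refl))

  blocked-avoid : ∀ {f g hs u a} → a ∉ blocked f g hs u → ∀ {p} → p ∈ hs → Adj u p → a ≢ f p × a ≢ g p
  blocked-avoid {f} {g} {hs} {u} ∉ p∈ adj =
    (λ e → ∉ (flatten-∈ _ p∈ (only-adj-∈ {f = pair f g} adj (here e)))) , (λ e → ∉ (flatten-∈ _ p∈ (only-adj-∈ {f = pair f g} adj (there (here e)))))

  big-gc : ∀ {L : List ℕ} {f g : Fin n → ℕ} hs → Unique L → length hs * 2 < length L → ∃[ a ] (a ∈ L × Avoids f g hs a)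
  big-gc {L} {f} {g} hs u lt = let a , m , ∉ = pick u (≤-trans (s≤s (flatten-length (pair f g) 2 hs (λ _ → ≤-refl))) lt) in
    a , m , λ p∈ → (λ e → ∉ (flatten-∈ _ p∈ (here e))) , (λ e → ∉ (flatten-∈ _ p∈ (there (here e))))

  module _ {l₁ l₂ : List ℕ} (o : OK l₁ l₂) {k₁ k₂} (x₁ x₂ : List ℕ) (sub : ∀ {a} → a ∈ x₂ → a ∈ x₁) (lx₁ : length x₁ ≤ k₁) (lx₂ : length x₂ ≤ k₂)
      (l₁≥ : k₁ + 6 ≤ length l₁) (l₂≥ : k₂ + 7 ≤ length l₂) where
    -- Every colour of `x₂` is in `x₁`, so a colour that survives in the first list and is missing
    -- from the second was missing from `l₂` already.
    remove-ok : OK (l₁ ∖ x₁) (l₂ ∖ x₂)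
    remove-ok = record
      { unique₁ = ∖-unique x₁ (unique₁ o) ; unique₂ = ∖-unique x₂ (unique₂ o)
      ; nearly⊆ = λ a∈ a∉ b∈ b∉ → nearly⊆ o (proj₁ (∈-∖⁻ x₁ a∈)) (down a∈ a∉) (proj₁ (∈-∖⁻ x₁ b∈)) (down b∈ b∉)
      ; six = +-cancelˡ-≤ k₁ _ _ (≤-trans l₁≥ (≤-trans (length-∖ x₁ (unique₁ o)) (+-monoˡ-≤ _ lx₁)))
      ; seven = +-cancelˡ-≤ k₂ _ _ (≤-trans l₂≥ (≤-trans (length-∖ x₂ (unique₂ o)) (+-monoˡ-≤ _ lx₂))) }
      where
      down : ∀ {a} → a ∈ l₁ ∖ x₁ → a ∉ l₂ ∖ x₂ → a ∉ l₂
      down a∈ a∉ m = a∉ (∈-∖⁺ x₂ m (λ h → proj₂ (∈-∖⁻ {l₁} x₁ a∈) (sub h)))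

  -- A coloured vertex `q` is traded for shorter lists of its neighbours. The first round only asks
  -- to avoid `φ₀ q` and `δ₁ q`; the colour `δ₂ q` goes too, so that `remove-ok` applies. At least
  -- seven colours remain in each list, and only neighbours of `q` become weak, so `q` alone can be
  -- the blob.
  module Absorb (D : FSet n) (L₁ L₂ : Lists) (q : Fin n) (δ₁ δ₂ : Fin n → ℕ)
      (okD : ∀ {v} → Mem D v → OK (L₁ v) (L₂ v)) (strongD : ∀ {v} → Mem D v → Strong L₁ L₂ v) (q∉D : ¬ Mem D q) where
    gone₁ gone₂ : List ℕ
    gone₁ = φ₀ q ∷ δ₁ q ∷ δ₂ q ∷ []
    gone₂ = δ₁ q ∷ δ₂ q ∷ []

    L₁' L₂' : Lists
    L₁' v with Adj? v q
    ... | yes _ = L₁ v ∖ gone₁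
    ... | no _ = L₁ v
    L₂' v with Adj? v q
    ... | yes _ = L₂ v ∖ gone₂
    ... | no _ = L₂ v

    weak-adj : ∀ {v} → Mem D v → Weak L₁' L₂' v → Adj v q
    weak-adj {v} m w with Adj? v q
    ... | yes adj = adj
    ... | no _ = contradiction (strongD m) w

    ok' : ∀ {v} → Mem D v → OK (L₁' v) (L₂' v)
    ok' {v} m with Adj? v q
    ... | yes _ = remove-ok (okD m) {3} {2} gone₁ gone₂ there ≤-refl ≤-refl (≤-trans (n≤1+n 9) (proj₁ (strongD m))) (proj₂ (strongD m))
    ... | no _ = okD m

    long : ∀ {v} → Mem D v → 7 ≤ length (L₁' v)
    long {v} m with Adj? v q
    ... | yes _ = +-cancelˡ-≤ 3 _ _ (≤-trans (proj₁ (strongD m)) (length-∖ gone₁ (unique₁ (okD m))))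
    ... | no _ = ≤-trans (m≤m+n 7 3) (proj₁ (strongD m))

    base' : Base D L₁' L₂' ⟦ q ⟧
    base' = record { ok = ok' ; weak-B = λ m w → adj-~ (weak-adj m w) ; conn-B = conn-⟦⟧ ; W∉B = λ { m refl → q∉D m } }

    gc' : ∀ {hs} → length hs ≤ 3 → Gc D L₁' δ₁ hs
    gc' {hs} le m _ = big-gc hs (unique₁ (ok' m)) (≤-trans (s≤s (≤-trans (≤-reflexive (*-comm (length hs) 2)) (*-monoʳ-≤ 2 le))) (long m))

    absorb : ∀ {hs} → Solvable D L₁' L₂' hs δ₁ δ₂ → Solvable D L₁ L₂ (q ∷ hs) δ₁ δ₂
    absorb {hs} = weaken id f g
      where
      f : ∀ {v a} → Mem D v → M₁ L₁' hs δ₁ v a → M₁ L₁ (q ∷ hs) δ₁ v a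
      f {v} m (a∈ , av) with Adj? v q
      ... | yes _ = proj₁ (∈-∖⁻ gone₁ a∈) , λ
            { (here refl) adj → (λ e → proj₂ (∈-∖⁻ {L₁ v} gone₁ a∈) (here e)) , λ e → proj₂ (∈-∖⁻ {L₁ v} gone₁ a∈) (there (here e))
            ; (there p) adj → av p adj }
      ... | no ¬adj = a∈ , λ { (here refl) adj → contradiction adj ¬adj ; (there p) adj → av p adj }
      g : ∀ {v a} → Mem D v → M₂ L₂' hs δ₁ δ₂ v a → M₂ L₂ (q ∷ hs) δ₁ δ₂ v a
      g {v} m (a∈ , av) with Adj? v q
      ... | yes _ = proj₁ (∈-∖⁻ gone₂ a∈) , λ
            { (here refl) adj → (λ e → proj₂ (∈-∖⁻ {L₂ v} gone₂ a∈) (here e)) , λ e → proj₂ (∈-∖⁻ {L₂ v} gone₂ a∈) (there (here e))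
            ; (there p) adj → av p adj }
      ... | no ¬adj = a∈ , λ { (here refl) adj → contradiction adj ¬adj ; (there p) adj → av p adj }

-- Colouring one vertex

module Cases {n : ℕ} (M : Map n) (genus0 : Map.Genus0 M) (φ₀ : Fin n → ℕ) where
  open Map M hiding (φ)
  open Minors M genus0
  open Scenes M genus0 φ₀ public
  open Component public

  -- The factor 4 lets one vertex of `W` pay for three new coloured vertices; the summand
  -- `length hs` pays for an absorption.
  Induction : ℕ → Set₁
  Induction m = ∀ W L₁ L₂ B hs δ₁ δ₂ → Base W L₁ L₂ B → Head W L₁ L₂ B δ₁ hs → 4 * ∣ W ∣ + length hs < m → Solvable W L₁ L₂ hs δ₁ δ₂

  module Solve (W : FSet n) (L₁ L₂ : Lists) (B : Node → Set) (hs : List (Fin n)) (δ₁ δ₂ : Fin n → ℕ)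
      (base : Base W L₁ L₂ B) (head : Head W L₁ L₂ B δ₁ hs) (IH : Induction (4 * ∣ W ∣ + length hs)) where

    smaller : ∀ {D L₁' L₂' B' hs' δ₁' δ₂'} → ∣ D ∣ < ∣ W ∣ → Base D L₁' L₂' B' → Head D L₁' L₂' B' δ₁' hs' → Solvable D L₁' L₂' hs' δ₁' δ₂'
    smaller {D} {hs' = hs'} lt b h = IH _ _ _ _ _ _ _ b h (≤-trans (s≤s (+-monoʳ-≤ (4 * ∣ D ∣) (head-length h)))
      (≤-trans (≤-reflexive (trans (sym (+-suc (4 * ∣ D ∣) 3)) (trans (+-comm _ 4) (sym (*-suc 4 ∣ D ∣)))))
        (≤-trans (*-monoʳ-≤ 4 lt) (m≤m+n _ (length hs)))))

    weak? : ∀ v → Dec (Weak L₁ L₂ v)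
    weak? v = ¬? (Strong? L₁ L₂ v)

    strong : ∀ {v} → ¬ Weak L₁ L₂ v → Strong L₁ L₂ v
    strong {v} h with Strong? L₁ L₂ v
    ... | yes s = s
    ... | no w = contradiction w h

    hs∉W : ∀ {p} → p ∈ hs → ¬ Mem W p
    hs∉W p∈ = proj₁ (head-out head p∈)

    W≢ : ∀ {v p} → Mem W v → ¬ Mem W p → v ≢ p
    W≢ m ¬m refl = ¬m m

    blocked-6 : ∀ f g u → length (blocked f g hs u) ≤ 6
    blocked-6 f g u = ≤-trans (blocked-length f g hs u) (*-mono-≤ (head-length head) ≤-refl)

    hasWeak? : ∀ D → Dec (HasWeak D L₁ L₂)
    hasWeak? D = anyᶠ? (λ v → mem? D v ×-dec weak? v)

    strong-gc : ∀ D {δ hs'} → (∀ {v} → Mem D v → Mem W v) → ¬ HasWeak D L₁ L₂ → length hs' ≤ 3 → Gc D L₁ δ hs'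
    strong-gc D {hs' = hs'} sub noweak le m _ = big-gc hs' (unique₁ (ok base (sub m)))
      (≤-trans (s≤s (*-mono-≤ le ≤-refl)) (≤-trans (m≤m+n 7 3) (proj₁ (strong (λ w → noweak (_ , m , w))))))

    -- `u` joins the coloured vertices, and the rest of `W` moves before it in both rounds. A second
    -- colour is always available: at most six of at least seven are blocked.
    module Color {u} (u∈W : Mem W u) {a} (a∈ : a ∈ L₁ u) (a∉ : a ∉ blocked φ₀ δ₁ hs u) where
      R : FSet n
      R = without W u

      private
        second = pick {ys = blocked δ₁ δ₂ hs u} (unique₂ (ok base u∈W)) (≤-trans (s≤s (blocked-6 δ₁ δ₂ u)) (seven (ok base u∈W)))
        b = proj₁ second

      δ₁' δ₂' : Fin n → ℕ
      δ₁' = upd δ₁ u a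
      δ₂' = upd δ₂ u b

      hs≢u : ∀ {p} → p ∈ hs → p ≢ u
      hs≢u p∈ refl = hs∉W p∈ u∈W

      δ₁-old : ∀ {p} → p ∈ hs → δ₁' p ≡ δ₁ p
      δ₁-old p∈ = upd-other δ₁ a (hs≢u p∈)

      δ₂-old : ∀ {p} → p ∈ hs → δ₂' p ≡ δ₂ p
      δ₂-old p∈ = upd-other δ₂ b (hs≢u p∈)

      colored : Solvable R L₁ L₂ (u ∷ hs) δ₁' δ₂' → Solvable W L₁ L₂ hs δ₁ δ₂
      colored sol = Join.same-order W (singleton u) R (λ m ne → m , ne)
        (single-sol u (a∈ , blocked-avoid {hs = hs} a∉) (proj₁ (proj₂ second) , blocked-avoid {hs = hs} (proj₂ (proj₂ second)))) sol
        (λ _ (m , av) → m , λ p∈ adj → let x , y = av (there p∈) adj in x , λ e → y (trans e (sym (δ₁-old p∈))))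
        (λ _ (m , av) → m , λ p∈ adj → let x , y = av (there p∈) adj in
          (λ e → x (trans e (sym (δ₁-old p∈)))) , λ e → y (trans e (sym (δ₂-old p∈))))
        (λ { _ (m , av) refl adj → let x , y = av (here refl) adj in x , λ e → y (trans e (sym (upd-same δ₁ u a))) })
        (λ { _ (m , av) refl adj e → proj₂ (av (here refl) adj) (trans e (sym (upd-same δ₂ u b))) })
        (λ { _ (m , av) refl adj e → proj₁ (av (here refl) adj) (trans e (sym (upd-same δ₁ u a))) })

      Part : FSet n → Set
      Part D = Solvable D L₁ L₂ (u ∷ hs) δ₁' δ₂'

      module _ (D : FSet n) (sub : ∀ {v} → Mem D v → Mem R v) where
        inW : ∀ {v} → Mem D v → Mem W v
        inW m = proj₁ (sub m)

        out-u : Out D B u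
        out-u = (λ m → proj₂ (sub m) refl) , W∉B base u∈W

        out-hs : ∀ {p} → p ∈ hs → Out D B p
        out-hs p∈ = (λ m → hs∉W p∈ (inW m)) , proj₂ (head-out head p∈)

        D<W : ∣ D ∣ < ∣ W ∣
        D<W = size-< D W inW u∈W (proj₁ out-u)

        up-weak : HasWeak D L₁ L₂ → HasWeak W L₁ L₂
        up-weak (v , m , w) = v , inW m , w

        -- Coloured vertices without a neighbour in `D` impose nothing, so only the others have to
        -- form an admissible path.
        finish : ∀ {hs'} → Head D L₁ L₂ B δ₁' hs' → (∀ {v p} → Mem D v → p ∈ u ∷ hs → Adj v p → p ∈ hs') → Part D
        finish h att = weaken id (λ m (a∈ , av) → a∈ , λ p∈ adj → av (att m p∈ adj) adj) (λ m (a∈ , av) → a∈ , λ p∈ adj → av (att m p∈ adj) adj)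
          (smaller D<W (base-⊆ inW base) h)

        unattached : ¬ Att D u → Part D
        unattached ¬att = finish (head-map out-hs up-weak id
            (λ gc m adjs → let c , c∈ , av = gc (inW m) adjs in c , c∈ , λ p∈ → proj₁ (av p∈) , λ e → proj₂ (av p∈) (trans e (δ₁-old p∈))) head)
          λ { m (here refl) adj → contradiction (_ , m , adj) ¬att ; m (there p∈) _ → p∈ }

    -- A colour of `u` is bad if it would violate `Gc` for the border p, q, u: some common neighbour
    -- has its whole list among the six used colours.
    module BadColor (u p q : Fin n) where
      used : ℕ → List ℕ
      used a = φ₀ p ∷ δ₁ p ∷ φ₀ q ∷ δ₁ q ∷ φ₀ u ∷ a ∷ []

      Bad : ℕ → Set
      Bad a = ∃[ w ] (Mem W w × Adj w p × Adj w q × Adj w u × All (_∈ used a) (L₁ w))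

      bad? : ∀ a → Dec (Bad a)
      bad? a = anyᶠ? (λ w → mem? W w ×-dec (Adj? w p ×-dec (Adj? w q ×-dec (Adj? w u ×-dec All.all? (λ c → member? ℕ._≟_ c (used a)) (L₁ w)))))

      bad-weak : ∀ {a} (x : Bad a) → Weak L₁ L₂ (proj₁ x)
      bad-weak (w , m , _ , _ , _ , h) (ten , _) = contradiction (≤-trans (m≤m+n 7 3) ten)
        (<⇒≱ (s≤s (unique-⊆-length (unique₁ (ok base m)) (All.lookup h))))

      -- A common witness for two colours would have all its six colours among the five that do not
      -- depend on the colour of `u`.
      bad-distinct : ∀ {a a'} (x : Bad a) (y : Bad a') → a ≢ a' → proj₁ x ≢ proj₁ y
      bad-distinct {a} {a'} (w , m , _ , _ , _ , h) (_ , _ , _ , _ , _ , h') ne refl =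
        contradiction (unique-⊆-length {ys = φ₀ p ∷ δ₁ p ∷ φ₀ q ∷ δ₁ q ∷ φ₀ u ∷ []} (unique₁ (ok base m))
          (λ z → both (All.lookup h z) (All.lookup h' z))) (<⇒≱ (six (ok base m)))
        where
        both : ∀ {z} → z ∈ used a → z ∈ used a' → z ∈ φ₀ p ∷ δ₁ p ∷ φ₀ q ∷ δ₁ q ∷ φ₀ u ∷ []
        both (here e) _ = here e
        both (there (here e)) _ = there (here e)
        both (there (there (here e))) _ = there (there (here e))
        both (there (there (there (here e)))) _ = there (there (there (here e)))
        both (there (there (there (there (here e))))) _ = there (there (there (there (here e))))
        both _ (here e) = here e
        both _ (there (here e)) = there (here e)
        both _ (there (there (here e))) = there (there (here e))
        both _ (there (there (there (here e)))) = there (there (there (here e)))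
        both _ (there (there (there (there (here e))))) = there (there (there (there (here e))))
        both (there (there (there (there (there (here e)))))) (there (there (there (there (there (here e')))))) = contradiction (trans (sym e) e') ne

      not-bad : ∀ {a} → ¬ Bad a → p ≢ u → q ≢ u → ∀ {w} → Mem W w → Adj w p → Adj w q → Adj w u →
        ∃[ c ] (c ∈ L₁ w × (∀ {x} → x ≡ p ⊎ x ≡ q ⊎ x ≡ u → c ≢ φ₀ x × c ≢ upd δ₁ u a x))
      not-bad {a} ¬bad p≢u q≢u {w} m wp wq wu with All.all? (λ c → member? ℕ._≟_ c (used a)) (L₁ w)
      ... | yes h = contradiction (w , m , wp , wq , wu , h) ¬bad
      ... | no ¬h = let c , c∈ , c∉ = find (¬All⇒Any¬ (λ c → member? ℕ._≟_ c (used a)) (L₁ w) ¬h) in c , c∈ , λ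
            { (inj₁ refl) → (λ e → c∉ (here e)) , λ e → c∉ (there (here (trans e (upd-other δ₁ a p≢u))))
            ; (inj₂ (inj₁ refl)) → (λ e → c∉ (there (there (here e)))) , λ e → c∉ (there (there (there (here (trans e (upd-other δ₁ a q≢u))))))
            ; (inj₂ (inj₂ refl)) → (λ e → c∉ (there (there (there (there (here e)))))) ,
                λ e → c∉ (there (there (there (there (there (here (trans e (upd-same δ₁ u a)))))))) }

    candidates : ∀ {u} (u∈W : Mem W u) → ∃[ cs ] (Unique cs × (∀ {a} → a ∈ cs → a ∈ L₁ u × a ∉ blocked φ₀ δ₁ hs u) ×
      length (L₁ u) ≤ length (blocked φ₀ δ₁ hs u) + length cs)
    candidates {u} u∈W = L₁ u ∖ blocked φ₀ δ₁ hs u , ∖-unique (blocked φ₀ δ₁ hs u) (unique₁ (ok base u∈W)) ,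
      ∈-∖⁻ (blocked φ₀ δ₁ hs u) , length-∖ (blocked φ₀ δ₁ hs u) (unique₁ (ok base u∈W))

    candidates-≥ : ∀ {u} (u∈W : Mem W u) j k → length (blocked φ₀ δ₁ hs u) ≤ j → j + k ≤ length (L₁ u) → k ≤ length (proj₁ (candidates u∈W))
    candidates-≥ u∈W j k le le' = +-cancelˡ-≤ j _ _ (≤-trans le' (≤-trans (proj₂ (proj₂ (proj₂ (candidates u∈W)))) (+-monoˡ-≤ _ le)))

  blocked-≤ : ∀ f g {p hs u} j k → length (only-adj u (pair f g) p) ≤ j → length (blocked f g hs u) ≤ k → length (blocked f g (p ∷ hs) u) ≤ j + k
  blocked-≤ f g {p} {hs} {u} j k h h' = ≤-trans (≤-reflexive (length-++ (only-adj u (pair f g) p))) (+-mono-≤ h h')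

  adj-≤2 : ∀ f g u p → length (only-adj u (pair f g) p) ≤ 2
  adj-≤2 f g u p = only-adj-≤ u (pair f g) 2 (λ _ → ≤-refl) p

  module _ (W : FSet n) (L₁ L₂ : Lists) (B : Node → Set) (δ₁ δ₂ : Fin n → ℕ) (base : Base W L₁ L₂ B) where

    solve-none : Induction (4 * ∣ W ∣ + 0) → ∀ {u} → Mem W u → Solvable W L₁ L₂ [] δ₁ δ₂
    solve-none IH {u} u∈W = colored (finish R id (one (out-u R id)) λ { m (here refl) _ → here refl })
      where
      open Solve W L₁ L₂ B [] δ₁ δ₂ base none IH
      a = one-member (≤-trans (s≤s z≤n) (six (ok base u∈W)))
      open Color u∈W (proj₂ a) (λ ())

    solve-one : ∀ {p} (out : Out W B p) → Induction (4 * ∣ W ∣ + 1) → ∀ {u} → Mem W u → Weak L₁ L₂ u → Adj u p → Solvable W L₁ L₂ (p ∷ []) δ₁ δ₂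
    solve-one {p} out IH {u} u∈W weak up = colored (finish R id (two (out-u R id) (out-hs R id (here refl)) up (λ _ → weak-B base u∈W weak)) λ _ p∈ _ → p∈)
      where
      open Solve W L₁ L₂ B (p ∷ []) δ₁ δ₂ base (one out) IH
      a = pick {ys = blocked φ₀ δ₁ (p ∷ []) u} (unique₁ (ok base u∈W)) (≤-trans (s≤s (≤-trans (blocked-length φ₀ δ₁ (p ∷ []) u) (m≤m+n 2 3))) (six (ok base u∈W)))
      open Color u∈W (proj₁ (proj₂ a)) (proj₂ (proj₂ a))

    -- A weak neighbour `u` of `q`, the end that need not reach the blob, prolongs the path to p, q,
    -- u, whose ends are both attached.
    module SolveTwo {p q} (out-p : Out W B p) (out-q : Out W B q) (pq : Adj p q) (pB : HasWeak W L₁ L₂ → ⟦ p ⟧ ~ B)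
        (IH : Induction (4 * ∣ W ∣ + 2)) {u} (u∈W : Mem W u) (weak : Weak L₁ L₂ u) (uq : Adj u q) where
      open Solve W L₁ L₂ B (p ∷ q ∷ []) δ₁ δ₂ base (two out-p out-q pq pB) IH
      open BadColor u p q

      p~B : ⟦ p ⟧ ~ B
      p~B = pB (u , u∈W , weak)
      u~B : ⟦ u ⟧ ~ B
      u~B = weak-B base u∈W weak
      cs = proj₁ (candidates u∈W)
      cs-unique = proj₁ (proj₂ (candidates u∈W))
      cs-sound = proj₁ (proj₂ (proj₂ (candidates u∈W)))

      bad-B : ∀ {a} (x : Bad a) → ⟦ proj₁ x ⟧ ~ B
      bad-B x = weak-B base (proj₁ (proj₂ x)) (bad-weak x)

      -- A K₃,₃ with sides p, q, blob and u, w, w'.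
      one-bad : Adj u p → ∀ {a a'} → Bad a → Bad a' → a ≢ a' → ⊥
      one-bad up x@(w , m , wp , wq , wu , _) y@(w' , m' , w'p , w'q , w'u , _) ne =
        kuratowski-vertices (conn-B base) (Adj-sym up) (Adj-sym wp) (Adj-sym w'p) u~B (bad-B x) (bad-B y) uq wq w'q
          (Adj-≢ pq) (≢-sym (Adj-≢ wu)) (≢-sym (Adj-≢ w'u)) (bad-distinct x y ne)
          (proj₂ out-p) (proj₂ out-q) (W∉B base u∈W) (W∉B base m) (W∉B base m')

      -- The three witnesses against p, q, u form a K₃,₃ without the blob. This serves the case that
      -- `u` is not adjacent to `p`, where only `q` blocks colours and three candidates remain.
      two-bad : ∀ {a a' a''} → Bad a → Bad a' → Bad a'' → a ≢ a' → a ≢ a'' → a' ≢ a'' → ⊥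
      two-bad x@(w , m , wp , wq , wu , _) y@(w' , m' , w'p , w'q , w'u , _) z@(w'' , m'' , w''p , w''q , w''u , _) ne₁ ne₂ ne₃ =
        kuratowski-vertices {B = ⟦ q ⟧} conn-⟦⟧ (Adj-sym wp) (Adj-sym w'p) (Adj-sym w''p) (adj-~ wq) (adj-~ w'q) (adj-~ w''q) wu w'u w''u
          (≢-sym (W≢ u∈W (proj₁ out-p))) (bad-distinct x y ne₁) (bad-distinct x z ne₂) (bad-distinct y z ne₃)
          (⟦⟧-∌ (Adj-≢ pq)) (⟦⟧-∌ (Adj-≢ uq)) (⟦⟧-∌ (Adj-≢ wq)) (⟦⟧-∌ (Adj-≢ w'q)) (⟦⟧-∌ (Adj-≢ w''q))

      with-color : ∀ {a} → a ∈ cs → ¬ Bad a → Solvable W L₁ L₂ (p ∷ q ∷ []) δ₁ δ₂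
      with-color {a} a∈ ¬bad = colored (finish R id
          (three (out-hs R id (here refl)) (out-hs R id (there (here refl))) (out-u R id) pq (Adj-sym uq) (≢-sym (W≢ u∈W (proj₁ out-p))) (λ _ → p~B) (λ _ → u~B)
            λ m adjs → let c , c∈ , av = not-bad ¬bad (≢-sym (W≢ u∈W (proj₁ out-p))) (≢-sym (Adj-≢ uq)) (proj₁ m) (adjs (here refl)) (adjs (there (here refl))) (adjs (there (there (here refl))))
                       in c , c∈ , λ { (here e) → av (inj₁ e) ; (there (here e)) → av (inj₂ (inj₁ e)) ; (there (there (here e))) → av (inj₂ (inj₂ e)) })
          λ { _ (here e) _ → there (there (here e)) ; _ (there (here e)) _ → here e ; _ (there (there (here e))) _ → there (here e) })
        where open Color u∈W (proj₁ (cs-sound a∈)) (proj₂ (cs-sound a∈))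

      solve : Solvable W L₁ L₂ (p ∷ q ∷ []) δ₁ δ₂
      solve with Adj? u p
      ... | yes up with two-members cs-unique (candidates-≥ u∈W 4 2 (blocked-length φ₀ δ₁ (p ∷ q ∷ []) u) (six (ok base u∈W)))
      ...   | a , a' , a∈ , a'∈ , ne with bad? a | bad? a'
      ...     | no ¬b | _ = with-color a∈ ¬b
      ...     | yes _ | no ¬b = with-color a'∈ ¬b
      ...     | yes b | yes b' = ⊥-elim (one-bad up b b' ne)
      solve | no ¬up with three-members cs-unique (candidates-≥ u∈W 2 3
          (blocked-≤ φ₀ δ₁ {hs = q ∷ []} 0 2 (only-adj-no ¬up) (blocked-length φ₀ δ₁ (q ∷ []) u)) (≤-trans (n≤1+n 5) (six (ok base u∈W))))
      ...   | a , a' , a'' , a∈ , a'∈ , a''∈ , ne₁ , ne₂ , ne₃ with bad? a | bad? a' | bad? a''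
      ...     | no ¬b | _ | _ = with-color a∈ ¬b
      ...     | yes _ | no ¬b | _ = with-color a'∈ ¬b
      ...     | yes _ | yes _ | no ¬b = with-color a''∈ ¬b
      ...     | yes b | yes b' | yes b'' = ⊥-elim (two-bad b b' b'' ne₁ ne₂ ne₃)

    module SolveThree {p q r} (out-p : Out W B p) (out-q : Out W B q) (out-r : Out W B r) (pq : Adj p q) (qr : Adj q r) (p≢r : p ≢ r)
        (pB : ⟦ p ⟧ ~ B) (rB : ⟦ r ⟧ ~ B) (gc : Gc W L₁ δ₁ (p ∷ q ∷ r ∷ [])) (IH : Induction (4 * ∣ W ∣ + 3)) where
      hs : List (Fin n)
      hs = p ∷ q ∷ r ∷ []
      open Solve W L₁ L₂ B hs δ₁ δ₂ base (three out-p out-q out-r pq qr p≢r (λ _ → pB) (λ _ → rB) gc) IH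

      pattern at-p = here refl
      pattern at-q = there (here refl)
      pattern at-r = there (there (here refl))

      B+ : Fin n → Node → Set
      B+ v = B ∪ ⟦ v ⟧

      ∉B+ : ∀ {v w} → ¬ B (V v) → v ≢ w → ¬ B+ w (V v)
      ∉B+ ¬b ne (inj₁ b) = ¬b b
      ∉B+ ¬b ne (inj₂ e) = ⟦⟧-∌ ne e

      -- Stated for one end of the path, to be used a second time with `p` and `r` exchanged.
      module Side {u} (u∈W : Mem W u) (u~B : ⟦ u ⟧ ~ B) (uq : Adj u q) {p r} (out-p : Out W B p) (out-r : Out W B r) (pq : Adj p q) (qr : Adj q r) (p≢r : p ≢ r)
          (pB : ⟦ p ⟧ ~ B) (rB : ⟦ r ⟧ ~ B) where
        open BadColor u p q

        bad-B : ∀ {a} (x : Bad a) → ⟦ proj₁ x ⟧ ~ B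
        bad-B x = weak-B base (proj₁ (proj₂ x)) (bad-weak x)

        conn+ : Conn (B+ r)
        conn+ = conn-∪ (conn-B base) conn-⟦⟧ (~-sym rB)

        left : ∀ {v} → ⟦ v ⟧ ~ B → ⟦ v ⟧ ~ B+ r
        left = ~-⊆ id inj₁

        -- A K₃,₃: the two witnesses and the blob enlarged by `r` against p, q, u. The vertex `q`
        -- reaches the enlarged blob through `r`.
        one-bad : ∀ {a a'} → Bad a → Bad a' → a ≢ a' → ⊥
        one-bad x@(w , m , wp , wq , wu , _) y@(w' , m' , w'p , w'q , w'u , _) ne =
          kuratowski-vertices conn+ wq wp wu (~-⊆ id inj₂ (adj-~ qr)) (left pB) (left u~B) (Adj-sym w'q) (Adj-sym w'p) (Adj-sym w'u)
            (bad-distinct x y ne) (≢-sym (Adj-≢ pq)) (≢-sym (Adj-≢ uq)) (≢-sym (W≢ u∈W (proj₁ out-p)))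
            (∉B+ (W∉B base m) (W≢ m (proj₁ out-r))) (∉B+ (W∉B base m') (W≢ m' (proj₁ out-r)))
            (∉B+ (proj₂ out-q) (Adj-≢ qr)) (∉B+ (proj₂ out-p) p≢r) (∉B+ (W∉B base u∈W) (W≢ u∈W (proj₁ out-r)))

        -- A K₅ on q, p, u, the witness and the blob enlarged by `r`.
        no-bad : Adj u p → ∀ {a} → ¬ Bad a
        no-bad up x@(w , m , wp , wq , wu , _) =
          kuratowski₅ conn-⟦⟧ conn+ (touch (Adj-sym pq)) (Adj-sym uq) (Adj-sym wq) (~-⊆ id inj₂ (adj-~ qr)) (left pB) (left u~B) (left (bad-B x))
            (adj-~ (Adj-sym up)) (adj-~ (Adj-sym wp)) (Adj-sym wu) (⟦⟧-∌ (≢-sym (Adj-≢ pq))) (⟦⟧-∌ (Adj-≢ up)) (⟦⟧-∌ (Adj-≢ wp))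
            (⟦⟧-disjoint (∉B+ (proj₂ out-p) p≢r)) (∉B+ (proj₂ out-q) (Adj-≢ qr)) (∉B+ (W∉B base u∈W) (W≢ u∈W (proj₁ out-r))) (∉B+ (W∉B base m) (W≢ m (proj₁ out-r)))

      -- A weak vertex adjacent to the middle vertex q cuts the scene into three parts.
      module Middle {u} (u∈W : Mem W u) (weak : Weak L₁ L₂ u) (uq : Adj u q) where
        u~B : ⟦ u ⟧ ~ B
        u~B = weak-B base u∈W weak
        module P = Side u∈W u~B uq out-p out-r pq qr p≢r pB rB
        module R' = Side u∈W u~B uq out-r out-p (Adj-sym qr) (Adj-sym pq) (≢-sym p≢r) rB pB
        module BP = BadColor u p q
        module BR = BadColor u r q
        cs = proj₁ (candidates u∈W)
        cs-unique = proj₁ (proj₂ (candidates u∈W))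
        cs-sound = proj₁ (proj₂ (proj₂ (candidates u∈W)))
        cost : ∀ j k → length (only-adj u (pair φ₀ δ₁) p) ≤ j → length (only-adj u (pair φ₀ δ₁) r) ≤ k → length (blocked φ₀ δ₁ hs u) ≤ j + (2 + (k + 0))
        cost j k hj hk = blocked-≤ φ₀ δ₁ {hs = q ∷ r ∷ []} j (2 + (k + 0)) hj
          (blocked-≤ φ₀ δ₁ {hs = r ∷ []} 2 (k + 0) (adj-≤2 φ₀ δ₁ u q) (blocked-≤ φ₀ δ₁ {hs = []} k 0 hk z≤n))

        u≢p = W≢ u∈W (proj₁ out-p)
        u≢r = W≢ u∈W (proj₁ out-r)

        free : ∀ {a} → Avoids φ₀ δ₁ hs a → a ∉ blocked φ₀ δ₁ hs u
        free {a} av m with flatten-∈⁻ (only-adj u (pair φ₀ δ₁)) hs m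
        ... | x , x∈ , h with Adj? u x
        free av m | x , x∈ , here e | yes _ = proj₁ (av x∈) e
        free av m | x , x∈ , there (here e) | yes _ = proj₂ (av x∈) e

        -- Each of `p` and `r` adjacent to `u` costs candidates, but by `no-bad` it has no bad
        -- colours on its side; each other end has at most one. If both are adjacent, `Gc` itself
        -- supplies the colour.
        color : ∃[ a ] (a ∈ L₁ u × a ∉ blocked φ₀ δ₁ hs u × ¬ BP.Bad a × ¬ BR.Bad a)
        color = colorBy (Adj? u p) (Adj? u r)
          where
          colorBy : Dec (Adj u p) → Dec (Adj u r) → ∃[ a ] (a ∈ L₁ u × a ∉ blocked φ₀ δ₁ hs u × ¬ BP.Bad a × ¬ BR.Bad a)
          colorBy (yes up) (yes ur) = let a , a∈ , av = gc u∈W (λ { at-p → up ; at-q → uq ; at-r → ur }) in a , a∈ , free av , P.no-bad up , R'.no-bad ur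
          colorBy (yes up) (no ¬ur) with two-members cs-unique (candidates-≥ u∈W 4 2 (cost 2 0 (adj-≤2 φ₀ δ₁ u p) (only-adj-no ¬ur)) (six (ok base u∈W)))
          ...   | a , a' , a∈ , a'∈ , ne with BR.bad? a | BR.bad? a'
          ...     | no ¬b | _ = a , proj₁ (cs-sound a∈) , proj₂ (cs-sound a∈) , P.no-bad up , ¬b
          ...     | yes _ | no ¬b = a' , proj₁ (cs-sound a'∈) , proj₂ (cs-sound a'∈) , P.no-bad up , ¬b
          ...     | yes b | yes b' = ⊥-elim (R'.one-bad b b' ne)
          colorBy (no ¬up) (yes ur) with two-members cs-unique (candidates-≥ u∈W 4 2 (cost 0 2 (only-adj-no ¬up) (adj-≤2 φ₀ δ₁ u r)) (six (ok base u∈W)))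
          ...   | a , a' , a∈ , a'∈ , ne with BP.bad? a | BP.bad? a'
          ...     | no ¬b | _ = a , proj₁ (cs-sound a∈) , proj₂ (cs-sound a∈) , ¬b , R'.no-bad ur
          ...     | yes _ | no ¬b = a' , proj₁ (cs-sound a'∈) , proj₂ (cs-sound a'∈) , ¬b , R'.no-bad ur
          ...     | yes b | yes b' = ⊥-elim (P.one-bad b b' ne)
          colorBy (no ¬up) (no ¬ur) = let a , a∈ = one-member two-left ; a∈₁ , ¬bR = ∈-filter⁻ goodR {xs = filter goodP cs} a∈ ; a∈₀ , ¬bP = ∈-filter⁻ goodP {xs = cs} a∈₁ in
              a , proj₁ (cs-sound a∈₀) , proj₂ (cs-sound a∈₀) , ¬bP , ¬bR
            where
            goodP = λ a → ¬? (BP.bad? a)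
            goodR = λ a → ¬? (BR.bad? a)
            eq-dec : ∀ {a b : ℕ} → (a ≢ b → ⊥) → a ≡ b
            eq-dec {a} {b} = decidable-stable (a ℕ.≟ b)
            enough : 3 ≤ length cs
            enough = candidates-≥ u∈W 2 3 (cost 0 0 (only-adj-no ¬up) (only-adj-no ¬ur)) (≤-trans (n≤1+n 5) (six (ok base u∈W)))
            left-P : 2 ≤ length (filter goodP cs)
            left-P = s≤s⁻¹ (≤-trans enough (length-filter-but-one goodP cs-unique λ {a} {b} _ _ x y → eq-dec (P.one-bad (decidable-stable (BP.bad? a) x) (decidable-stable (BP.bad? b) y))))
            two-left : 1 ≤ length (filter goodR (filter goodP cs))
            two-left = s≤s⁻¹ (≤-trans left-P (length-filter-but-one goodR (Unique.filter⁺ goodP cs-unique) λ {a} {b} _ _ x y → eq-dec (R'.one-bad (decidable-stable (BR.bad? a) x) (decidable-stable (BR.bad? b) y))))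

        module WithColor {a} (a∈ : a ∈ L₁ u) (a∉ : a ∉ blocked φ₀ δ₁ hs u) (¬badP : ¬ BP.Bad a) (¬badR : ¬ BR.Bad a) where
          open Color u∈W a∈ a∉

          -- A component attached to p, r and u would form a K₃,₃ with them, `q` and the blob. So it
          -- misses one of them, and at most three coloured vertices are left for it.
          part : ∀ D → Component R D → Part D
          part D comp with Att? D p | Att? D r | Att? D u
          ... | _ | _ | no ¬u = unattached D (inside comp) ¬u
          ... | no ¬p | _ | yes _ = finish D (inside comp)
                (three (out-hs D (inside comp) at-r) (out-hs D (inside comp) at-q) (out-u D (inside comp)) (Adj-sym qr) (Adj-sym uq) (≢-sym u≢r) (λ _ → rB) (λ _ → u~B)
                  λ m adjs → let c , c∈ , av = BR.not-bad ¬badR (≢-sym u≢r) (≢-sym (Adj-≢ uq)) (inW D (inside comp) m) (adjs at-p) (adjs at-q) (adjs at-r)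
                             in c , c∈ , λ { (here e) → av (inj₁ e) ; (there (here e)) → av (inj₂ (inj₁ e)) ; (there (there (here e))) → av (inj₂ (inj₂ e)) })
                λ { m (here refl) _ → at-r ; m (there at-p) adj → contradiction (_ , m , adj) ¬p ; m (there at-q) _ → at-q ; m (there at-r) _ → at-p }
          ... | yes _ | no ¬r | yes _ = finish D (inside comp)
                (three (out-hs D (inside comp) at-p) (out-hs D (inside comp) at-q) (out-u D (inside comp)) pq (Adj-sym uq) (≢-sym u≢p) (λ _ → pB) (λ _ → u~B)
                  λ m adjs → let c , c∈ , av = BP.not-bad ¬badP (≢-sym u≢p) (≢-sym (Adj-≢ uq)) (inW D (inside comp) m) (adjs at-p) (adjs at-q) (adjs at-r)
                             in c , c∈ , λ { (here e) → av (inj₁ e) ; (there (here e)) → av (inj₂ (inj₁ e)) ; (there (there (here e))) → av (inj₂ (inj₂ e)) })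
                λ { m (here refl) _ → at-r ; m (there at-r) adj → contradiction (_ , m , adj) ¬r ; m (there at-q) _ → at-q ; m (there at-p) _ → at-p }
          ... | yes ap | yes ar | yes au = ⊥-elim (kuratowski-component D (conn-B base) (conn comp) (Adj-sym pq) (Adj-sym uq) qr pB u~B rB ap au ar
                (≢-sym u≢p) p≢r u≢r (proj₂ out-q) (proj₂ out-p) (W∉B base u∈W) (proj₂ out-r)
                (proj₁ (out-hs D (inside comp) at-q)) (proj₁ (out-hs D (inside comp) at-p)) (proj₁ (out-u D (inside comp))) (proj₁ (out-hs D (inside comp) at-r))
                (λ m → W∉B base (inW D (inside comp) m)))

          solve : Solvable W L₁ L₂ hs δ₁ δ₂
          solve = colored (by-components R part)

        solve : Solvable W L₁ L₂ hs δ₁ δ₂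
        solve = let _ , a∈ , a∉ , ¬badP , ¬badR = color in WithColor.solve a∈ a∉ ¬badP ¬badR

      -- A component attached to u and to the blob lies on the side of u away from q.
      away : ∀ {u} (u∈W : Mem W u) → Adj u p → Adj u r → ∀ {D} → Conn (lift (Mem D)) → (∀ {v} → Mem D v → Mem W v) → ¬ Mem D u →
        Att D u → HasWeak D L₁ L₂ → ¬ Att D q
      away {u} u∈W up ur {D} cD sub u∉D (w , w∈ , wu) (v , v∈ , wk) aq =
        kuratowski-set {X = lift (Mem D)} cD (conn-B base) (touch-lift (Adj-sym wu) w∈) up ur (lift-~B v∈ (weak-B base (sub v∈) wk)) pB rB (att-~ {D} aq) pq (Adj-sym qr)
          (W≢ u∈W (proj₁ out-q)) p≢r u∉D (proj₁ out-q ∘ sub) (proj₁ out-p ∘ sub) (proj₁ out-r ∘ sub) (lift-disjoint (λ m → W∉B base (sub m)))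
          (W∉B base u∈W) (proj₂ out-q) (proj₂ out-p) (proj₂ out-r)

      -- After `Delete` a strong vertex may be down to six colours, all of which three coloured
      -- neighbours could block. Such a vertex is coloured beforehand.
      module Hub {x} (x∈W : Mem W x) (sx : Strong L₁ L₂ x) (xp : Adj x p) (xq : Adj x q) (xr : Adj x r) where
        open BadColor x p r
        x≢p = Adj-≢ xp
        x≢r = Adj-≢ xr
        cs = proj₁ (candidates x∈W)
        cs-unique = proj₁ (proj₂ (candidates x∈W))
        cs-sound = proj₁ (proj₂ (proj₂ (candidates x∈W)))

        -- A K₃,₃ with sides p, r, x and q, w, w'.
        one-bad : ∀ {a a'} → Bad a → Bad a' → a ≢ a' → ⊥
        one-bad y@(w , m , wp , wr , wx , _) y'@(w' , m' , w'p , w'r , w'x , _) ne =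
          kuratowski-vertices {B = ⟦ p ⟧} conn-⟦⟧ xq (Adj-sym wx) (Adj-sym w'x) (adj-~ (Adj-sym pq)) (adj-~ wp) (adj-~ w'p) qr wr w'r
            x≢r (≢-sym (W≢ m (proj₁ out-q))) (≢-sym (W≢ m' (proj₁ out-q))) (bad-distinct y y' ne)
            (⟦⟧-∌ x≢p) (⟦⟧-∌ (≢-sym p≢r)) (⟦⟧-∌ (≢-sym (Adj-≢ pq))) (⟦⟧-∌ (Adj-≢ wp)) (⟦⟧-∌ (Adj-≢ w'p))

        color : ∃[ a ] (a ∈ cs × ¬ Bad a)
        color with two-members cs-unique (candidates-≥ x∈W 6 2 (blocked-6 φ₀ δ₁ x) (≤-trans (m≤m+n 8 2) (proj₁ sx)))
        ... | a , a' , a∈ , a'∈ , ne with bad? a | bad? a'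
        ...   | no ¬b | _ = a , a∈ , ¬b
        ...   | yes _ | no ¬b = a' , a'∈ , ¬b
        ...   | yes b | yes b' = ⊥-elim (one-bad b b' ne)

        module WithColor {a} (a∈ : a ∈ L₁ x) (a∉ : a ∉ blocked φ₀ δ₁ hs x) (¬bad : ¬ Bad a) where
          open Color x∈W a∈ a∉

          part : ∀ D → Component R D → Part D
          part D comp with Att? D x
          ... | no ¬x = unattached D (inside comp) ¬x
          ... | yes ax with Att? D q
          ...   | no ¬q = finish D (inside comp)
                  (three (out-hs D (inside comp) at-p) (out-u D (inside comp)) (out-hs D (inside comp) at-r) (Adj-sym xp) xr p≢r (λ _ → pB) (λ _ → rB)
                    λ m adjs → let c , c∈ , av = not-bad ¬bad (≢-sym x≢p) (≢-sym x≢r) (inW D (inside comp) m) (adjs at-p) (adjs at-r) (adjs at-q)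
                               in c , c∈ , λ { (here e) → av (inj₁ e) ; (there (here e)) → av (inj₂ (inj₂ e)) ; (there (there (here e))) → av (inj₂ (inj₁ e)) })
                  λ { m (here refl) _ → at-q ; m (there at-q) adj → contradiction (_ , m , adj) ¬q ; m (there at-p) _ → at-p ; m (there at-r) _ → at-r }
          -- By `away` a component attached to `q` has no weak vertex, so the conditions on the blob
          -- hold vacuously and `Gc` follows from the long lists.
          ...   | yes aq with Att? D p | Att? D r
          ...     | no ¬p | _ = finish D (inside comp)
                    (three (out-u D (inside comp)) (out-hs D (inside comp) at-q) (out-hs D (inside comp) at-r) xq qr x≢r (⊥-elim ∘ noWeak) (⊥-elim ∘ noWeak)
                      (strong-gc D (inW D (inside comp)) noWeak ≤-refl))
                    λ { m (here refl) _ → at-p ; m (there at-p) adj → contradiction (_ , m , adj) ¬p ; m (there at-q) _ → at-q ; m (there at-r) _ → at-r }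
              where
              noWeak : ¬ HasWeak D L₁ L₂
              noWeak w = away x∈W xp xr {D} (conn comp) (inW D (inside comp)) (proj₁ (out-u D (inside comp))) ax w aq
          ...     | yes _ | no ¬r = finish D (inside comp)
                    (three (out-hs D (inside comp) at-p) (out-hs D (inside comp) at-q) (out-u D (inside comp)) pq (Adj-sym xq) (≢-sym x≢p) (⊥-elim ∘ noWeak) (⊥-elim ∘ noWeak)
                      (strong-gc D (inW D (inside comp)) noWeak ≤-refl))
                    λ { m (here refl) _ → at-r ; m (there at-r) adj → contradiction (_ , m , adj) ¬r ; m (there at-q) _ → at-q ; m (there at-p) _ → at-p }
              where
              noWeak : ¬ HasWeak D L₁ L₂
              noWeak w = away x∈W xp xr {D} (conn comp) (inW D (inside comp)) (proj₁ (out-u D (inside comp))) ax w aq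
          -- This would be a K₅ on q, x, p, the component and the blob enlarged by `r`.
          ...     | yes ap | yes ar = ⊥-elim (kuratowski₅ {X = lift (Mem D)} {B = B+ r} (conn comp) (conn-∪ (conn-B base) conn-⟦⟧ (~-sym rB))
                    (touch-lift (Adj-sym (proj₂ (proj₂ aq))) (proj₁ (proj₂ aq))) (Adj-sym xq) (Adj-sym pq)
                    (~-⊆ id inj₂ (adj-~ qr)) (~-⊆ id inj₂ (att-~ {D} ar)) (~-⊆ id inj₂ (adj-~ xr)) (~-⊆ id inj₁ pB) (att-~ {D} ax) (att-~ {D} ap) xp
                    (∉D at-q) (proj₁ (out-u D (inside comp))) (∉D at-p) (lift-disjoint (λ m → ∉B+ (W∉B base (inW D (inside comp) m)) (W≢ (inW D (inside comp) m) (proj₁ out-r))))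
                    (∉B+ (proj₂ out-q) (Adj-≢ qr)) (∉B+ (W∉B base x∈W) x≢r) (∉B+ (proj₂ out-p) p≢r))
              where
              ∉D : ∀ {v} → v ∈ hs → ¬ Mem D v
              ∉D v∈ = proj₁ (out-hs D (inside comp) v∈)

          solve : Solvable W L₁ L₂ hs δ₁ δ₂
          solve = colored (by-components R part)

        solve : Solvable W L₁ L₂ hs δ₁ δ₂
        solve = let _ , a∈ , ¬bad = color in WithColor.solve (proj₁ (cs-sound a∈)) (proj₂ (cs-sound a∈)) ¬bad

      -- A weak vertex adjacent to both ends closes the outer boundary.
      module Closing {u} (u∈W : Mem W u) (weak : Weak L₁ L₂ u) (up : Adj u p) (ur : Adj u r) (¬uq : ¬ Adj u q) where
        u~B : ⟦ u ⟧ ~ B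
        u~B = weak-B base u∈W weak
        u≢q = W≢ u∈W (proj₁ out-q)

        cs = proj₁ (candidates u∈W)
        cs-sound = proj₁ (proj₂ (proj₂ (candidates u∈W)))

        cs-length : 1 ≤ length cs
        cs-length = candidates-≥ u∈W 5 1
          (≤-trans (blocked-≤ φ₀ δ₁ {hs = q ∷ r ∷ []} 2 2 (adj-≤2 φ₀ δ₁ u p) (blocked-≤ φ₀ δ₁ {hs = r ∷ []} 0 2 (only-adj-no ¬uq) (blocked-length φ₀ δ₁ (r ∷ []) u))) (n≤1+n 4))
          (six (ok base u∈W))

        color : ∃[ a ] (a ∈ L₁ u × a ∉ blocked φ₀ δ₁ hs u)
        color = let a , a∈ = one-member cs-length in a , cs-sound a∈

        module WithColor {a} (a∈ : a ∈ L₁ u) (a∉ : a ∉ blocked φ₀ δ₁ hs u) where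
          open Color u∈W a∈ a∉

          module InPart (D : FSet n) (comp : Component R D) (au : Att D u) where
            sub : ∀ {v} → Mem D v → Mem W v
            sub = inW D (inside comp)

            -- Contracting `r` and `q` gives a K₅ with u, p, v and the blob.
            no-weak : ∀ {v} → Mem D v → (∀ {x} → x ∈ p ∷ u ∷ r ∷ [] → Adj v x) → ¬ Weak L₁ L₂ v
            no-weak {v} m adjs wk = kuratowski₅ {X = ⟦ r ⟧ ∪ ⟦ q ⟧} (conn-∪ conn-⟦⟧ conn-⟦⟧ (adj-~ (Adj-sym qr))) (conn-B base)
                (touch-⊆ {⟦ r ⟧} {⟦ r ⟧ ∪ ⟦ q ⟧} inj₁ (touch ur)) up (Adj-sym (adjs at-q)) u~B (~-⊆ inj₁ id rB) pB (weak-B base v∈W wk)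
                (~-⊆ inj₂ id (adj-~ (Adj-sym pq))) (~-⊆ inj₁ id (adj-~ (Adj-sym (adjs at-r)))) (Adj-sym (adjs at-p))
                (out₂ (Adj-≢ ur) u≢q) (out₂ p≢r (Adj-≢ pq)) (out₂ (W≢ v∈W (proj₁ out-r)) (W≢ v∈W (proj₁ out-q)))
                (λ { _ (inj₁ refl) → proj₂ out-r ; _ (inj₂ refl) → proj₂ out-q }) (W∉B base u∈W) (proj₂ out-p) (W∉B base v∈W)
              where
              v∈W : Mem W v
              v∈W = sub m
              out₂ : ∀ {x} → x ≢ r → x ≢ q → ¬ (⟦ r ⟧ ∪ ⟦ q ⟧) (V x)
              out₂ ne ne' (inj₁ e) = ⟦⟧-∌ ne e
              out₂ ne ne' (inj₂ e) = ⟦⟧-∌ ne' e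

            gcD : Gc D L₁ δ₁' (p ∷ u ∷ r ∷ [])
            gcD {v} m adjs = big-gc (p ∷ u ∷ r ∷ []) (unique₁ (ok base (sub m))) (≤-trans (m≤m+n 7 3) (proj₁ (strong (no-weak m adjs))))

            outer : HasWeak D L₁ L₂ → Part D
            outer w = finish D (inside comp)
              (three (out-hs D (inside comp) at-p) (out-u D (inside comp)) (out-hs D (inside comp) at-r) (Adj-sym up) ur p≢r (λ _ → pB) (λ _ → rB) gcD)
              λ { m (here refl) _ → at-q ; m (there at-q) adj → contradiction (_ , m , adj) ¬q ; m (there at-p) _ → at-p ; m (there at-r) _ → at-r }
              where
              ¬q : ¬ Att D q
              ¬q = away u∈W up ur {D} (conn comp) sub (proj₁ (out-u D (inside comp))) au w

            -- All of p, q, r, u may be attached, one vertex too many. Since `D` has only strong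
            -- vertices, `u` is absorbed and becomes the blob, to which `p` and `r` are adjacent.
            inner : ¬ HasWeak D L₁ L₂ → Part D
            inner noWeak = A.absorb (smaller (D<W D (inside comp)) A.base'
              (three (out' at-p) (out' at-q) (out' at-r) pq qr p≢r (λ _ → adj-~ (Adj-sym up)) (λ _ → adj-~ (Adj-sym ur)) (A.gc' {hs} ≤-refl)))
              where
              module A = Absorb D L₁ L₂ u δ₁' δ₂' (λ m → ok base (sub m)) (λ m → strong (λ w → noWeak (_ , m , w))) (proj₁ (out-u D (inside comp)))
              out' : ∀ {v} → v ∈ hs → Out D ⟦ u ⟧ v
              out' v∈ = proj₁ (out-hs D (inside comp) v∈) , ⟦⟧-∌ (hs≢u v∈)

          part : ∀ D → Component R D → Part D
          part D comp = go (Att? D u) (hasWeak? D)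
            where
            go : Dec (Att D u) → Dec (HasWeak D L₁ L₂) → Part D
            go (no ¬u) _ = unattached D (inside comp) ¬u
            go (yes au) (yes w) = InPart.outer D comp au w
            go (yes au) (no noWeak) = InPart.inner D comp au noWeak

          solve : Solvable W L₁ L₂ hs δ₁ δ₂
          solve = colored (by-components R part)

        solve : Solvable W L₁ L₂ hs δ₁ δ₂
        solve = let _ , a∈ , a∉ = color in WithColor.solve a∈ a∉

-- Cutting a scene

module Cutting {n : ℕ} (M : Map n) (genus0 : Map.Genus0 M) (φ₀ : Fin n → ℕ) where
  open Map M hiding (φ)
  open Minors M genus0
  open Cases M genus0 φ₀ public

  module CutScene (W : FSet n) (L₁ L₂ : Lists) (B : Node → Set) (hs : List (Fin n)) (δ₁ δ₂ : Fin n → ℕ)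
      (base : Base W L₁ L₂ B) (head : Head W L₁ L₂ B δ₁ hs) (IH : Induction (4 * ∣ W ∣ + length hs)) where
    open Solve W L₁ L₂ B hs δ₁ δ₂ base head IH

    -- Once W₀ is recolored, its vertices adjacent to the rest count as coloured.
    module Glue (W₀ : FSet n) (W₀⊆W : ∀ {v} → Mem W₀ v → Mem W v) (s : Solvable W₀ L₁ L₂ hs δ₁ δ₂) where
      C : FSet n
      C = W ─ W₀

      δ₁' δ₂' : Fin n → ℕ
      δ₁' = onto W₀ (Sol.φ₁ s) δ₁
      δ₂' = onto W₀ (Sol.φ₂ s) δ₂

      glue : ∀ {hs₁} → (∀ {c p} → Mem C c → p ∈ hs → Adj c p → p ∈ hs₁) → (∀ {c u} → Mem C c → Mem W₀ u → Adj c u → u ∈ hs₁) →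
        Solvable C L₁ L₂ hs₁ δ₁' δ₂' → Solvable W L₁ L₂ hs δ₁ δ₂
      glue att att₀ t = Join.same-order W W₀ C (λ m ¬a → m , ¬a) s t
        (λ c (m , av) → m , λ p∈ adj → let x , y = av (att c p∈ adj) adj in x , λ e → y (trans e (sym (onto-out W₀ (out p∈)))))
        (λ c (m , av) → m , λ p∈ adj → let x , y = av (att c p∈ adj) adj in
          (λ e → x (trans e (sym (onto-out W₀ (out p∈))))) , λ e → y (trans e (sym (onto-out W₀ (out p∈)))))
        (λ c (m , av) u∈ adj → let x , y = av (att₀ c u∈ adj) adj in x , λ e → y (trans e (sym (onto-in W₀ u∈))))
        (λ c (m , av) u∈ adj e → proj₂ (av (att₀ c u∈ adj) adj) (trans e (sym (onto-in W₀ u∈))))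
        (λ c (m , av) u∈ adj e → proj₁ (av (att₀ c u∈ adj) adj) (trans e (sym (onto-in W₀ u∈))))
        where
        out : ∀ {p} → p ∈ hs → ¬ Mem W₀ p
        out p∈ m = hs∉W p∈ (W₀⊆W m)

    -- Three neighbours ya, yb, yc of z attached to the blob; D₀ carries the coloured vertices and avoids yc.
    record Fork (z ya yb yc : Fin n) (D₀ : FSet n) : Set where
      field
        z∈W : Mem W z
        za : Adj z ya
        zb : Adj z yb
        zc : Adj z yc
        aB : ⟦ ya ⟧ ~ B
        bB : ⟦ yb ⟧ ~ B
        cB : ⟦ yc ⟧ ~ B
        a∈ : Mem W ya ⊎ (ya ∈ hs × Weak L₁ L₂ z)
        b∈W : Mem W yb
        c∈W : Mem W yc
        a≢b : ya ≢ yb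
        a≢c : ya ≢ yc
        b≢c : yb ≢ yc
        D-conn : Conn (lift (Mem D₀))
        D-sub : ∀ {v} → Mem D₀ v → Mem W v ⊎ v ∈ hs
        z∉D : ¬ Mem D₀ z
        a∉D : ¬ Mem D₀ ya
        b∉D : ¬ Mem D₀ yb
        c∉D : ¬ Mem D₀ yc
        D-closed : ∀ {v w} → Mem D₀ v → Mem W w → Adj v w → w ≢ z → w ≢ ya → w ≢ yb → w ≢ yc → Mem D₀ w
        hs-near : ∀ {p} → p ∈ hs → Mem D₀ p ⊎ p ≡ ya
        ¬c : ¬ Att D₀ yc

    module CutFork {z ya yb yc D₀} (fork : Fork z ya yb yc D₀) where
      open Fork fork

      a∉B : ¬ B (V ya)
      a∉B with a∈
      ... | inj₁ m = W∉B base m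
      ... | inj₂ (m , _) = proj₂ (head-out head m)

      D∉B : ∀ {v} → Mem D₀ v → ¬ B (V v)
      D∉B m with D-sub m
      ... | inj₁ w = W∉B base w
      ... | inj₂ h = proj₂ (head-out head h)

      head₀ : ∀ {W₀ : FSet n} → (∀ {v} → Mem W₀ v → Mem W v) → Head W₀ L₁ L₂ B δ₁ hs
      head₀ sub = head-map (λ p∈ → hs∉W p∈ ∘ sub , proj₂ (head-out head p∈)) (λ (v , m , w) → v , sub m , w) id (λ gc m → gc (sub m)) head

      -- Only `z` and `ya` connect `D₀` with the rest, so the second part has two coloured vertices
      -- and `Gc` does not arise.
      module Two (¬b : ¬ Att D₀ yb) where
        W₀ : FSet n
        W₀ = fset (λ v → Mem W v × (Mem D₀ v ⊎ v ≡ z ⊎ v ≡ ya)) (λ v → mem? W v ×-dec (mem? D₀ v ⊎-dec ((v ≟ᶠ z) ⊎-dec (v ≟ᶠ ya))))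

        c∉W₀ : ¬ Mem W₀ yc
        c∉W₀ (_ , inj₁ m) = c∉D m
        c∉W₀ (_ , inj₂ (inj₁ e)) = Adj-≢ zc (sym e)
        c∉W₀ (_ , inj₂ (inj₂ e)) = a≢c (sym e)

        s : Solvable W₀ L₁ L₂ hs δ₁ δ₂
        s = smaller (size-< W₀ W proj₁ c∈W c∉W₀) (base-⊆ proj₁ base) (head₀ {W₀} proj₁)

        open Glue W₀ proj₁ s

        escape : ∀ {v c} → Mem C c → Mem D₀ v → ¬ Adj v c
        escape {v} {c} (cW , c∉) m adj with c ≟ᶠ yb | c ≟ᶠ yc
        ... | yes refl | _ = ¬b (v , m , adj)
        ... | no _ | yes refl = ¬c (v , m , adj)
        ... | no c≢b | no c≢c = c∉ (cW , inj₁ (D-closed m cW adj (λ e → c∉ (cW , inj₂ (inj₁ e))) (λ e → c∉ (cW , inj₂ (inj₂ e))) c≢b c≢c))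

        t : Solvable C L₁ L₂ (ya ∷ z ∷ []) δ₁' δ₂'
        t = smaller (size-< C W proj₁ z∈W (λ (_ , z∉) → z∉ (z∈W , inj₂ (inj₁ refl)))) (base-⊆ proj₁ base)
          (two ((λ (m , ∉) → ∉ (m , inj₂ (inj₂ refl))) , a∉B) ((λ (m , ∉) → ∉ (m , inj₂ (inj₁ refl))) , W∉B base z∈W) (Adj-sym za) (λ _ → aB))

        solve : Solvable W L₁ L₂ hs δ₁ δ₂
        solve = glue att att₀ t
          where
          att : ∀ {c p} → Mem C c → p ∈ hs → Adj c p → p ∈ ya ∷ z ∷ []
          att mc p∈ adj with hs-near p∈
          ... | inj₁ m = contradiction (Adj-sym adj) (escape mc m)
          ... | inj₂ e = here e
          att₀ : ∀ {c u} → Mem C c → Mem W₀ u → Adj c u → u ∈ ya ∷ z ∷ []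
          att₀ mc (_ , inj₁ m) adj = contradiction (Adj-sym adj) (escape mc m)
          att₀ mc (_ , inj₂ (inj₁ e)) adj = there (here e)
          att₀ mc (_ , inj₂ (inj₂ e)) adj = here e

      -- The border of the second part is the path ya, z, yb. Its ends are attached to the blob by
      -- assumption; the work lies in its `Gc`.
      module Three (ab : Att D₀ ya) (bb : Att D₀ yb) where
        W₀ : FSet n
        W₀ = fset (λ v → Mem W v × (Mem D₀ v ⊎ v ≡ z ⊎ v ≡ ya ⊎ v ≡ yb))
          (λ v → mem? W v ×-dec (mem? D₀ v ⊎-dec ((v ≟ᶠ z) ⊎-dec ((v ≟ᶠ ya) ⊎-dec (v ≟ᶠ yb)))))

        c∉W₀ : ¬ Mem W₀ yc
        c∉W₀ (_ , inj₁ m) = c∉D m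
        c∉W₀ (_ , inj₂ (inj₁ e)) = Adj-≢ zc (sym e)
        c∉W₀ (_ , inj₂ (inj₂ (inj₁ e))) = a≢c (sym e)
        c∉W₀ (_ , inj₂ (inj₂ (inj₂ e))) = b≢c (sym e)

        W₀<W : ∣ W₀ ∣ < ∣ W ∣
        W₀<W = size-< W₀ W proj₁ c∈W c∉W₀

        C₀ : FSet n
        C₀ = W ─ W₀

        z∈W₀ : Mem W₀ z
        z∈W₀ = z∈W , inj₂ (inj₁ refl)

        b∈W₀ : Mem W₀ yb
        b∈W₀ = b∈W , inj₂ (inj₂ (inj₂ refl))

        escape : ∀ {v c} → Mem C₀ c → Mem D₀ v → ¬ Adj v c
        escape {v} {c} (cW , c∉) m adj with c ≟ᶠ yc
        ... | yes refl = ¬c (v , m , adj)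
        ... | no c≢c = c∉ (cW , inj₁ (D-closed m cW adj (λ e → c∉ (cW , inj₂ (inj₁ e))) (λ e → c∉ (cW , inj₂ (inj₂ (inj₁ e))))
                         (λ e → c∉ (cW , inj₂ (inj₂ (inj₂ e)))) c≢c))

        border : List (Fin n)
        border = ya ∷ z ∷ yb ∷ []

        module Finish (s : Solvable W₀ L₁ L₂ hs δ₁ δ₂) where
          open Glue W₀ proj₁ s public

          finish : Gc C L₁ δ₁' border → Solvable W L₁ L₂ hs δ₁ δ₂
          finish gc = glue att att₀ (smaller (size-< C W proj₁ z∈W (λ (_ , z∉) → z∉ z∈W₀)) (base-⊆ proj₁ base)
            (three ((λ (m , ∉) → ∉ (m , inj₂ (inj₂ (inj₁ refl)))) , a∉B) ((λ (_ , ∉) → ∉ z∈W₀) , W∉B base z∈W) ((λ (_ , ∉) → ∉ b∈W₀) , W∉B base b∈W)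
              (Adj-sym za) zb a≢b (λ _ → aB) (λ _ → bB) gc))
            where
            att : ∀ {c p} → Mem C c → p ∈ hs → Adj c p → p ∈ border
            att mc p∈ adj with hs-near p∈
            ... | inj₁ m = contradiction (Adj-sym adj) (escape mc m)
            ... | inj₂ e = here e
            att₀ : ∀ {c u} → Mem C c → Mem W₀ u → Adj c u → u ∈ border
            att₀ mc (_ , inj₁ m) adj = contradiction (Adj-sym adj) (escape mc m)
            att₀ mc (_ , inj₂ (inj₁ e)) adj = there (here e)
            att₀ mc (_ , inj₂ (inj₂ (inj₁ e))) adj = here e
            att₀ mc (_ , inj₂ (inj₂ (inj₂ e))) adj = there (there (here e))

          strong-border : ∀ {v} → Mem C v → ¬ Weak L₁ L₂ v → ∃[ a ] (a ∈ L₁ v × Avoids φ₀ δ₁' border a)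
          strong-border m ¬wk = big-gc border (unique₁ (ok base (proj₁ m))) (≤-trans (m≤m+n 7 3) (proj₁ (strong ¬wk)))

        plain : Solvable W₀ L₁ L₂ hs δ₁ δ₂
        plain = smaller W₀<W (base-⊆ proj₁ base) (head₀ {W₀} proj₁)

        X : Node → Set
        X = ⟦ ya ⟧ ∪ lift (Mem D₀)

        conn-X : Conn X
        conn-X = conn-∪ conn-⟦⟧ D-conn (att-~ʳ {D₀} ab)

        ∉X : ∀ {v} → v ≢ ya → ¬ Mem D₀ v → ¬ X (V v)
        ∉X ne ∉ (inj₁ e) = ⟦⟧-∌ ne e
        ∉X ne ∉ (inj₂ m) = ∉ m

        C∉X : ∀ {v} → Mem C₀ v → ¬ X (V v)
        C∉X (m , ∉) = ∉X (λ e → ∉ (m , inj₂ (inj₂ (inj₁ e)))) (λ d → ∉ (m , inj₁ d))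

        X-disjoint : Disjoint X B
        X-disjoint _ (inj₁ refl) = a∉B
        X-disjoint (V v) (inj₂ m) = D∉B m

        AllAdj : Fin n → Set
        AllAdj v = ∀ {x} → x ∈ border → Adj v x

        -- Contracting `ya` and `D₀`, which reaches `yb`, gives a K₅ with z, yb, v and the blob.
        no-weak : Weak L₁ L₂ z → ∀ {v} → Mem C₀ v → Weak L₁ L₂ v → ¬ AllAdj v
        no-weak wz {v} m wk adjs = kuratowski₅ {X = X} conn-X (conn-B base) (touch-⊆ {⟦ ya ⟧} {X} inj₁ (touch za)) zb (Adj-sym (adjs (there (here refl))))
          (weak-B base z∈W wz) (~-⊆ inj₁ id aB) bB (weak-B base (proj₁ m) wk) (~-⊆ inj₂ id (att-~ {D₀} bb)) (~-⊆ inj₁ id (adj-~ (Adj-sym (adjs (here refl)))))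
          (Adj-sym (adjs (there (there (here refl))))) (∉X (Adj-≢ za) z∉D) (∉X (≢-sym a≢b) b∉D) (C∉X m) X-disjoint
          (W∉B base z∈W) (W∉B base b∈W) (W∉B base (proj₁ m))

        -- Two such vertices and `X` would form a K₃,₃ with z, yb and the blob.
        one-weak : ∀ {v w} → Mem C₀ v → Weak L₁ L₂ v → AllAdj v → Mem C₀ w → Weak L₁ L₂ w → AllAdj w → v ≡ w
        one-weak {v} {w} m wk adjs m' wk' adjs' with v ≟ᶠ w
        ... | yes e = e
        ... | no ne = ⊥-elim (kuratowski-set {X = X} conn-X (conn-B base) (touch-⊆ {⟦ ya ⟧} {X} inj₁ (touch za)) (Adj-sym (adjs (there (here refl)))) (Adj-sym (adjs' (there (here refl))))
          (~-⊆ inj₁ id aB) (weak-B base (proj₁ m) wk) (weak-B base (proj₁ m') wk') (~-⊆ inj₂ id (att-~ {D₀} bb))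
          (adjs (there (there (here refl)))) (adjs' (there (there (here refl)))) (Adj-≢ zb) ne (∉X (Adj-≢ za) z∉D) (∉X (≢-sym a≢b) b∉D)
          (C∉X m) (C∉X m') X-disjoint (W∉B base z∈W) (W∉B base b∈W) (W∉B base (proj₁ m)) (W∉B base (proj₁ m')))

        solve-weak : Weak L₁ L₂ z → Solvable W L₁ L₂ hs δ₁ δ₂
        solve-weak wz = finish λ m adjs → strong-border m (λ wk → no-weak wz m wk adjs)
          where open Finish plain

        -- Forbidding at z three colours of the only critical vertex w leaves w a colour, whatever the colours of its neighbours.
        module Reserve (sz : Strong L₁ L₂ z) (a∈W : Mem W ya) {w} (w∈C : Mem C₀ w) (wk : Weak L₁ L₂ w) (adjs : AllAdj w)
            {r₁ r₂ r₃} (free : ∀ {a} → a ∈ r₁ ∷ r₂ ∷ r₃ ∷ [] → a ∈ L₁ w × a ∉ φ₀ ya ∷ φ₀ z ∷ φ₀ yb ∷ []) (uniq : Unique (r₁ ∷ r₂ ∷ r₃ ∷ [])) where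
          rs : List ℕ
          rs = r₁ ∷ r₂ ∷ r₃ ∷ []

          L₁' : Lists
          L₁' v with v ≟ᶠ z
          ... | yes _ = L₁ v ∖ rs
          ... | no _ = L₁ v

          L₁'⊆ : ∀ {v a} → a ∈ L₁' v → a ∈ L₁ v
          L₁'⊆ {v} m with v ≟ᶠ z
          ... | yes _ = proj₁ (∈-∖⁻ rs m)
          ... | no _ = m

          L₁'-z : ∀ {a} → a ∈ L₁' z → a ∉ rs
          L₁'-z m with z ≟ᶠ z
          ... | yes _ = proj₂ (∈-∖⁻ {L₁ z} rs m)
          ... | no ne = contradiction refl ne

          long-z : 7 ≤ length (L₁ z ∖ rs)
          long-z = +-cancelˡ-≤ 3 _ _ (≤-trans (proj₁ sz) (length-∖ rs (unique₁ (ok base z∈W))))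

          ok' : ∀ {v} → Mem W₀ v → OK (L₁' v) (L₂ v)
          ok' {v} m with v ≟ᶠ z
          ... | no _ = ok base (proj₁ m)
          ... | yes refl = record
            { unique₁ = ∖-unique rs (unique₁ o) ; unique₂ = unique₂ o
            ; nearly⊆ = λ a∈ a∉ b∈ b∉ → nearly⊆ o (proj₁ (∈-∖⁻ rs a∈)) a∉ (proj₁ (∈-∖⁻ rs b∈)) b∉
            ; six = ≤-trans (n≤1+n 6) long-z ; seven = seven o }
            where o = ok base z∈W

          -- The shortened list may make `z` weak, so its neighbour `yc`, which lies outside `W₀`,
          -- is added to the blob.
          weak' : ∀ {v} → Mem W₀ v → Weak L₁' L₂ v → ⟦ v ⟧ ~ (B ∪ ⟦ yc ⟧)
          weak' {v} m wk with v ≟ᶠ z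
          ... | yes refl = ~-⊆ id inj₂ (adj-~ zc)
          ... | no _ = ~-⊆ id inj₁ (weak-B base (proj₁ m) wk)

          base' : Base W₀ L₁' L₂ (B ∪ ⟦ yc ⟧)
          base' = record { ok = ok' ; weak-B = weak' ; conn-B = conn-∪ (conn-B base) conn-⟦⟧ (~-sym cB)
            ; W∉B = λ { m (inj₁ b) → W∉B base (proj₁ m) b ; m (inj₂ refl) → c∉W₀ m } }

          gc' : Gc W L₁ δ₁ hs → Gc W₀ L₁' δ₁ hs
          gc' gc {v} m adjs with v ≟ᶠ z
          ... | no _ = gc (proj₁ m) adjs
          ... | yes refl = big-gc hs (∖-unique rs (unique₁ (ok base z∈W))) (≤-trans (s≤s (*-mono-≤ (head-length head) ≤-refl)) long-z)

          s' : Solvable W₀ L₁' L₂ hs δ₁ δ₂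
          s' = smaller W₀<W base' (head-map (λ p∈ → hs∉W p∈ ∘ proj₁ , λ { (inj₁ b) → proj₂ (head-out head p∈) b ; (inj₂ refl) → hs∉W p∈ c∈W })
            (λ _ → w , proj₁ w∈C , wk) (~-⊆ id inj₁) gc' head)

          s : Solvable W₀ L₁ L₂ hs δ₁ δ₂
          s = weaken id (λ _ (a∈ , av) → L₁'⊆ a∈ , av) (λ _ h → h) s'

          open Finish s

          solve : Solvable W L₁ L₂ hs δ₁ δ₂
          solve = finish gcC
            where
            ψ = Sol.φ₁ s
            -- The old colours of the border are excluded by `free` and the new colour of `z` by
            -- `L₁'`; three reserved colours outnumber the new colours of `ya` and `yb`.
            spare = pick {ys = ψ ya ∷ ψ yb ∷ []} uniq ≤-refl
            c = proj₁ spare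
            c∈ = proj₁ (proj₂ spare)
            c∉ = proj₂ (proj₂ spare)
            a∈W₀ : Mem W₀ ya
            a∈W₀ = a∈W , inj₂ (inj₂ (inj₁ refl))
            avoid : Avoids φ₀ δ₁' border c
            avoid (here refl) = (λ e → proj₂ (free c∈) (here e)) , λ e → c∉ (here (trans e (onto-in W₀ a∈W₀)))
            avoid (there (here refl)) = (λ e → proj₂ (free c∈) (there (here e))) ,
              λ e → L₁'-z (proj₁ (Sol.in₁ s' z∈W₀)) (subst (_∈ rs) (trans e (onto-in W₀ z∈W₀)) c∈)
            avoid (there (there (here refl))) = (λ e → proj₂ (free c∈) (there (there (here e)))) , λ e → c∉ (there (here (trans e (onto-in W₀ b∈W₀))))
            gcC : Gc C L₁ δ₁' border
            gcC {v} m adjs' with weak? v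
            ... | no ¬wk = strong-border m ¬wk
            ... | yes wk' with one-weak w∈C wk adjs m wk' adjs'
            ...   | refl = c , proj₁ (free c∈) , avoid

        solve-strong : Strong L₁ L₂ z → Mem W ya → Solvable W L₁ L₂ hs δ₁ δ₂
        solve-strong sz a∈W with anyᶠ? (λ w → mem? C₀ w ×-dec (weak? w ×-dec (Adj? w ya ×-dec (Adj? w z ×-dec Adj? w yb))))
        ... | no ¬p = finish λ {v} m adjs → strong-border m (λ wk → ¬p (v , m , wk , adjs (here refl) , adjs (there (here refl)) , adjs (there (there (here refl)))))
          where open Finish plain
        ... | yes (w , w∈C , wk , wa , wz , wb) = reserve (three-members free-unique free-length)
          where
          o = ok base (proj₁ w∈C)
          old : List ℕ
          old = φ₀ ya ∷ φ₀ z ∷ φ₀ yb ∷ []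
          free-unique : Unique (L₁ w ∖ old)
          free-unique = ∖-unique old (unique₁ o)
          free-length : 3 ≤ length (L₁ w ∖ old)
          free-length = +-cancelˡ-≤ 3 _ _ (≤-trans (six o) (length-∖ old (unique₁ o)))
          adjs : AllAdj w
          adjs (here refl) = wa
          adjs (there (here refl)) = wz
          adjs (there (there (here refl))) = wb
          reserve : ∃[ a ] ∃[ b ] ∃[ c ] (a ∈ L₁ w ∖ old × b ∈ L₁ w ∖ old × c ∈ L₁ w ∖ old × a ≢ b × a ≢ c × b ≢ c) → Solvable W L₁ L₂ hs δ₁ δ₂
          reserve (a , b , c , a∈' , b∈' , c∈' , ab , ac , bc) = Reserve.solve sz a∈W w∈C wk adjs
            (λ { (here refl) → ∈-∖⁻ old a∈' ; (there (here refl)) → ∈-∖⁻ old b∈' ; (there (there (here refl))) → ∈-∖⁻ old c∈' })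
            ((ab ∷ ac ∷ []) ∷ (bc ∷ []) ∷ [] ∷ [])

        solve : Solvable W L₁ L₂ hs δ₁ δ₂
        solve with weak? z | a∈
        ... | yes wz | _ = solve-weak wz
        ... | no ¬wz | inj₁ m = solve-strong (strong ¬wz) m
        ... | no ¬wz | inj₂ (_ , wz) = contradiction wz ¬wz

    -- The vertex `y₁` may itself be coloured, acting as a third neighbour attached to the blob. It
    -- is then adjacent to `c`, hence to `D₀`, and `z` is weak, which spares reserving colours.
    module CutAt {z y₁ y₂ y₃ c : Fin n} (z∈W : Mem W z) (z₁ : Adj z y₁) (z₂ : Adj z y₂) (z₃ : Adj z y₃)
        (b₁ : ⟦ y₁ ⟧ ~ B) (b₂ : ⟦ y₂ ⟧ ~ B) (b₃ : ⟦ y₃ ⟧ ~ B) (y₁∈ : Mem W y₁ ⊎ (y₁ ∈ hs × Weak L₁ L₂ z × Adj c y₁)) (y₂∈W : Mem W y₂) (y₃∈W : Mem W y₃)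
        (n₁₂ : y₁ ≢ y₂) (n₁₃ : y₁ ≢ y₃) (n₂₃ : y₂ ≢ y₃) (c∈ : c ∈ hs) (c≢y₁ : c ≢ y₁) (near : ∀ {p} → p ∈ hs → p ≡ y₁ ⊎ p ≡ c ⊎ Adj c p) where
      R : FSet n
      R = fset (λ v → (Mem W v ⊎ v ∈ hs) × v ≢ z × v ≢ y₁ × v ≢ y₂ × v ≢ y₃)
        (λ v → (mem? W v ⊎-dec member? _≟ᶠ_ v hs) ×-dec (¬? (v ≟ᶠ z) ×-dec (¬? (v ≟ᶠ y₁) ×-dec (¬? (v ≟ᶠ y₂) ×-dec ¬? (v ≟ᶠ y₃)))))

      hs∈R : ∀ {p} → p ∈ hs → p ≢ y₁ → Mem R p
      hs∈R p∈ ne = inj₂ p∈ , (λ { refl → hs∉W p∈ z∈W }) , ne , (λ { refl → hs∉W p∈ y₂∈W }) , λ { refl → hs∉W p∈ y₃∈W }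

      comp = component R (hs∈R c∈ c≢y₁)
      D₀ : FSet n
      D₀ = proj₁ comp
      D₀-comp : Component R D₀
      D₀-comp = proj₁ (proj₂ comp)
      c∈D : Mem D₀ c
      c∈D = proj₂ (proj₂ comp)

      hs⊆D : ∀ {p} → p ∈ hs → Mem D₀ p ⊎ p ≡ y₁
      hs⊆D {p} p∈ with p ≟ᶠ y₁ | near p∈
      ... | yes e | _ = inj₂ e
      ... | no ne | inj₁ e = contradiction e ne
      ... | no ne | inj₂ (inj₁ refl) = inj₁ c∈D
      ... | no ne | inj₂ (inj₂ adj) = inj₁ (closed D₀-comp c∈D (hs∈R p∈ ne) adj)

      D-closed : ∀ {v w} → Mem D₀ v → Mem W w → Adj v w → w ≢ z → w ≢ y₁ → w ≢ y₂ → w ≢ y₃ → Mem D₀ w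
      D-closed m w∈ adj a b c e = closed D₀-comp m (inj₁ w∈ , a , b , c , e) adj

      D-sub : ∀ {v} → Mem D₀ v → Mem W v ⊎ v ∈ hs
      D-sub m = proj₁ (inside D₀-comp m)
      z∉D : ¬ Mem D₀ z
      z∉D m = proj₁ (proj₂ (inside D₀-comp m)) refl
      ∉D₁ : ¬ Mem D₀ y₁
      ∉D₁ m = proj₁ (proj₂ (proj₂ (inside D₀-comp m))) refl
      ∉D₂ : ¬ Mem D₀ y₂
      ∉D₂ m = proj₁ (proj₂ (proj₂ (proj₂ (inside D₀-comp m)))) refl
      ∉D₃ : ¬ Mem D₀ y₃
      ∉D₃ m = proj₂ (proj₂ (proj₂ (proj₂ (inside D₀-comp m)))) refl

      y₁-place : Mem W y₁ ⊎ (y₁ ∈ hs × Weak L₁ L₂ z)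
      y₁-place = [ inj₁ , (λ (m , w , _) → inj₂ (m , w)) ]′ y₁∈

      y₁∉B : ¬ B (V y₁)
      y₁∉B = [ W∉B base , (λ (m , _) → proj₂ (head-out head m)) ]′ y₁∈

      D∉B : ∀ {v} → Mem D₀ v → ¬ B (V v)
      D∉B m with D-sub m
      ... | inj₁ w = W∉B base w
      ... | inj₂ h = proj₂ (head-out head h)

      -- The three neighbours against z, `D₀` and the blob form a K₃,₃. So the component of the
      -- coloured vertices reaches at most two of them.
      not-all : Att D₀ y₁ → Att D₀ y₂ → Att D₀ y₃ → ⊥
      not-all a₁ a₂ a₃ = kuratowski-component D₀ (conn-B base) (conn D₀-comp) z₁ z₂ z₃ b₁ b₂ b₃ a₁ a₂ a₃ n₁₂ n₁₃ n₂₃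
        (W∉B base z∈W) y₁∉B (W∉B base y₂∈W) (W∉B base y₃∈W) z∉D ∉D₁ ∉D₂ ∉D₃ D∉B

      fork₁₂ : ¬ Att D₀ y₃ → Fork z y₁ y₂ y₃ D₀
      fork₁₂ ¬c = record { z∈W = z∈W ; za = z₁ ; zb = z₂ ; zc = z₃ ; aB = b₁ ; bB = b₂ ; cB = b₃ ; a∈ = y₁-place ; b∈W = y₂∈W ; c∈W = y₃∈W
        ; a≢b = n₁₂ ; a≢c = n₁₃ ; b≢c = n₂₃ ; D-conn = conn D₀-comp ; D-sub = D-sub ; z∉D = z∉D ; a∉D = ∉D₁ ; b∉D = ∉D₂ ; c∉D = ∉D₃
        ; D-closed = D-closed ; hs-near = hs⊆D ; ¬c = ¬c }

      fork₁₃ : ¬ Att D₀ y₂ → Fork z y₁ y₃ y₂ D₀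
      fork₁₃ ¬c = record { z∈W = z∈W ; za = z₁ ; zb = z₃ ; zc = z₂ ; aB = b₁ ; bB = b₃ ; cB = b₂ ; a∈ = y₁-place ; b∈W = y₃∈W ; c∈W = y₂∈W
        ; a≢b = n₁₃ ; a≢c = n₁₂ ; b≢c = ≢-sym n₂₃ ; D-conn = conn D₀-comp ; D-sub = D-sub ; z∉D = z∉D ; a∉D = ∉D₁ ; b∉D = ∉D₃ ; c∉D = ∉D₂
        ; D-closed = λ m w adj p q r s → D-closed m w adj p q s r ; hs-near = hs⊆D ; ¬c = ¬c }

      y₁∈W : ¬ Att D₀ y₁ → Mem W y₁
      y₁∈W ¬a = [ id , (λ (_ , _ , adj) → contradiction (c , c∈D , adj) ¬a) ]′ y₁∈

      hs⊆D' : ∀ {y} → ¬ Att D₀ y₁ → ∀ {p} → p ∈ hs → Mem D₀ p ⊎ p ≡ y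
      hs⊆D' ¬a p∈ with hs⊆D p∈
      ... | inj₁ m = inj₁ m
      ... | inj₂ refl = contradiction (y₁∈W ¬a) (hs∉W p∈)

      fork₂₃ : ¬ Att D₀ y₁ → Fork z y₂ y₃ y₁ D₀
      fork₂₃ ¬c = record { z∈W = z∈W ; za = z₂ ; zb = z₃ ; zc = z₁ ; aB = b₂ ; bB = b₃ ; cB = b₁ ; a∈ = inj₁ y₂∈W ; b∈W = y₃∈W ; c∈W = y₁∈W ¬c
        ; a≢b = n₂₃ ; a≢c = ≢-sym n₁₂ ; b≢c = ≢-sym n₁₃ ; D-conn = conn D₀-comp ; D-sub = D-sub ; z∉D = z∉D ; a∉D = ∉D₂ ; b∉D = ∉D₃ ; c∉D = ∉D₁
        ; D-closed = λ m w adj p q r s → D-closed m w adj p s q r ; hs-near = hs⊆D' ¬c ; ¬c = ¬c }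

      fork₃₂ : ¬ Att D₀ y₁ → Fork z y₃ y₂ y₁ D₀
      fork₃₂ ¬c = record { z∈W = z∈W ; za = z₃ ; zb = z₂ ; zc = z₁ ; aB = b₃ ; bB = b₂ ; cB = b₁ ; a∈ = inj₁ y₃∈W ; b∈W = y₂∈W ; c∈W = y₁∈W ¬c
        ; a≢b = ≢-sym n₂₃ ; a≢c = ≢-sym n₁₃ ; b≢c = ≢-sym n₁₂ ; D-conn = conn D₀-comp ; D-sub = D-sub ; z∉D = z∉D ; a∉D = ∉D₃ ; b∉D = ∉D₂ ; c∉D = ∉D₁
        ; D-closed = λ m w adj p q r s → D-closed m w adj p s r q ; hs-near = hs⊆D' ¬c ; ¬c = ¬c }

      solve : Solvable W L₁ L₂ hs δ₁ δ₂
      solve = go (Att? D₀ y₁) (Att? D₀ y₂) (Att? D₀ y₃)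
        where
        go : Dec (Att D₀ y₁) → Dec (Att D₀ y₂) → Dec (Att D₀ y₃) → Solvable W L₁ L₂ hs δ₁ δ₂
        go (yes a₁) (yes a₂) (yes a₃) = ⊥-elim (not-all a₁ a₂ a₃)
        go (yes a₁) (yes a₂) (no a₃) = CutFork.Three.solve (fork₁₂ a₃) a₁ a₂
        go (yes a₁) (no a₂) (yes a₃) = CutFork.Three.solve (fork₁₃ a₂) a₁ a₃
        go (no a₁) (yes a₂) (yes a₃) = CutFork.Three.solve (fork₂₃ a₁) a₂ a₃
        go _ (no a₂) (no a₃) = CutFork.Two.solve (fork₁₂ a₃) a₂
        go (no a₁) (yes a₂) (no a₃) = CutFork.Two.solve (fork₂₃ a₁) a₃
        go (no a₁) (no a₂) (yes a₃) = CutFork.Two.solve (fork₃₂ a₁) a₂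

-- Deleting the weak vertices

module Induct {n : ℕ} (M : Map n) (genus0 : Map.Genus0 M) (φ₀ : Fin n → ℕ) where
  open Map M hiding (φ)
  open Minors M genus0
  open Cutting M genus0 φ₀ public

  triple : (Fin n → ℕ) → (Fin n → ℕ) → Fin n → List ℕ
  triple δ₁ δ₂ p = φ₀ p ∷ δ₁ p ∷ δ₂ p ∷ []

  conn-star : ∀ {B : Node → Set} {U : Fin n → Set} → Conn B → (∀ {u} → U u → ⟦ u ⟧ ~ B) → Conn (B ∪ lift U)
  conn-star cB toB μ ν (inj₁ a) (inj₁ b) = widen inj₁ (cB μ ν a b)
  conn-star cB toB μ (V v) (inj₁ a) (inj₂ m) with toB m
  ... | link s e b = reverseʷ (move′ s e refl (inj₂ m) (widen inj₁ (cB _ _ b a)))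
  conn-star cB toB (V u) ν (inj₂ m) (inj₁ b) with toB m
  ... | link s e a = move′ s e refl (inj₂ m) (widen inj₁ (cB _ _ a b))
  conn-star {B} {U} cB toB (V u) (V v) (inj₂ m) (inj₂ m') with toB m | toB m'
  ... | link s e a | link s' e' b = move′ s e refl (inj₂ m) (widen inj₁ (cB _ _ a b) ++ʷ reverseʷ (move′ s' e' refl (inj₂ m') (stop (inj₁ b))))

  module Deletion (W : FSet n) (L₁ L₂ : Lists) (B : Node → Set) (hs : List (Fin n)) (δ₁ δ₂ : Fin n → ℕ)
      (base : Base W L₁ L₂ B) (head : Head W L₁ L₂ B δ₁ hs) (IH : Induction (4 * ∣ W ∣ + length hs)) where
    open Solve W L₁ L₂ B hs δ₁ δ₂ base head IH public

    U : FSet n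
    U = fset (λ v → Mem W v × Weak L₁ L₂ v) (λ v → mem? W v ×-dec weak? v)

    nbrs : Fin n → List (Fin n)
    nbrs v = filter (Adj? v) (elems U)

    nbrs-unique : ∀ v → Unique (nbrs v)
    nbrs-unique v = Unique.filter⁺ (Adj? v) (elems-unique U)

    ∈-nbrs⁻ : ∀ {v u} → u ∈ nbrs v → Mem U u × Adj v u
    ∈-nbrs⁻ {v} m = let u∈ , adj = ∈-filter⁻ (Adj? v) {xs = elems U} m in ∈-elems⁻ U u∈ , adj

    ∈-nbrs⁺ : ∀ {v u} → Mem U u → Adj v u → u ∈ nbrs v
    ∈-nbrs⁺ {v} m adj = ∈-filter⁺ (Adj? v) (∈-elems⁺ U m) adj

    forbidden : Fin n → List ℕ
    forbidden u = flatten (only-adj u (triple δ₁ δ₂)) hs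

    -- All weak vertices are deleted; each keeps one new colour in both rounds.  In the second round they go first,
    -- so that a neighbour left in the scene loses two colours in the first round and only one in the second.
    module Delete {u₀} (u₀∈ : Mem U u₀) (few : ∀ {v} → Mem W v → length (nbrs v) ≤ 2)
        (cheap : ∀ {u} → Mem U u → length (forbidden u) + length (nbrs u) ≤ 4)
        (no-hub : 3 ≤ length hs → ∀ {v} → Mem W v → Strong L₁ L₂ v → ¬ (∀ {p} → p ∈ hs → Adj v p)) where
      common : Fin n → List ℕ
      common u = filter (λ a → member? ℕ._≟_ a (L₂ u)) (L₁ u)

      A : Fin n → List ℕ
      A u = common u ∖ forbidden u

      common-unique : ∀ {u} → Mem U u → Unique (common u)
      common-unique {u} m = Unique.filter⁺ (λ a → member? ℕ._≟_ a (L₂ u)) (unique₁ (ok base (proj₁ m)))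

      A-length : ∀ {u} → Mem U u → length (nbrs u) < length (A u)
      -- Of at least six colours in `L₁ u` at most one is missing from `L₂ u`; the remaining five
      -- exceed the four that `cheap` allows to be lost.
      A-length {u} m = +-cancelˡ-≤ (length (forbidden u)) _ _ (≤-trans (≤-reflexive (+-suc _ _)) (≤-trans (s≤s (cheap m))
        (≤-trans (s≤s⁻¹ (≤-trans (six o) (length-filter-but-one (λ a → member? ℕ._≟_ a (L₂ u)) (unique₁ o) (λ a b x y → nearly⊆ o a x b y))))
          (length-∖ (forbidden u) (common-unique m)))))
        where o = ok base (proj₁ m)

      private
        g = greedy A (elems U) (elems-unique U) (λ {u} m → ∖-unique (forbidden u) (common-unique (∈-elems⁻ U m))) (λ m → A-length (∈-elems⁻ U m))

      c r : Fin n → ℕ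
      c = proj₁ g
      r = proj₁ (proj₂ g)

      c∈A : ∀ {u} → Mem U u → c u ∈ A u
      c∈A m = proj₁ (proj₂ (proj₂ g)) (∈-elems⁺ U m)

      c∈common : ∀ {u} → Mem U u → c u ∈ L₁ u × c u ∈ L₂ u
      c∈common {u} m = ∈-filter⁻ (λ a → member? ℕ._≟_ a (L₂ u)) {xs = L₁ u} (proj₁ (∈-∖⁻ (forbidden u) (c∈A m)))

      c-allowed : ∀ {u} → Mem U u → ∀ {p a} → p ∈ hs → Adj u p → a ∈ triple δ₁ δ₂ p → c u ≢ a
      c-allowed {u} m p∈ adj a∈ refl = proj₂ (∈-∖⁻ {common u} (forbidden u) (c∈A m)) (flatten-∈ _ p∈ (only-adj-∈ {f = triple δ₁ δ₂} adj a∈))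

      solved : Solvable U L₁ L₂ hs δ₁ δ₂
      solved = record
        { φ₁ = c ; φ₂ = c ; r₁ = r ; r₂ = r
        ; in₁ = λ m → proj₁ (c∈common m) , λ p∈ adj → c-allowed m p∈ adj (here refl) , c-allowed m p∈ adj (there (here refl))
        ; in₂ = λ m → proj₂ (c∈common m) , λ p∈ adj → c-allowed m p∈ adj (there (here refl)) , c-allowed m p∈ adj (there (there (here refl)))
        ; proper₁ = proper ; proper₂ = proper
        ; order₁ = λ m m' → proj₂ (proj₂ (proj₂ (proj₂ g))) (∈-elems⁺ U m) (∈-elems⁺ U m')
        ; order₂ = λ m m' adj _ → proper m m' adj }
        where
        proper : ∀ {u v} → Mem U u → Mem U v → Adj u v → c u ≢ c v
        proper m m' = proj₁ (proj₂ (proj₂ (proj₂ g))) (∈-elems⁺ U m) (∈-elems⁺ U m')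

      X : FSet n
      X = fset (λ v → Mem W v × Strong L₁ L₂ v) (λ v → mem? W v ×-dec Strong? L₁ L₂ v)

      gone₁ gone₂ : Fin n → List ℕ
      gone₁ v = map φ₀ (nbrs v) ++ map c (nbrs v)
      gone₂ v = map c (nbrs v)

      L₁' L₂' : Lists
      L₁' v = L₁ v ∖ gone₁ v
      L₂' v = L₂ v ∖ gone₂ v

      gone₁-length : ∀ {v} → Mem X v → length (gone₁ v) ≤ 4
      gone₁-length {v} m = ≤-trans (≤-reflexive (trans (length-++ (map φ₀ (nbrs v))) (cong₂ _+_ (length-map φ₀ (nbrs v)) (length-map c (nbrs v)))))
        (+-mono-≤ (few (proj₁ m)) (few (proj₁ m)))

      gone₂-length : ∀ {v} → Mem X v → length (gone₂ v) ≤ 2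
      gone₂-length {v} m = ≤-trans (≤-reflexive (length-map c (nbrs v))) (few (proj₁ m))

      weak-nbr : ∀ {v} → Mem X v → Weak L₁' L₂' v → ∃[ u ] (Mem U u × Adj v u)
      weak-nbr {v} m wk = by (nbrs v) refl
        where
        o = ok base (proj₁ m)
        by : ∀ N → nbrs v ≡ N → ∃[ u ] (Mem U u × Adj v u)
        by (u ∷ _) e = u , ∈-nbrs⁻ (subst (u ∈_) (sym e) (here refl))
        by [] e = contradiction
          ( ≤-trans (proj₁ (proj₂ m)) (≤-trans (length-∖ (gone₁ v) (unique₁ o)) (+-monoˡ-≤ _ (≤-reflexive (cong (λ N → length (map φ₀ N ++ map c N)) e))))
          , ≤-trans (proj₂ (proj₂ m)) (≤-trans (length-∖ (gone₂ v) (unique₂ o)) (+-monoˡ-≤ _ (≤-reflexive (cong (λ N → length (map c N)) e))))) wk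

      B' : Node → Set
      B' = B ∪ lift (Mem U)

      U~B : ∀ {u} → Mem U u → ⟦ u ⟧ ~ B
      U~B (m , wk) = weak-B base m wk

      ok' : ∀ {v} → Mem X v → OK (L₁' v) (L₂' v)
      ok' {v} m = remove-ok (ok base (proj₁ m)) {4} {2} (gone₁ v) (gone₂ v) (∈-++⁺ʳ (map φ₀ (nbrs v))) (gone₁-length m) (gone₂-length m)
        (proj₁ (proj₂ m)) (proj₂ (proj₂ m))

      base' : Base X L₁' L₂' B'
      base' = record
        { ok = ok'
        ; weak-B = λ m wk → let u , u∈ , adj = weak-nbr m wk in ~-⊆ id inj₂ (~-lift adj u∈)
        ; conn-B = conn-star (conn-B base) U~B
        ; W∉B = λ { m (inj₁ b) → W∉B base (proj₁ m) b ; (_ , s) (inj₂ (_ , wk)) → wk s } }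
        where
        ~-lift : ∀ {v u} → Adj v u → Mem U u → ⟦ v ⟧ ~ lift (Mem U)
        ~-lift (x , t , h) m = link (E x) (cong V t) (subst (Mem U) (sym h) m)

      -- Two coloured vertices block at most four of six colours, and with three `no-hub` leaves no
      -- vertex adjacent to all.
      gc' : Gc X L₁' δ₁ hs
      gc' m adjs with 3 ≤? length hs
      ... | yes three≤ = ⊥-elim (no-hub three≤ (proj₁ m) (proj₂ m) adjs)
      ... | no ¬three≤ = big-gc hs (unique₁ (ok' m)) (≤-trans (s≤s (*-mono-≤ (s≤s⁻¹ (≰⇒> ¬three≤)) ≤-refl)) (≤-trans (n≤1+n 5) (six (ok' m))))

      head' : Head X L₁' L₂' B' δ₁ hs
      head' = head-map (λ p∈ → hs∉W p∈ ∘ proj₁ , λ { (inj₁ b) → proj₂ (head-out head p∈) b ; (inj₂ (m , _)) → hs∉W p∈ m })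
        -- New weak vertices may appear in `X`. That the ends of the path reach the blob is known
        -- only if `W` has a weak vertex, and `u₀` is one.
        (λ _ → u₀ , u₀∈) (~-⊆ id inj₁) (λ _ → gc') head

      rest : Solvable X L₁' L₂' hs δ₁ δ₂
      rest = smaller (size-< X W proj₁ (proj₁ u₀∈) (λ (_ , s) → proj₂ u₀∈ s)) base' head'

      avoid₁ : ∀ {v u a} → a ∈ L₁' v → Mem U u → Adj v u → a ≢ φ₀ u × a ≢ c u
      avoid₁ {v} a∈ m adj = (λ { refl → ∉ (∈-++⁺ˡ (∈-map⁺ φ₀ (∈-nbrs⁺ m adj))) }) , λ { refl → ∉ (∈-++⁺ʳ (map φ₀ (nbrs v)) (∈-map⁺ c (∈-nbrs⁺ m adj))) }
        where ∉ = proj₂ (∈-∖⁻ {L₁ v} (gone₁ v) a∈)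

      solve : Solvable W L₁ L₂ hs δ₁ δ₂
      solve = Join.opposite-order W U X (λ m ¬u → m , strong (λ wk → ¬u (m , wk))) solved rest
        (λ {v} _ (a∈ , av) → proj₁ (∈-∖⁻ (gone₁ v) a∈) , av)
        (λ {v} _ (a∈ , av) → proj₁ (∈-∖⁻ (gone₂ v) a∈) , av)
        (λ _ (a∈ , _) m adj → avoid₁ a∈ m adj)
        (λ { {v = v} _ (a∈ , _) m adj refl → proj₂ (∈-∖⁻ {L₂ v} (gone₂ v) a∈) (∈-map⁺ c (∈-nbrs⁺ m adj)) })
        (λ (_ , s) (_ , wk) → wk s)
        (λ _ (a∈ , _) m adj → proj₂ (avoid₁ a∈ m adj))

  module ByHead (W : FSet n) (L₁ L₂ : Lists) (B : Node → Set) (δ₁ δ₂ : Fin n → ℕ) (base : Base W L₁ L₂ B) where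

    absorb-head : ∀ q hs → (∀ {v} → Mem W v → Strong L₁ L₂ v) → ¬ Mem W q → length hs ≤ 3 → Induction (4 * ∣ W ∣ + suc (length hs)) →
      (∀ {L₁' L₂'} → Gc W L₁' δ₁ hs → Head W L₁' L₂' ⟦ q ⟧ δ₁ hs) → Solvable W L₁ L₂ (q ∷ hs) δ₁ δ₂
    absorb-head q hs str q∉ le IH h = A.absorb (IH W A.L₁' A.L₂' ⟦ q ⟧ hs δ₁ δ₂ A.base' (h (A.gc' {hs} le)) (≤-reflexive (sym (+-suc (4 * ∣ W ∣) (length hs)))))
      where module A = Absorb W L₁ L₂ q δ₁ δ₂ (ok base) str q∉

    forbidden-≤ : ∀ {p hs u} j k → length (only-adj u (triple δ₁ δ₂) p) ≤ j → length (flatten (only-adj u (triple δ₁ δ₂)) hs) ≤ k →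
      length (flatten (only-adj u (triple δ₁ δ₂)) (p ∷ hs)) ≤ j + k
    forbidden-≤ {p} {hs} {u} j k h h' = ≤-trans (≤-reflexive (length-++ (only-adj u (triple δ₁ δ₂) p))) (+-mono-≤ h h')

    adj-≤3 : ∀ u p → length (only-adj u (triple δ₁ δ₂) p) ≤ 3
    adj-≤3 u p = only-adj-≤ u (triple δ₁ δ₂) 3 (λ _ → ≤-refl) p

    module Shape (hs : List (Fin n)) (head : Head W L₁ L₂ B δ₁ hs) (IH : Induction (4 * ∣ W ∣ + length hs)) where
      open Deletion W L₁ L₂ B hs δ₁ δ₂ base head IH public
      open CutScene W L₁ L₂ B hs δ₁ δ₂ base head IH using (module CutAt)

      U~B : ∀ {u} → Mem U u → ⟦ u ⟧ ~ B
      U~B (m , wk) = weak-B base m wk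

      wide? : Dec (∃[ z ] (Mem W z × 3 ≤ length (nbrs z)))
      wide? = anyᶠ? (λ z → mem? W z ×-dec (3 ≤? length (nbrs z)))

      cut-wide : ∀ {c} → c ∈ hs → (∀ {p} → p ∈ hs → p ≡ c ⊎ Adj c p) → ∃[ z ] (Mem W z × 3 ≤ length (nbrs z)) → Solvable W L₁ L₂ hs δ₁ δ₂
      cut-wide {c} c∈ near (z , z∈ , len) = go (three-members (nbrs-unique z) len)
        where
        go : ∃[ y₁ ] ∃[ y₂ ] ∃[ y₃ ] (y₁ ∈ nbrs z × y₂ ∈ nbrs z × y₃ ∈ nbrs z × y₁ ≢ y₂ × y₁ ≢ y₃ × y₂ ≢ y₃) → Solvable W L₁ L₂ hs δ₁ δ₂
        go (y₁ , y₂ , y₃ , m₁ , m₂ , m₃ , n₁₂ , n₁₃ , n₂₃) =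
          let u₁ , a₁ = ∈-nbrs⁻ m₁ ; u₂ , a₂ = ∈-nbrs⁻ m₂ ; u₃ , a₃ = ∈-nbrs⁻ m₃ in
          CutAt.solve z∈ a₁ a₂ a₃ (U~B u₁) (U~B u₂) (U~B u₃) (inj₁ (proj₁ u₁)) (proj₁ u₂) (proj₁ u₃) n₁₂ n₁₃ n₂₃ c∈
            (λ { refl → hs∉W c∈ (proj₁ u₁) }) (λ p∈ → inj₂ (near p∈))

      -- The coloured vertex `p` is attached to the blob and counts as the third such neighbour of
      -- `u`.
      cut-anchor : ∀ {c p} → c ∈ hs → p ∈ hs → Adj c p → ⟦ p ⟧ ~ B → (∀ {x} → x ∈ hs → x ≡ p ⊎ x ≡ c ⊎ Adj c x) →
        ∃[ u ] (Mem U u × Adj u p × 2 ≤ length (nbrs u)) → Solvable W L₁ L₂ hs δ₁ δ₂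
      cut-anchor {c} {p} c∈ p∈ cp pB near (u , u∈ , up , len) = go (two-members (nbrs-unique u) len)
        where
        go : ∃[ y₂ ] ∃[ y₃ ] (y₂ ∈ nbrs u × y₃ ∈ nbrs u × y₂ ≢ y₃) → Solvable W L₁ L₂ hs δ₁ δ₂
        go (y₂ , y₃ , m₂ , m₃ , n₂₃) = let u₂ , a₂ = ∈-nbrs⁻ m₂ ; u₃ , a₃ = ∈-nbrs⁻ m₃ in
          CutAt.solve (proj₁ u∈) up a₂ a₃ pB (U~B u₂) (U~B u₃) (inj₂ (p∈ , proj₂ u∈ , cp)) (proj₁ u₂) (proj₁ u₃)
            (λ { refl → hs∉W p∈ (proj₁ u₂) }) (λ { refl → hs∉W p∈ (proj₁ u₃) }) n₂₃ c∈ (Adj-≢ cp) near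

      weak-at? : ∀ p → Dec (∃[ u ] (Mem U u × Adj u p))
      weak-at? p = anyᶠ? (λ u → mem? U u ×-dec Adj? u p)

      anchor? : ∀ p → Dec (∃[ u ] (Mem U u × Adj u p × 2 ≤ length (nbrs u)))
      anchor? p = anyᶠ? (λ u → mem? U u ×-dec (Adj? u p ×-dec (2 ≤? length (nbrs u))))

      narrow : ¬ (∃[ z ] (Mem W z × 3 ≤ length (nbrs z))) → ∀ {v} → Mem W v → length (nbrs v) ≤ 2
      narrow h m = s≤s⁻¹ (≰⇒> (λ len → h (_ , m , len)))

      all-strong : ¬ HasWeak W L₁ L₂ → ∀ {v} → Mem W v → Strong L₁ L₂ v
      all-strong h m = strong (λ wk → h (_ , m , wk))

      anchored : ∀ {p u} → ¬ (∃[ u ] (Mem U u × Adj u p × 2 ≤ length (nbrs u))) → Mem U u → Adj u p → length (nbrs u) ≤ 1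
      anchored h m adj = s≤s⁻¹ (≰⇒> (λ len → h (_ , m , adj , len)))

    step-one : ∀ {p} → Out W B p → Induction (4 * ∣ W ∣ + 1) → Solvable W L₁ L₂ (p ∷ []) δ₁ δ₂
    step-one {p} out IH = go (hasWeak? W) (weak-at? p) wide?
      where
      open Shape (p ∷ []) (one out) IH
      go : Dec (HasWeak W L₁ L₂) → Dec (∃[ u ] (Mem U u × Adj u p)) → Dec (∃[ z ] (Mem W z × 3 ≤ length (nbrs z))) → Solvable W L₁ L₂ (p ∷ []) δ₁ δ₂
      go (no h) _ _ = absorb-head p [] (all-strong h) (proj₁ out) z≤n IH (λ _ → none)
      go (yes _) (yes (u , (m , wk) , adj)) _ = solve-one W L₁ L₂ B δ₁ δ₂ base out IH m wk adj
      go (yes _) (no _) (yes w) = cut-wide (here refl) (λ { (here e) → inj₁ e }) w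
      go (yes (u₀ , u₀∈)) (no h) (no h') = Delete.solve u₀∈ (narrow h')
        (λ {u} m → +-mono-≤ (forbidden-≤ {hs = []} 0 0 (only-adj-no (λ adj → h (_ , m , adj))) z≤n) (≤-trans (narrow h' (proj₁ m)) (m≤m+n 2 2)))
        λ { (s≤s ()) }

    step-two : ∀ {p q} (out-p : Out W B p) (out-q : Out W B q) (pq : Adj p q) (pB : HasWeak W L₁ L₂ → ⟦ p ⟧ ~ B) → Induction (4 * ∣ W ∣ + 2) →
      Solvable W L₁ L₂ (p ∷ q ∷ []) δ₁ δ₂
    step-two {p} {q} out-p out-q pq pB IH = go (hasWeak? W) (weak-at? q) (anchor? p) wide?
      where
      open Shape (p ∷ q ∷ []) (two out-p out-q pq pB) IH
      go : Dec (HasWeak W L₁ L₂) → Dec (∃[ u ] (Mem U u × Adj u q)) → Dec (∃[ u ] (Mem U u × Adj u p × 2 ≤ length (nbrs u))) →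
        Dec (∃[ z ] (Mem W z × 3 ≤ length (nbrs z))) → Solvable W L₁ L₂ (p ∷ q ∷ []) δ₁ δ₂
      go (no h) _ _ _ = absorb-head p (q ∷ []) (all-strong h) (proj₁ out-p) (s≤s z≤n) IH (λ _ → one (proj₁ out-q , ⟦⟧-∌ (≢-sym (Adj-≢ pq))))
      go (yes _) (yes (u , (m , wk) , adj)) _ _ = SolveTwo.solve W L₁ L₂ B δ₁ δ₂ base out-p out-q pq pB IH m wk adj
      go (yes w) (no _) (yes a) _ = cut-anchor (there (here refl)) (here refl) (Adj-sym pq) (pB w) (λ { (here e) → inj₁ e ; (there (here e)) → inj₂ (inj₁ e) }) a
      go (yes _) (no _) (no _) (yes w) = cut-wide (there (here refl)) (λ { (here refl) → inj₂ (Adj-sym pq) ; (there (here e)) → inj₁ e }) w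
      go (yes (u₀ , u₀∈)) (no hq) (no hp) (no h') = Delete.solve u₀∈ (narrow h') (λ {u} m → cheap m (Adj? u p)) λ { (s≤s (s≤s ())) }
        where
        at-q : ∀ {u} → Mem U u → length (flatten (only-adj u (triple δ₁ δ₂)) (q ∷ [])) ≤ 0
        at-q m = forbidden-≤ {hs = []} 0 0 (only-adj-no (λ adj → hq (_ , m , adj))) z≤n
        cheap : ∀ {u} → Mem U u → Dec (Adj u p) → length (forbidden u) + length (nbrs u) ≤ 4
        -- Three colours are lost to the coloured neighbour `p` and one to the only possible weak
        -- neighbour.
        cheap {u} m (yes adj) = +-mono-≤ (forbidden-≤ {hs = q ∷ []} 3 0 (adj-≤3 u p) (at-q m)) (anchored hp m adj)
        cheap {u} m (no ¬adj) = +-mono-≤ (forbidden-≤ {hs = q ∷ []} 0 0 (only-adj-no ¬adj) (at-q m)) (≤-trans (narrow h' (proj₁ m)) (m≤m+n 2 2))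

    step-three : ∀ {p q r} (out-p : Out W B p) (out-q : Out W B q) (out-r : Out W B r) (pq : Adj p q) (qr : Adj q r) (p≢r : p ≢ r)
      (pB : HasWeak W L₁ L₂ → ⟦ p ⟧ ~ B) (rB : HasWeak W L₁ L₂ → ⟦ r ⟧ ~ B) (gc : Gc W L₁ δ₁ (p ∷ q ∷ r ∷ [])) → Induction (4 * ∣ W ∣ + 3) →
      Solvable W L₁ L₂ (p ∷ q ∷ r ∷ []) δ₁ δ₂
    step-three {p} {q} {r} out-p out-q out-r pq qr p≢r pB rB gc IH =
      go (hasWeak? W)
      where
      open Shape (p ∷ q ∷ r ∷ []) (three out-p out-q out-r pq qr p≢r pB rB gc) IH
      hs : List (Fin n)
      hs = p ∷ q ∷ r ∷ []
      hub? : Dec (∃[ x ] (Mem W x × Strong L₁ L₂ x × Adj x p × Adj x q × Adj x r))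
      hub? = anyᶠ? (λ x → mem? W x ×-dec (Strong? L₁ L₂ x ×-dec (Adj? x p ×-dec (Adj? x q ×-dec Adj? x r))))
      closing? : Dec (∃[ u ] (Mem U u × Adj u p × Adj u r))
      closing? = anyᶠ? (λ u → mem? U u ×-dec (Adj? u p ×-dec Adj? u r))
      module _ (w : HasWeak W L₁ L₂) where
        module S = SolveThree W L₁ L₂ B δ₁ δ₂ base out-p out-q out-r pq qr p≢r (pB w) (rB w) gc IH
        near-p : ∀ {x} → x ∈ hs → x ≡ p ⊎ x ≡ q ⊎ Adj q x
        near-p (here e) = inj₁ e
        near-p (there (here e)) = inj₂ (inj₁ e)
        near-p (there (there (here refl))) = inj₂ (inj₂ qr)
        near-r : ∀ {x} → x ∈ hs → x ≡ r ⊎ x ≡ q ⊎ Adj q x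
        near-r (here refl) = inj₂ (inj₂ (Adj-sym pq))
        near-r (there (here e)) = inj₂ (inj₁ e)
        near-r (there (there (here e))) = inj₁ e
        near-q : ∀ {x} → x ∈ hs → x ≡ q ⊎ Adj q x
        near-q (here refl) = inj₂ (Adj-sym pq)
        near-q (there (here e)) = inj₁ e
        near-q (there (there (here refl))) = inj₂ qr
        weak-case : Dec (∃[ u ] (Mem U u × Adj u q)) → Dec (∃[ x ] (Mem W x × Strong L₁ L₂ x × Adj x p × Adj x q × Adj x r)) →
          Dec (∃[ u ] (Mem U u × Adj u p × Adj u r)) → Dec (∃[ u ] (Mem U u × Adj u p × 2 ≤ length (nbrs u))) →
          Dec (∃[ u ] (Mem U u × Adj u r × 2 ≤ length (nbrs u))) → Dec (∃[ z ] (Mem W z × 3 ≤ length (nbrs z))) → Solvable W L₁ L₂ hs δ₁ δ₂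
        weak-case (yes (u , (m , wk) , adj)) _ _ _ _ _ = S.Middle.solve m wk adj
        weak-case (no _) (yes (x , m , s , xp , xq , xr)) _ _ _ _ = S.Hub.solve m s xp xq xr
        weak-case (no h) (no _) (yes (u , (m , wk) , up , ur)) _ _ _ = S.Closing.solve m wk up ur (λ uq → h (u , (m , wk) , uq))
        weak-case (no _) (no _) (no _) (yes a) _ _ = cut-anchor (there (here refl)) (here refl) (Adj-sym pq) (pB w) near-p a
        weak-case (no _) (no _) (no _) (no _) (yes a) _ = cut-anchor (there (here refl)) (there (there (here refl))) qr (rB w) near-r a
        weak-case (no _) (no _) (no _) (no _) (no _) (yes z) = cut-wide (there (here refl)) near-q z
        weak-case (no hq) (no hub) (no cl) (no hp) (no hr) (no h') = Delete.solve (proj₂ w) (narrow h') (λ {u} m → cheap m (Adj? u p) (Adj? u r))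
          λ _ m s adjs → hub (_ , m , s , adjs (here refl) , adjs (there (here refl)) , adjs (there (there (here refl))))
          where
          cost : ∀ {u} j k → Mem U u → length (only-adj u (triple δ₁ δ₂) p) ≤ j → length (only-adj u (triple δ₁ δ₂) r) ≤ k → length (forbidden u) ≤ j + (0 + (k + 0))
          cost j k m hj hk = forbidden-≤ {hs = q ∷ r ∷ []} j (0 + (k + 0)) hj (forbidden-≤ {hs = r ∷ []} 0 (k + 0) (only-adj-no (λ adj → hq (_ , m , adj)))
            (forbidden-≤ {hs = []} k 0 hk z≤n))
          cheap : ∀ {u} → Mem U u → Dec (Adj u p) → Dec (Adj u r) → length (forbidden u) + length (nbrs u) ≤ 4
          -- Two coloured neighbours could forbid six colours, more than the budget; such a vertex
          -- was handled by `Closing`.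
          cheap m (yes up) (yes ur) = contradiction (_ , m , up , ur) cl
          cheap {u} m (yes up) (no ¬ur) = +-mono-≤ (cost 3 0 m (adj-≤3 u p) (only-adj-no ¬ur)) (anchored hp m up)
          cheap {u} m (no ¬up) (yes ur) = +-mono-≤ (cost 0 3 m (only-adj-no ¬up) (adj-≤3 u r)) (anchored hr m ur)
          cheap {u} m (no ¬up) (no ¬ur) = +-mono-≤ (cost 0 0 m (only-adj-no ¬up) (only-adj-no ¬ur)) (≤-trans (narrow h' (proj₁ m)) (m≤m+n 2 2))
      go : Dec (HasWeak W L₁ L₂) → Solvable W L₁ L₂ hs δ₁ δ₂
      go (no h) = absorb-head p (q ∷ r ∷ []) (all-strong h) (proj₁ out-p) (s≤s (s≤s z≤n)) IH
        λ _ → two (proj₁ out-q , ⟦⟧-∌ (≢-sym (Adj-≢ pq))) (proj₁ out-r , ⟦⟧-∌ (≢-sym p≢r)) qr (λ _ → adj-~ (Adj-sym pq))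
      go (yes w) = weak-case w (weak-at? q) hub? closing? (anchor? p) (anchor? r) wide?

  solvable : ∀ m → Induction m
  solvable (suc m) W L₁ L₂ B hs δ₁ δ₂ base head lt with anyᶠ? (mem? W)
  ... | no ¬any = empty-sol (λ v m → ¬any (v , m))
  ... | yes (v , v∈) = by head lt
    where
    open ByHead W L₁ L₂ B δ₁ δ₂ base
    below : ∀ {k} → k ≤ m → Induction k
    below le W' L₁' L₂' B' hs' δ₁' δ₂' base' head' lt' = solvable m W' L₁' L₂' B' hs' δ₁' δ₂' base' head' (≤-trans lt' le)
    by : ∀ {hs} → Head W L₁ L₂ B δ₁ hs → 4 * ∣ W ∣ + length hs < suc m → Solvable W L₁ L₂ hs δ₁ δ₂
    by none (s≤s le) = solve-none W L₁ L₂ B δ₁ δ₂ base (below le) v∈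
    by (one o) (s≤s le) = step-one o (below le)
    by (two o o' pq pB) (s≤s le) = step-two o o' pq pB (below le)
    by (three o o' o'' pq qr ne pB rB gc) (s≤s le) = step-three o o' o'' pq qr ne pB rB gc (below le)

-- Recoloring sequences

sorted-elems : ∀ {n} (W : FSet n) (r : Fin n → ℕ) →
  ∃[ vs ] (Unique vs × (∀ {v} → v ∈ vs → Mem W v) × (∀ {v} → Mem W v → v ∈ vs) × AllPairs (λ u v → r u ≤ r v) vs)
sorted-elems {n} W r = sort (elems W) , ↭ₛ.Unique-resp-↭ (setoid (Fin n)) (↭⇒↭ₛ (↭-sym (sort-↭ (elems W)))) (elems-unique W)
  , (λ m → ∈-elems⁻ W (∈-resp-↭ (sort-↭ (elems W)) m)) , (λ m → ∈-resp-↭ (↭-sym (sort-↭ (elems W))) (∈-elems⁺ W m))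
  , Sorted⇒AllPairs (DecTotalOrder.totalOrder O) (sort-↗ (elems W))
  where
  O = On.decTotalOrder ≤-decTotalOrder r
  open Sort O

module Rounds {n : ℕ} (Adj : Fin n → Fin n → Set) (Adj-sym : ∀ {u v} → Adj u v → Adj v u) (hs : List (Fin n)) where
  open Coloring Adj

  InH : Fin n → Set
  InH v = v ∈ hs

  InH? : ∀ v → Dec (InH v)
  InH? v = member? _≟ᶠ_ v hs

  update-same : ∀ c v a → update c v a v ≡ a
  update-same c v a with v ≟ᶠ v
  ... | yes _ = refl
  ... | no ne = contradiction refl ne

  update-other : ∀ c {v w} a → w ≢ v → update c v a w ≡ c w
  update-other c {v} {w} a ne with w ≟ᶠ v
  ... | yes e = contradiction e ne
  ... | no _ = refl

  apply-++ : ∀ xs ys c → apply c (xs ++ ys) ≡ apply (apply c xs) ys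
  apply-++ [] ys c = refl
  apply-++ ((v , a) ∷ xs) ys c = apply-++ xs ys (update c v a)

  proper-++ : ∀ {S : Fin n → Set} xs ys {c} → ProperSeqOn S c xs → ProperSeqOn S (apply c xs) ys → ProperSeqOn S c (xs ++ ys)
  proper-++ [] ys p q = q
  proper-++ (_ ∷ xs) ys (s , p , ps) q = s , p , proper-++ xs ys ps q

  apply-absent : ∀ rs {c v} → v ∉ map proj₁ rs → apply c rs v ≡ c v
  apply-absent [] _ = refl
  apply-absent ((w , a) ∷ rs) {c} ∉ = trans (apply-absent rs (∉ ∘ there)) (update-other c a (λ e → ∉ (here e)))

  module _ {c ψ δa δb : Fin n → ℕ} {r : Fin n → ℕ}
      (c-proper : ∀ {u v} → Adj u v → c u ≢ c v)
      (c-hs : ∀ {v} → InH v → c v ≡ δa v)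
      (ψ-proper : ∀ {u v} → ¬ InH u → ¬ InH v → Adj u v → ψ u ≢ ψ v)
      (ψ-order : ∀ {u v} → ¬ InH u → ¬ InH v → Adj u v → r u ≤ r v → ψ u ≢ c v)
      (ψ-a : ∀ {u v} → ¬ InH u → InH v → Adj u v → ψ u ≢ δa v)
      (ψ-b : ∀ {u v} → ¬ InH u → InH v → Adj u v → ψ u ≢ δb v)
      (inner : ∃[ rs ] Transforms InH δa δb rs) where
    private
      outside : FSet n
      outside = fset (λ v → ¬ InH v) (λ v → ¬? (InH? v))
      order = sorted-elems outside r
      vs = proj₁ order

      -- The state of a vertex while the vertices outside `H` move. A `done` vertex keeps the fact
      -- that its time is at most that of every vertex still waiting, the premise of `ψ-order`.
      data Status (rest : List (Fin n)) (e : Fin n → ℕ) (v : Fin n) : Set where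
        pending : v ∈ rest → ¬ InH v → e v ≡ c v → Status rest e v
        done    : ¬ InH v → (∀ {w} → w ∈ rest → r v ≤ r w) → e v ≡ ψ v → Status rest e v
        inH     : InH v → e v ≡ c v → Status rest e v

      status-proper : ∀ {rest e} → (∀ v → Status rest e v) → ProperOn Everything e
      status-proper {rest} {e} st u v _ _ adj eq = check (st u) (st v)
        where
        check : Status rest e u → Status rest e v → ⊥
        check (done hu _ eu) (done hv _ ev) = ψ-proper hu hv adj (trans (sym eu) (trans eq ev))
        check (done hu le eu) (pending m hv ev) = ψ-order hu hv adj (le m) (trans (sym eu) (trans eq ev))
        check (pending m hu eu) (done hv le ev) = ψ-order hv hu (Adj-sym adj) (le m) (trans (sym ev) (trans (sym eq) eu))
        check (done hu _ eu) (inH hv ev) = ψ-a hu hv adj (trans (sym eu) (trans eq (trans ev (c-hs hv))))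
        check (inH hu eu) (done hv _ ev) = ψ-a hv hu (Adj-sym adj) (trans (sym ev) (trans (sym eq) (trans eu (c-hs hu))))
        check (pending _ _ eu) (pending _ _ ev) = c-proper adj (trans (sym eu) (trans eq ev))
        check (pending _ _ eu) (inH _ ev) = c-proper adj (trans (sym eu) (trans eq ev))
        check (inH _ eu) (pending _ _ ev) = c-proper adj (trans (sym eu) (trans eq ev))
        check (inH _ eu) (inH _ ev) = c-proper adj (trans (sym eu) (trans eq ev))

      recolor : List (Fin n) → Recoloring
      recolor = map (λ v → v , ψ v)

      advance : ∀ {x rest e} → Unique (x ∷ rest) → AllPairs (λ u v → r u ≤ r v) (x ∷ rest) → ¬ InH x → (∀ v → Status (x ∷ rest) e v) →
        ∀ v → Status rest (update e x (ψ x)) v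
      advance {x} {rest} {e} (x∉ ∷ _) (x≤ ∷ _) hx st v = by (v ≟ᶠ x) (st v)
        where
        keep : ∀ {a} → v ≢ x → e v ≡ a → update e x (ψ x) v ≡ a
        keep ne eq = trans (update-other e (ψ x) ne) eq
        by : Dec (v ≡ x) → Status (x ∷ rest) e v → Status rest (update e x (ψ x)) v
        by (yes refl) _ = done hx (All.lookup x≤) (update-same e x (ψ x))
        by (no ne) (pending (here e') _ _) = contradiction e' ne
        by (no ne) (pending (there m) h eq) = pending m h (keep ne eq)
        by (no ne) (done h le eq) = done h (le ∘ there) (keep ne eq)
        by (no ne) (inH h eq) = inH h (keep ne eq)

      run : ∀ rest e → Unique rest → AllPairs (λ u v → r u ≤ r v) rest → (∀ {v} → v ∈ rest → ¬ InH v) → (∀ v → Status rest e v) →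
        ProperSeqOn Everything e (recolor rest) × (∀ v → Status [] (apply e (recolor rest)) v)
      run [] e _ _ _ st = tt , st
      run (x ∷ rest) e u@(_ ∷ u') s@(_ ∷ s') out st = let st' = advance u s (out (here refl)) st
                                                          p , q = run rest (update e x (ψ x)) u' s' (out ∘ there) st'
        in (tt , status-proper st' , p) , q

      first : ProperSeqOn Everything c (recolor vs) × (∀ v → Status [] (apply c (recolor vs)) v)
      first = run vs c (proj₁ (proj₂ order)) (proj₂ (proj₂ (proj₂ (proj₂ order)))) (proj₁ (proj₂ (proj₂ order))) start
        where
        start : ∀ v → Status vs c v
        start v with InH? v
        ... | yes h = inH h refl
        ... | no ¬h = pending (proj₁ (proj₂ (proj₂ (proj₂ order))) ¬h) ¬h refl

      mid : Fin n → ℕ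
      mid = apply c (recolor vs)

      -- The given sequence runs on `H` alone in `d` and on the whole graph in `e`. Every vertex of
      -- `H` shows only its colour before or after the round, and `ψ` avoids both.
      second : ∀ rs d e → ProperSeqOn InH d rs → Unique (map proj₁ rs) → (∀ {v} → InH v → apply d rs v ≡ δb v) →
        (∀ {v} → InH v → e v ≡ d v) → (∀ {v} → InH v → d v ≡ δa v ⊎ d v ≡ δb v) → (∀ {v} → ¬ InH v → e v ≡ ψ v) →
        ProperSeqOn Everything e rs × (∀ {v} → InH v → apply e rs v ≡ δb v) × (∀ {v} → ¬ InH v → apply e rs v ≡ ψ v) × All (λ p → InH (proj₁ p)) rs
      second [] d e _ _ fin eh dab eo = tt , (λ h → trans (eh h) (fin h)) , eo , []
      second ((x , a) ∷ rs) d e (hx , pd , ps) (x∉ ∷ u) fin eh dab eo =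
        let p , q , s , t = second rs (update d x a) (update e x a) ps u fin eh' dab' eo' in (tt , proper' , p) , q , s , hx ∷ t
        where
        -- A vertex is recolored only once, so the colour it receives here is its final one.
        a≡ : a ≡ δb x
        a≡ = trans (sym (update-same d x a)) (trans (sym (apply-absent rs {update d x a} (λ m → All.lookup x∉ m refl))) (fin hx))
        eh' : ∀ {v} → InH v → update e x a v ≡ update d x a v
        eh' {v} h = by (v ≟ᶠ x)
          where
          by : Dec (v ≡ x) → update e x a v ≡ update d x a v
          by (yes refl) = trans (update-same e x a) (sym (update-same d x a))
          by (no ne) = trans (update-other e a ne) (trans (eh h) (sym (update-other d a ne)))
        dab' : ∀ {v} → InH v → update d x a v ≡ δa v ⊎ update d x a v ≡ δb v
        dab' {v} h = by (v ≟ᶠ x)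
          where
          by : Dec (v ≡ x) → update d x a v ≡ δa v ⊎ update d x a v ≡ δb v
          by (yes refl) = inj₂ (trans (update-same d x a) a≡)
          by (no ne) = [ inj₁ ∘ trans (update-other d a ne) , inj₂ ∘ trans (update-other d a ne) ]′ (dab h)
        eo' : ∀ {v} → ¬ InH v → update e x a v ≡ ψ v
        eo' {v} h = trans (update-other e a (λ { refl → h hx })) (eo h)
        mixed : ∀ {u v} → ¬ InH u → InH v → Adj u v → update e x a u ≢ update e x a v
        mixed hu hv adj eq with dab' hv
        ... | inj₁ da = ψ-a hu hv adj (trans (sym (eo' hu)) (trans eq (trans (eh' hv) da)))
        ... | inj₂ db = ψ-b hu hv adj (trans (sym (eo' hu)) (trans eq (trans (eh' hv) db)))
        proper' : ProperOn Everything (update e x a)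
        proper' u v _ _ adj eq = by (InH? u) (InH? v)
          where
          by : Dec (InH u) → Dec (InH v) → ⊥
          by (yes hu) (yes hv) = pd u v hu hv adj (trans (sym (eh' hu)) (trans eq (eh' hv)))
          by (yes hu) (no hv) = mixed hv hu (Adj-sym adj) (sym eq)
          by (no hu) (yes hv) = mixed hu hv adj eq
          by (no hu) (no hv) = ψ-proper hu hv adj (trans (sym (eo' hu)) (trans eq (eo' hv)))

    round : ∀ c' → (∀ {v} → InH v → c' v ≡ δb v) → (∀ {v} → ¬ InH v → c' v ≡ ψ v) → ∃[ rs ] (Transforms Everything c c' rs × Late InH rs)
    round c' c'-hs c'-out = xs ++ ys
      , ( proper-++ xs ys (proj₁ first) (proj₁ last) , once , λ v _ → trans (cong (λ f → f v) (apply-++ xs ys c)) (final v))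
      , xs , ys , refl , All.tabulate (λ m → let v , v∈ , e = ∈-map⁻ (λ v → v , ψ v) m in
            subst (λ p → ¬ InH (proj₁ p)) (sym e) (proj₁ (proj₂ (proj₂ order)) v∈)) , proj₂ (proj₂ (proj₂ last))
      where
      xs = recolor vs
      ys = proj₁ inner
      inner-transforms = proj₂ inner
      mid-hs : ∀ {v} → InH v → mid v ≡ δa v
      mid-hs {v} h with proj₂ first v
      ... | done ¬h _ _ = contradiction h ¬h
      ... | inH _ e = trans e (c-hs h)
      mid-out : ∀ {v} → ¬ InH v → mid v ≡ ψ v
      mid-out {v} h with proj₂ first v
      ... | done _ _ e = e
      ... | inH h' _ = contradiction h' h
      last : ProperSeqOn Everything mid ys × (∀ {v} → InH v → apply mid ys v ≡ δb v) × (∀ {v} → ¬ InH v → apply mid ys v ≡ ψ v) × All (λ p → InH (proj₁ p)) ys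
      last = second ys δa mid (proj₁ inner-transforms) (proj₁ (proj₂ inner-transforms)) (λ {v} h → proj₂ (proj₂ inner-transforms) v h)
        mid-hs (λ _ → inj₁ refl) mid-out
      final : ∀ v → apply mid ys v ≡ c' v
      final v with InH? v
      ... | yes h = trans (proj₁ (proj₂ last) h) (sym (c'-hs h))
      ... | no ¬h = trans (proj₁ (proj₂ (proj₂ last)) ¬h) (sym (c'-out ¬h))
      names : ∀ us → map proj₁ (recolor us) ≡ us
      names [] = refl
      names (u ∷ us) = cong (u ∷_) (names us)
      once : OnceOnly (xs ++ ys)
      once = subst Unique (sym (trans (map-++ proj₁ xs ys) (cong (_++ map proj₁ ys) (names vs))))
        (Unique.++⁺ (proj₁ (proj₂ order)) (proj₁ (proj₂ inner-transforms)) λ (m , m') →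
          let p , p∈ , e = ∈-map⁻ proj₁ m' in proj₁ (proj₂ (proj₂ order)) m (subst InH (sym e) (All.lookup (proj₂ (proj₂ (proj₂ last))) p∈)))

-- Completeness of the connectivity test

module Connectivity {n : ℕ} (M : Map n) where
  open Map M hiding (φ)

  private
    R : ℕ → Fin n → FSet n
    R k u = fset (λ v → T (reachB k u v)) (λ v → T? (reachB k u v))

    Closed : ℕ → Fin n → Set
    Closed k u = ∀ {v w} → T (reachB k u v) → Adj v w → T (reachB k u w)

    next-reach : ∀ k {u v w} → T (reachB k u v) → Adj v w → T (reachB (suc k) u w)
    next-reach k {u} {v} {w} t (x , tx , hx) = T-∨⁺ʳ {reachB k u w} (anyFin⁺ v (T-∧⁺ {reachB k u v} t (anyFin⁺ x (T-∧⁺ {eqF (tail x) v} (eqF⁺ tx) (eqF⁺ hx)))))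

    closed-suc : ∀ k {u} → Closed k u → Closed (suc k) u
    closed-suc k {u} c {v} {w} t adj with T-∨⁻ {reachB k u v} t
    ... | inj₁ p = T-∨⁺ˡ {reachB k u w} (c p adj)
    ... | inj₂ q with anyFin⁻ q
    ...   | y , a with T-∧⁻ {reachB k u y} a
    ...     | p , b with anyFin⁻ b
    ...       | x , e with T-∧⁻ {eqF (tail x) y} e
    ...         | tx , hx = T-∨⁺ˡ {reachB k u w} (c (c p (x , eqF⁻ tx , eqF⁻ hx)) adj)

    -- A ball that is not closed under adjacency gains a vertex when its radius grows; this cannot
    -- go on for `n` steps.
    grows : ∀ k u → Closed k u ⊎ suc k ≤ ∣ R k u ∣
    grows zero u = inj₂ (unique-⊆-length {xs = u ∷ []} ([] ∷ []) λ { (here refl) → ∈-elems⁺ (R 0 u) (eqF⁺ {a = u} refl) })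
    grows (suc k) u with grows k u
    ... | inj₁ c = inj₁ (closed-suc k c)
    ... | inj₂ le with anyᶠ? (λ w → ¬? (T? (reachB k u w)) ×-dec T? (reachB (suc k) u w))
    ...   | yes (w , w∉ , w∈) = inj₂ (≤-trans (s≤s le) (size-< (R k u) (R (suc k) u) (λ {v} → T-∨⁺ˡ {reachB k u v}) w∈ w∉))
    ...   | no none = inj₁ (closed-suc k λ {v} {w} t adj → decidable-stable (T? (reachB k u w)) (λ ∉ → none (w , ∉ , next-reach k t adj)))

    closed : ∀ u → Closed n u
    closed u with grows n u
    ... | inj₁ c = c
    ... | inj₂ le = contradiction (size-≤n (R n u)) (<⇒≱ le)

    self : ∀ k u → T (reachB k u u)
    self zero u = eqF⁺ {a = u} refl
    self (suc k) u = T-∨⁺ˡ {reachB k u u} (self k u)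

  Connected : Fin n → Fin n → Set
  Connected = Star Adj

  connected⇒connB : ∀ {u v} → Connected u v → T (connB u v)
  connected⇒connB {u} = go (self n u)
    where
    go : ∀ {w v} → T (connB u w) → Connected w v → T (connB u v)
    go t ε = t
    go t (adj ◅ p) = go (closed u t adj) p

-- From the outer face to the blob

T-not⁻ : ∀ {b} → T b → ¬ T (not b)
T-not⁻ {true} _ ()

module Lifting (S : Scene) (valid : Scene.Valid S) where
  open Scene S
  open PlaneGraph G using (outer; OnOuter; Internal; outer-closed; outer-one; ConsecutiveOnOuter) renaming (rot to M; genus0 to euler)
  open Map M
  open Jordan M euler using (tail-φ)
  open Minors M euler
  open Induct M euler φ0
  open Rounds Adj Adj-sym hs hiding (InH)
  open Connectivity M
  open Coloring Adj

  lists-ok : ∀ v → OK (L1 v) (L2 v)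
  lists-ok v = record { unique₁ = L1-unique v ; unique₂ = L2-unique v ; nearly⊆ = λ p q r s → proj₁ (proj₁ (proj₂ valid) v) _ _ p q r s
    ; six = proj₁ (proj₂ (proj₁ (proj₂ valid) v)) ; seven = proj₂ (proj₂ (proj₁ (proj₂ valid) v)) }

  onOuter? : ∀ v → Dec (OnOuter v)
  onOuter? v = (T? (isolatedB v) ×-dec T? (PlaneGraph.outerIso G v)) ⊎-dec anyᶠ? (λ x → (tail x ≟ᶠ v) ×-dec T? (outer x))

  weak-outer : ∀ {v} → Weak L1 L2 v → OnOuter v
  weak-outer {v} wk with onOuter? v
  ... | yes o = o
  ... | no ¬o = contradiction (proj₁ (proj₂ (proj₂ valid)) v ¬o) wk

  isolated : ∀ {v w} → T (isolatedB v) → ¬ Adj v w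
  isolated iso (x , t , _) = T-not⁻ (anyFin⁺ x (eqF⁺ t)) iso

  first-step : ∀ {u v} → Connected u v → u ≢ v → ∃[ w ] Adj u w
  first-step ε ne = contradiction refl ne
  first-step (adj ◅ _) _ = _ , adj

  walk-connected : ∀ {A a b} → Walk A a b → Connected (base a) (base b)
  walk-connected (stop _) = ε
  walk-connected {b = b} (move s _ w) = single s ◅◅ walk-connected w
    where
    single : ∀ s → Connected (base (src s)) (base (dst s))
    single (E x) = (x , refl , refl) ◅ ε
    single (S⁺ x) = ε
    single (S⁻ x) = ε
    single (R⁺ x) = (x , refl , sym (tail-φ x)) ◅ ε
    single (R⁻ x) = Adj-sym (x , refl , sym (tail-φ x)) ◅ ε

  -- The initial blob: the corners of the outer face in the component of v₀.
  Outside : Fin n → Node → Set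
  Outside v₀ (V _) = ⊥
  Outside v₀ (K z) = T (outer z) × Connected v₀ (tail z)

  outside-φ : ∀ {v₀ z} → Outside v₀ (K z) → Outside v₀ (K (φ z))
  outside-φ {z = z} (o , c) = subst T (sym (outer-closed z)) o , c ◅◅ ((z , refl , sym (tail-φ z)) ◅ ε)

  outside-iter : ∀ {v₀ z} k → Outside v₀ (K z) → Walk (Outside v₀) (K z) (K (iter φ k z))
  outside-iter zero o = stop o
  outside-iter {v₀} {z} (suc k) o = w ++ʷ move (R⁺ (iter φ k z)) (end w) (stop (outside-φ (end w)))
    where
    w = outside-iter k o
    end : ∀ {a b} → Walk (Outside v₀) a b → Outside v₀ b
    end (stop m) = m
    end (move _ _ w) = end w

  -- By `outer-one` the outer darts of one component form a single face orbit, and its corners are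
  -- linked by rims.
  conn-outside : ∀ {v₀} → Conn (Outside v₀)
  conn-outside {v₀} (K z) (K z') (o , c) (o' , c') with anyFin⁻ {d} {λ k → eqF (iter φ (toℕ k) z) z'} (outer-one z z' o o' (connected⇒connB (reverse Adj-sym c ◅◅ c')))
  ... | k , e = subst (λ y → Walk (Outside v₀) (K z) (K y)) (eqF⁻ e) (outside-iter (toℕ k) (o , c))

  W : FSet n
  W = fset (λ v → ¬ InH v) (λ v → ¬? (InH? v))

  -- A weak vertex lies on the outer face. If it is not isolated, an outer dart at it gives a corner
  -- and thus a spoke to the blob; an isolated vertex has no corner.
  base-outside : ∀ (D : FSet n) {v₀} → (∀ {v} → Mem D v → Connected v₀ v) → (∀ {v} → Mem D v → ¬ T (isolatedB v)) → Base D L1 L2 (Outside v₀)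
  base-outside D {v₀} connected ¬iso = record
    { ok = λ {v} _ → lists-ok v
    ; weak-B = λ m wk → by m (weak-outer wk)
    ; conn-B = conn-outside
    ; W∉B = λ _ () }
    where
    by : ∀ {v} → Mem D v → OnOuter v → ⟦ v ⟧ ~ Outside v₀
    by m (inj₁ (iso , _)) = contradiction iso (¬iso m)
    by m (inj₂ (x , refl , o)) = link (S⁺ x) refl (o , connected m)

  -- `L1 v` has at least six colours and the union at most six. If no colour of the list survived,
  -- the two sets would coincide, which (Gc) forbids.
  gc-top : length hs ≡ 3 → ∀ {D} → Gc D L1 δ1 hs
  gc-top len₃ {D} {v} _ adjs with any? (λ a → ¬? (member? ℕ._≟_ a F)) (L1 v)
    where F = flatten (pair φ0 δ1) hs
  ... | yes p = let a , a∈ , ∉ = find p in a , a∈ , λ p∈ → (λ e → ∉ (flatten-∈ _ p∈ (here e))) , λ e → ∉ (flatten-∈ _ p∈ (there (here e)))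
    where
    F = flatten (pair φ0 δ1) hs
  ... | no all∈F = ⊥-elim (proj₂ (proj₂ (proj₂ valid)) len₃ v (λ u u∈ → adjs u∈) λ a → mk⇔ (to a) (from a))
    where
    F = flatten (pair φ0 δ1) hs
    L⊆F : ∀ {a} → a ∈ L1 v → a ∈ F
    L⊆F {a} a∈ with member? ℕ._≟_ a F
    ... | yes m = m
    ... | no ∉ = contradiction (lose a∈ ∉) all∈F
    F⊆L : ∀ {a} → a ∈ F → a ∈ L1 v
    F⊆L {a} a∈ with member? ℕ._≟_ a (L1 v)
    ... | yes m = m
    ... | no ∉ = contradiction (unique-⊆-length {xs = a ∷ L1 v} (All.tabulate (λ m e → ∉ (subst (_∈ L1 v) (sym e) m)) ∷ L1-unique v) λ { (here refl) → a∈ ; (there m) → L⊆F m })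
          (<⇒≱ (s≤s (≤-trans (flatten-length (pair φ0 δ1) 2 hs (λ _ → ≤-refl)) (≤-trans (≤-reflexive (cong (_* 2) len₃)) (six (lists-ok v))))))
    to : ∀ a → a ∈ L1 v → ∃[ u ] (u ∈ hs × (a ≡ δ0 u ⊎ a ≡ δ1 u))
    to a a∈ with flatten-∈⁻ (pair φ0 δ1) hs (L⊆F a∈)
    ... | u , u∈ , here e = u , u∈ , inj₁ (trans e (sym (δ0-start u u∈)))
    ... | u , u∈ , there (here e) = u , u∈ , inj₂ e
    from : ∀ a → ∃[ u ] (u ∈ hs × (a ≡ δ0 u ⊎ a ≡ δ1 u)) → a ∈ L1 v
    from a (u , u∈ , inj₁ e) = F⊆L (flatten-∈ _ u∈ (here (trans e (δ0-start u u∈))))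
    from a (u , u∈ , inj₂ e) = F⊆L (flatten-∈ _ u∈ (there (here e)))

  -- The outer walk that runs through the coloured vertices has a corner at each of them, whose
  -- spoke attaches the ends to the blob.
  path-head : ∀ {D v₀ x} l → l ≡ map (λ i → tail (iter φ i x)) (upTo (length l)) → length l ≤ 3 → Unique l → T (outer x) →
    (∀ {p} → p ∈ l → ¬ Mem D p) → (∃[ p ] (p ∈ l × Connected v₀ p)) → (length l ≡ 3 → Gc D L1 δ1 l) → Head D L1 L2 (Outside v₀) δ1 l
  path-head [] _ _ _ _ _ _ _ = none
  path-head (a ∷ []) _ _ _ _ out _ _ = one (out (here refl) , λ ())
  path-head {D} {v₀} {x} (_ ∷ _ ∷ []) refl _ _ o out (p , p∈ , c) _ =
    two (out (here refl) , λ ()) (out (there (here refl)) , λ ()) xy (λ _ → link (S⁺ x) refl (o , c ◅◅ back p∈))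
    where
    xy : Adj (tail x) (tail (φ x))
    xy = x , refl , sym (tail-φ x)
    back : ∀ {p} → p ∈ tail x ∷ tail (φ x) ∷ [] → Connected p (tail x)
    back (here refl) = ε
    back (there (here refl)) = Adj-sym xy ◅ ε
  path-head {D} {v₀} {x} (_ ∷ _ ∷ _ ∷ []) refl _ ((_ ∷ x≢z ∷ []) ∷ _) o out (p , p∈ , c) gc =
    three (out (here refl) , λ ()) (out (there (here refl)) , λ ()) (out (there (there (here refl))) , λ ()) xy yz x≢z
      (λ _ → link (S⁺ x) refl at-x) (λ _ → link (S⁺ (φ (φ x))) refl (outside-φ (outside-φ at-x))) (gc refl)
    where
    xy : Adj (tail x) (tail (φ x))
    xy = x , refl , sym (tail-φ x)
    yz : Adj (tail (φ x)) (tail (φ (φ x)))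
    yz = φ x , refl , sym (tail-φ (φ x))
    back : ∀ {p} → p ∈ tail x ∷ tail (φ x) ∷ tail (φ (φ x)) ∷ [] → Connected p (tail x)
    back (here refl) = ε
    back (there (here refl)) = Adj-sym xy ◅ ε
    back (there (there (here refl))) = Adj-sym yz ◅ Adj-sym xy ◅ ε
    at-x : Outside v₀ (K x)
    at-x = o , c ◅◅ back p∈
  path-head (_ ∷ _ ∷ _ ∷ _ ∷ _) _ (s≤s (s≤s (s≤s ()))) _ _ _ _ _

  head-top : ∀ D {v₀ p} → (∀ {q} → q ∈ hs → ¬ Mem D q) → p ∈ hs → Connected v₀ p → Head D L1 L2 (Outside v₀) δ1 hs
  head-top D {v₀} {p} out p∈ c with hs-consecutive
  ... | inj₁ e = subst (Head D L1 L2 (Outside v₀) δ1) (sym e) none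
  ... | inj₂ (inj₁ (v , e , _)) = subst (Head D L1 L2 (Outside v₀) δ1) (sym e) (one (out (subst (v ∈_) (sym e) (here refl)) , λ ()))
  ... | inj₂ (inj₂ (x , o , e)) = path-head {D} hs e (proj₁ valid) hs-unique o out (p , p∈ , c) (λ l → gc-top l {D})

  Part : FSet n → Set
  Part D = Solvable D L1 L2 hs δ1 δ2

  module _ (D : FSet n) (comp : Component W D) where
    linked : ∀ {u v} → Mem D u → Mem D v → Connected u v
    linked m m' = walk-connected (conn comp _ _ m m')

    attached : ∀ {w p} → Mem D w → p ∈ hs → Adj w p → Part D
    attached {w} {p} w∈ p∈ adj = solvable _ D L1 L2 (Outside w) hs δ1 δ2
      (base-outside D (linked w∈) (λ m iso → let _ , a = first-step (linked m w∈ ◅◅ (adj ◅ ε)) (λ e → inside comp m (subst InH (sym e) p∈)) in isolated iso a))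
      (head-top D (λ q∈ m → inside comp m q∈) p∈ (adj ◅ ε)) ≤-refl

    -- An isolated vertex, having no corner, is coloured directly; any other component is a scene
    -- without coloured vertices.
    detached : (∀ {w p} → Mem D w → p ∈ hs → ¬ Adj w p) → ∀ {v₀} → Mem D v₀ → Part D
    detached ¬att {v₀} v₀∈ with T? (isolatedB v₀)
    ... | yes iso = weaken only (λ _ h → h) (λ _ h → h) (single-sol v₀
          (proj₂ (one-member (≤-trans (s≤s z≤n) (six (lists-ok v₀)))) , λ p∈ adj → contradiction adj (isolated iso))
          (proj₂ (one-member (≤-trans (s≤s z≤n) (seven (lists-ok v₀)))) , λ p∈ adj → contradiction adj (isolated iso)))
      where
      only : ∀ {v} → Mem D v → v ≡ v₀
      only {v} m with v₀ ≟ᶠ v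
      ... | yes e = sym e
      ... | no ne = contradiction (proj₂ (first-step (linked v₀∈ m) ne)) (isolated iso)
    ... | no ¬iso = weaken id (λ m (a∈ , _) → a∈ , λ p∈ adj → contradiction adj (¬att m p∈)) (λ m (a∈ , _) → a∈ , λ p∈ adj → contradiction adj (¬att m p∈))
          (solvable _ D L1 L2 (Outside v₀) [] δ1 δ2 (base-outside D (linked v₀∈) proper) none ≤-refl)
      where
      proper : ∀ {v} → Mem D v → ¬ T (isolatedB v)
      proper {v} m iso with v ≟ᶠ v₀
      ... | yes refl = ¬iso iso
      ... | no ne = isolated iso (proj₂ (first-step (linked m v₀∈) ne))

    part : Part D
    part with anyᶠ? (λ w → mem? D w ×-dec anyᶠ? (λ p → InH? p ×-dec Adj? w p)) | anyᶠ? (mem? D)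
    ... | yes (w , w∈ , p , p∈ , adj) | _ = attached w∈ p∈ adj
    ... | no _ | no empty = empty-sol (λ v m → empty (v , m))
    ... | no ¬att | yes (v₀ , v₀∈) = detached (λ m p∈ adj → ¬att (_ , m , _ , p∈ , adj)) v₀∈

  open Sol (by-components W part)

  H : FSet n
  H = fset InH InH?

  c₁ c₂ : Fin n → ℕ
  c₁ = onto H δ1 φ₁
  c₂ = onto H δ2 φ₂

  coloring : ∀ (δ ψ : Fin n → ℕ) L → LColOn InH L δ → (∀ {v} → ¬ InH v → ψ v ∈ L v) → (∀ {u v} → ¬ InH u → ¬ InH v → Adj u v → ψ u ≢ ψ v) →
    (∀ {u v} → ¬ InH u → InH v → Adj u v → ψ u ≢ δ v) → LColOn Everything L (onto H δ ψ)
  coloring δ ψ L (pδ , inδ) inψ pψ mixed = (λ u v _ _ adj e → proper u v adj e (InH? u) (InH? v)) , λ v _ → member v (InH? v)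
    where
    proper : ∀ u v → Adj u v → onto H δ ψ u ≡ onto H δ ψ v → Dec (InH u) → Dec (InH v) → ⊥
    proper u v adj e (yes a) (yes b) = pδ u v a b adj (trans (sym (onto-in H a)) (trans e (onto-in H b)))
    proper u v adj e (yes a) (no b) = mixed b a (Adj-sym adj) (trans (sym (onto-out H b)) (trans (sym e) (onto-in H a)))
    proper u v adj e (no a) (yes b) = mixed a b adj (trans (sym (onto-out H a)) (trans e (onto-in H b)))
    proper u v adj e (no a) (no b) = pψ a b adj (trans (sym (onto-out H a)) (trans e (onto-out H b)))
    member : ∀ v → Dec (InH v) → onto H δ ψ v ∈ L v
    member v (yes a) = subst (_∈ L v) (sym (onto-in H a)) (inδ v a)
    member v (no a) = subst (_∈ L v) (sym (onto-out H a)) (inψ a)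

  δ1-color = proj₁ (proj₂ δ-trajectory)
  δ2-color = proj₁ (proj₂ (proj₂ δ-trajectory))

  c₁-color : LColOn Everything L1 c₁
  c₁-color = coloring δ1 φ₁ L1 δ1-color (λ m → proj₁ (in₁ m)) proper₁ (λ a b adj → proj₂ (proj₂ (in₁ a) b adj))

  c₂-color : LColOn Everything L2 c₂
  c₂-color = coloring δ2 φ₂ L2 δ2-color (λ m → proj₁ (in₂ m)) proper₂ (λ a b adj → proj₂ (proj₂ (in₂ a) b adj))

  lifts : HasTrajectory
  lifts = c₁ , c₂ , φ0-proper , c₁-color , c₂-color
    , round {r = r₁} (λ {u} {v} → φ0-proper u v tt tt) (λ {v} h → sym (δ0-start v h)) proper₁ order₁
        (λ a b adj e → proj₁ (proj₂ (in₁ a) b adj) (trans e (δ0-start _ b))) (λ a b adj → proj₂ (proj₂ (in₁ a) b adj))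
        (proj₁ (proj₂ (proj₂ (proj₂ δ-trajectory)))) c₁ (onto-in H) (onto-out H)
    , round {r = r₂} (λ {u} {v} → proj₁ c₁-color u v tt tt) (onto-in H) proper₂
        (λ a b adj le e → order₂ a b adj le (trans e (onto-out H b)))
        (λ a b adj → proj₁ (proj₂ (in₂ a) b adj)) (λ a b adj → proj₂ (proj₂ (in₂ a) b adj))
        (proj₂ (proj₂ (proj₂ (proj₂ δ-trajectory)))) c₂ (onto-in H) (onto-out H)
    , λ v h → δ0-start v h , sym (onto-in H h) , sym (onto-in H h)

theorem15 : (S : Scene) → Scene.Valid S → Scene.HasTrajectory S
theorem15 S valid = Lifting.lifts S valid
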